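{- For each $H \in \{P_1+P_5,\ S_{1,2,2},\ P_1+P_2+P_3\}$, the class of $(K_3,H)$-free graphs has bounded clique-width.
   Context: All graphs are finite, undirected, without multiple edges or self-loops. $G+H$ denotes the disjoint union of $G$ and $H$, $P_r$ the path on $r$ vertices, $K_3$ the triangle. $S_{1,2,2}$ is the tree with exactly one vertex $x$ of degree $3$ and exactly three leaves, at distances $1,2,2$ from $x$. A graph is $(H_1,H_2)$-free if it has no induced subgraph isomorphic to $H_1$ or $H_2$. The clique-width of a graph $G$ is the minimum number of labels needed to construct $G$ using the operations: creating a new single vertex with label $i$; taking the disjoint union of two labelled graphs; joining each vertex with label $i$ to each vertex with label $j$ ($i\ne j$); renaming label $i$ to $j$. A class of graphs has bounded clique-width if there is a constant $c$ such that every graph in it has clique-width at most $c$. -}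

module Defs where

open import Data.Fin using (Fin; toℕ; splitAt; _≟_)
open import Data.Fin.Patterns using (0F; 1F; 2F; 3F; 4F; 5F)
open import Data.List using (List; []; _∷_)
open import Data.List.Membership.Propositional using (_∈_)
open import Data.List.Relation.Unary.All using (All; []; _∷_; lookup)
import Data.List.Membership.DecPropositional as DecMembership
open import Data.Nat using (ℕ; suc; _+_; _≤_; NonZero)
import Data.Nat.Properties as ℕ
open import Data.Product using (Σ; ∃-syntax; _×_; _,_; uncurry)
open import Data.Product.Properties using (≡-dec)
open import Data.Sum using (_⊎_; inj₁; inj₂; [_,_]; [_,_]′; swap)
open import Data.Sum.Relation.Binary.Pointwise
  using (Pointwise; inj₁; inj₂; ⊎-symmetric; ⊎-decidable)
open import Function using (_∘_; Injective; Inverse; _⇔_; _↔_)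
open import Relation.Binary using (Decidable; Symmetric)
open import Relation.Binary.PropositionalEquality using (_≡_; _≢_; refl; sym; trans)
open import Relation.Nullary using (¬_; yes; no; ¬?; _×-dec_; _⊎-dec_)

record Graph (n : ℕ) : Set₁ where
  field
    Adj        : Fin n → Fin n → Set
    adj?       : Decidable Adj
    adj-sym    : Symmetric Adj
    adj-irrefl : ∀ {v} → ¬ Adj v v

open Graph

infix 4 _≅_ _⊴_
infixl 6 _⊕_

_≅_ : ∀ {m n} → Graph m → Graph n → Set
_≅_ {m} {n} G H =
  Σ (Fin m ↔ Fin n) λ f → ∀ u v → Adj G u v ⇔ Adj H (Inverse.to f u) (Inverse.to f v)

-- H is isomorphic to an induced subgraph of G, namely the one on the image of f.
_⊴_ : ∀ {m n} → Graph m → Graph n → Set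
_⊴_ {m} {n} H G =
  Σ (Fin m → Fin n) λ f → Injective _≡_ _≡_ f × (∀ u v → Adj H u v ⇔ Adj G (f u) (f v))

GraphClass : Set₁
GraphClass = ∀ {n} → Graph n → Set

Free : ∀ {m n} → Graph m → Graph n → GraphClass
Free H₁ H₂ G = ¬ (H₁ ⊴ G) × ¬ (H₂ ⊴ G)

_⊕_ : ∀ {m n} → Graph m → Graph n → Graph (m + n)
Adj        (_⊕_ {m} G H) u v = Pointwise (Adj G) (Adj H) (splitAt m u) (splitAt m v)
adj?       (_⊕_ {m} G H) u v = ⊎-decidable (adj? G) (adj? H) (splitAt m u) (splitAt m v)
adj-sym    (G ⊕ H)           = ⊎-symmetric (adj-sym G) (adj-sym H)
adj-irrefl (_⊕_ {m} G H) {w} with splitAt m w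
... | inj₁ _ = λ { (inj₁ e) → adj-irrefl G e }
... | inj₂ _ = λ { (inj₂ e) → adj-irrefl H e }

P : (r : ℕ) → Graph r
Adj        (P r) i j = suc (toℕ i) ≡ toℕ j ⊎ suc (toℕ j) ≡ toℕ i
adj?       (P r) i j = (suc (toℕ i) ℕ.≟ toℕ j) ⊎-dec (suc (toℕ j) ℕ.≟ toℕ i)
adj-sym    (P r)     = swap
adj-irrefl (P r)     = [ ℕ.1+n≢n , ℕ.1+n≢n ]

K : (n : ℕ) → Graph n
Adj        (K n) i j     = i ≢ j
adj?       (K n) i j     = ¬? (i ≟ j)
adj-sym    (K n) i≢j     = i≢j ∘ sym
adj-irrefl (K n) v≢v     = v≢v refl

fromEdges : ∀ {n} (es : List (Fin n × Fin n)) → All (uncurry _≢_) es → Graph n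
Adj        (fromEdges es loopless) u v = (u , v) ∈ es ⊎ (v , u) ∈ es
adj?       (fromEdges es loopless) u v = ((u , v) ∈? es) ⊎-dec ((v , u) ∈? es)
  where open DecMembership (≡-dec _≟_ _≟_) using (_∈?_)
adj-sym    (fromEdges es loopless)     = swap
adj-irrefl (fromEdges es loopless)     =
  [ (λ e → lookup loopless e refl) , (λ e → lookup loopless e refl) ]

-- The vertex of degree 3 is 0F; the leaves are 1F, 3F and 5F.
S₁₂₂ : Graph 6
S₁₂₂ = fromEdges
  ((0F , 1F) ∷ (0F , 2F) ∷ (2F , 3F) ∷ (0F , 4F) ∷ (4F , 5F) ∷ [])
  ((λ ()) ∷ (λ ()) ∷ (λ ()) ∷ (λ ()) ∷ (λ ()) ∷ [])

record LabelledGraph (k n : ℕ) : Set₁ where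
  field
    graph : Graph n
    label : Fin n → Fin k

open LabelledGraph

data Expr (k : ℕ) : ℕ → Set where
  vertex : (i : Fin k) → Expr k 1
  union  : ∀ {m n} → Expr k m → Expr k n → Expr k (m + n)
  join   : ∀ {n} (i j : Fin k) → i ≢ j → Expr k n → Expr k n
  rename : ∀ {n} (i j : Fin k) → Expr k n → Expr k n

joinLabels : ∀ {k n} (i j : Fin k) → i ≢ j → LabelledGraph k n → Graph n
Adj (joinLabels i j _ L) u v =
  Adj (graph L) u v ⊎ (label L u ≡ i × label L v ≡ j) ⊎ (label L u ≡ j × label L v ≡ i)
adj? (joinLabels i j _ L) u v =
  adj? (graph L) u v ⊎-dec
  ((label L u ≟ i) ×-dec (label L v ≟ j)) ⊎-dec
  ((label L u ≟ j) ×-dec (label L v ≟ i))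
adj-sym (joinLabels i j _ L) (inj₁ e)                 = inj₁ (adj-sym (graph L) e)
adj-sym (joinLabels i j _ L) (inj₂ (inj₁ (u≡i , v≡j))) = inj₂ (inj₂ (v≡j , u≡i))
adj-sym (joinLabels i j _ L) (inj₂ (inj₂ (u≡j , v≡i))) = inj₂ (inj₁ (v≡i , u≡j))
adj-irrefl (joinLabels i j _ L) (inj₁ e)                   = adj-irrefl (graph L) e
adj-irrefl (joinLabels i j i≢j L) (inj₂ (inj₁ (v≡i , v≡j))) = i≢j (trans (sym v≡i) v≡j)
adj-irrefl (joinLabels i j i≢j L) (inj₂ (inj₂ (v≡j , v≡i))) = i≢j (trans (sym v≡i) v≡j)

renameLabel : ∀ {k} (i j : Fin k) → Fin k → Fin k
renameLabel i j l with l ≟ i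
... | yes _ = j
... | no  _ = l

⟦_⟧ : ∀ {k n} → Expr k n → LabelledGraph k n
⟦ vertex i ⟧ = record
  { graph = P 1
  ; label = λ _ → i
  }
⟦ union {m} e₁ e₂ ⟧ = record
  { graph = graph ⟦ e₁ ⟧ ⊕ graph ⟦ e₂ ⟧
  ; label = [ label ⟦ e₁ ⟧ , label ⟦ e₂ ⟧ ]′ ∘ splitAt m
  }
⟦ join i j i≢j e ⟧ = record
  { graph = joinLabels i j i≢j ⟦ e ⟧
  ; label = label ⟦ e ⟧
  }
⟦ rename i j e ⟧ = record
  { graph = graph ⟦ e ⟧
  ; label = renameLabel i j ∘ label ⟦ e ⟧
  }

Constructible : ∀ {n} → ℕ → Graph n → Set
Constructible {n} k G = ∃[ e ] graph (⟦_⟧ {k} {n} e) ≅ G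

IsCliqueWidth : ∀ {n} → Graph n → ℕ → Set
IsCliqueWidth G w = Constructible w G × (∀ k → Constructible k G → w ≤ k)

-- No expression builds the graph without vertices, so it has no clique-width;
-- hence the restriction to NonZero n.
BoundedCliqueWidth : GraphClass → Set₁
BoundedCliqueWidth C =
  ∃[ c ] ∀ n .{{_ : NonZero n}} (G : Graph n) → C G → ∃[ w ] IsCliqueWidth G w × w ≤ c

-- A class has bounded clique-width as soon as its members can be split recursively into two parts whose mutual adjacencies
-- depend only on boundedly many labels. In a connected (K₃,H)-free graph take an induced copy of a small base graph: one of
-- four graphs e₁, …, e₄ on seven vertices, C₅ or C₇, each base being used only when the preceding ones do not occur. The
-- other vertices fall into types according to their neighbours in the base, and finite computations, adding at most five
-- vertices to the base, show that few types occur and how they are joined. After complementing between some types,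
-- either adjacency across types is transitive, or the types form three classes with neither triangles nor independent
-- transversals; both structures decompose until at most two types (classes) are left, and a bipartite graph of that kind
-- splits further. If no base occurs then the graph is bipartite, because two adjacent vertices in the same layer of a
-- breadth-first search give K₃, C₅, C₇ or P₈. A bipartite graph has pairwise non-crossing neighbourhoods for H = P₁ + P₅
-- and S₁,₂,₂, and its bipartite complement decomposes for H = P₁ + P₂ + P₃. For H = S₁,₂,₂ an induced P₇ forces the
-- graph to have degree at most two up to twins.

module Submission where

open import Defs
open import Data.Bool using (Bool; true; false; not; _∧_; _∨_; _xor_; if_then_else_)
import Data.Bool.Properties as 𝔹
open import Data.Empty using (⊥; ⊥-elim)
open import Data.Fin as F using (Fin; zero; suc; toℕ; splitAt; _↑ˡ_; _↑ʳ_; combine; remQuot; funToFin; finToFun)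
import Data.Fin.Properties as F
open import Data.List as List using (List; []; _∷_; _++_; allFin; cartesianProduct)
import Data.List.Membership.Propositional as L
open import Data.List.Membership.Propositional.Properties
  using (∈-allFin; ∈-cartesianProduct⁺; ∈-++⁺ˡ; ∈-++⁺ʳ; ∈-map⁺; ∈-map⁻; ∈-upTo⁺; ∈-upTo⁻)
open import Data.List.Properties using (length-map; map-++; ∷-injective; length-upTo; ≡-dec)
import Data.List.Relation.Unary.All as All
open import Data.List.Relation.Unary.AllPairs using ([]; _∷_)
open import Data.List.Relation.Unary.Any using (here; there)
open import Data.List.Relation.Unary.Unique.Propositional using (Unique)
open import Data.List.Relation.Unary.Unique.Propositional.Properties using (upTo⁺)
open import Data.Nat as ℕ using (ℕ; zero; suc; _+_; _*_; _^_; _≤_; _<_; z≤n; s≤s; NonZero; z<s)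
open import Data.Nat.Induction using (<-rec)
import Data.Nat.Properties as ℕ
open import Data.Product using (Σ; ∃; ∃₂; ∃-syntax; _×_; _,_; proj₁; proj₂; uncurry)
open import Data.Sum using (_⊎_; inj₁; inj₂; [_,_]′)
open import Data.Unit using (⊤; tt)
open import Function using (_∘_; id; case_of_; Equivalence; Inverse; mk⇔; _⇔_; Injective; mk↔ₛ′)
open import Relation.Binary using (DecidableEquality; tri<; tri≈; tri>)
open import Relation.Binary.PropositionalEquality hiding ([_])
open import Relation.Nullary using (¬_; Dec; yes; no; does; contradiction; _×-dec_; _⊎-dec_; _→-dec_; ¬?)
import Relation.Nullary.Decidable as Dec

open Graph
open LabelledGraph

-- Clique-width is defined as a minimum, so an upper bound alone does not suffice: constructibility
-- with k labels is shown to be decidable, by saturating a finite set of codes of labelled graphs,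
-- and the least k is then searched for. The decompositions are trees in which a fixed labelling of
-- the vertices by types costs nothing. Hence complementing between types is free, and the types are
-- paid for once, at the end, as a factor in the number of classes. Every class of a tree needs
-- three clique-width labels, which gives the bound 3 · 768. The transitive and the cyclic structure
-- share one residue, a graph with at most two types in which P₂ + P₃ between the types is excluded.
-- Both configurations forbidden in the bipartite theorem contain that P₂ + P₃. The same theorem
-- serves bipartite graphs without P₁ + P₂ + P₃, where the bipartite complement excludes the two
-- configurations. Listing the types by hand would be hopeless. A backtracking search is proved
-- sound and evaluated on closed configurations, so that each table (complemented pairs, classes) is
-- a guess certified by `refl`.

does⇒ : ∀ {p} {P : Set p} (d : Dec P) → does d ≡ true → P
does⇒ (yes p) _ = p

⇒does : ∀ {p} {P : Set p} (d : Dec P) → P → does d ≡ true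
⇒does (yes _) _ = refl
⇒does (no ¬p) p = contradiction p ¬p

does-⇔ : ∀ {p q} {P : Set p} {Q : Set q} (d : Dec P) (e : Dec Q) → (P → Q) → (Q → P) → does d ≡ does e
does-⇔ (yes _) (yes _) _ _ = refl
does-⇔ (no _)  (no _)  _ _ = refl
does-⇔ (yes p) (no ¬q) f _ = contradiction (f p) ¬q
does-⇔ (no ¬p) (yes q) _ g = contradiction (g q) ¬p

-- Decidable subsets of `Fin n`

Sub : ℕ → Set
Sub n = Fin n → Bool

infix 4 _∈_ _∉_ _⊆_

record _∈_ {n} (v : Fin n) (X : Sub n) : Set where
  constructor mem
  field holds : X v ≡ true

open _∈_ public

_∉_ : ∀ {n} → Fin n → Sub n → Set
v ∉ X = ¬ (v ∈ X)

_⊆_ : ∀ {n} → Sub n → Sub n → Set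
X ⊆ Y = ∀ {v} → v ∈ X → v ∈ Y

_∈?_ : ∀ {n} (v : Fin n) (X : Sub n) → Dec (v ∈ X)
v ∈? X = Dec.map′ mem holds (X v 𝔹.≟ true)

∉⇒false : ∀ {n} {v : Fin n} (X : Sub n) → v ∉ X → X v ≡ false
∉⇒false X v∉X = 𝔹.¬-not (v∉X ∘ mem)

tail⊆ : ∀ {n} {X Y : Sub (suc n)} → X ⊆ Y → (X ∘ suc) ⊆ (Y ∘ suc)
tail⊆ X⊆Y (mem p) = mem (holds (X⊆Y (mem p)))

size : ∀ {n} → Sub n → ℕ
size {zero}  X = 0
size {suc n} X = (if X zero then 1 else 0) + size (X ∘ suc)

size-mono : ∀ {n} {X Y : Sub n} → X ⊆ Y → size X ≤ size Y
size-mono {zero} _ = z≤n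
size-mono {suc n} {X} {Y} X⊆Y with X zero in x | Y zero in y
... | true  | true  = s≤s (size-mono {n} (tail⊆ X⊆Y))
... | true  | false = contradiction (trans (sym y) (holds (X⊆Y (mem x)))) λ ()
... | false | true  = ℕ.m≤n⇒m≤1+n (size-mono {n} (tail⊆ X⊆Y))
... | false | false = size-mono {n} (tail⊆ X⊆Y)

size-< : ∀ {n} {X Y : Sub n} v → X ⊆ Y → v ∈ Y → v ∉ X → size X < size Y
size-< {suc n} {X} {Y} zero X⊆Y (mem y) v∉X with X zero in x | Y zero
... | true  | _    = contradiction (mem x) v∉X
... | false | true = s≤s (size-mono {n} (tail⊆ X⊆Y))
size-< {suc n} {X} {Y} (suc v) X⊆Y v∈Y v∉X with X zero in x | Y zero in y
... | true  | true  = s≤s (size-< {n} v (tail⊆ X⊆Y) (mem (holds v∈Y)) (λ p → v∉X (mem (holds p))))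
... | true  | false = contradiction (trans (sym y) (holds (X⊆Y (mem x)))) λ ()
... | false | true  = ℕ.m≤n⇒m≤1+n (size-< {n} v (tail⊆ X⊆Y) (mem (holds v∈Y)) (λ p → v∉X (mem (holds p))))
... | false | false = size-< {n} v (tail⊆ X⊆Y) (mem (holds v∈Y)) (λ p → v∉X (mem (holds p)))

size-full : ∀ n → size {n} (λ _ → true) ≡ n
size-full zero    = refl
size-full (suc n) = cong suc (size-full n)

size<n : ∀ {n} (X : Sub n) {v} → v ∉ X → size X < n
size<n {n} X {v} v∉X = subst (size X <_) (size-full n) (size-< v (λ _ → mem refl) (mem refl) v∉X)

⟨_⟩ : ∀ {n} → Fin n → Sub n
⟨ u ⟩ v = does (v F.≟ u)

v∈⟨v⟩ : ∀ {n} (v : Fin n) → v ∈ ⟨ v ⟩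
v∈⟨v⟩ v = mem (⇒does (v F.≟ v) refl)

∈⟨⟩ : ∀ {n} {u v : Fin n} → v ∈ ⟨ u ⟩ → v ≡ u
∈⟨⟩ {u = u} {v} (mem p) = does⇒ (v F.≟ u) p

_∪_ _∖_ _∩_ : ∀ {n} → Sub n → Sub n → Sub n
(X ∪ Y) v = X v ∨ Y v
(X ∖ Y) v = X v ∧ not (Y v)
(X ∩ Y) v = X v ∧ Y v

∈∪ : ∀ {n} (X Y : Sub n) {v} → v ∈ X ∪ Y → v ∈ X ⊎ v ∈ Y
∈∪ X Y {v} (mem p) with X v in x
... | true  = inj₁ (mem x)
... | false = inj₂ (mem p)

∪ˡ : ∀ {n} (X Y : Sub n) {v} → v ∈ X → v ∈ X ∪ Y
∪ˡ X Y {v} (mem p) = mem (cong (_∨ Y v) p)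

∪ʳ : ∀ {n} (X Y : Sub n) {v} → v ∈ Y → v ∈ X ∪ Y
∪ʳ X Y {v} (mem p) = mem (trans (cong (X v ∨_) p) (𝔹.∨-zeroʳ (X v)))

∈∖ : ∀ {n} (X Y : Sub n) {v} → v ∈ X ∖ Y → v ∈ X × v ∉ Y
∈∖ X Y {v} (mem p) with X v in x | Y v in y
... | true | false = mem x , λ { (mem q) → contradiction (trans (sym y) q) λ () }

∖∈ : ∀ {n} (X Y : Sub n) {v} → v ∈ X → v ∉ Y → v ∈ X ∖ Y
∖∈ X Y (mem p) q = mem (cong₂ (λ x y → x ∧ not y) p (∉⇒false Y q))

∈∩ : ∀ {n} (X Y : Sub n) {v} → v ∈ X ∩ Y → v ∈ X × v ∈ Y
∈∩ X Y {v} (mem p) with X v in x | Y v in y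
... | true | true = mem x , mem y

∩∈ : ∀ {n} (X Y : Sub n) {v} → v ∈ X → v ∈ Y → v ∈ X ∩ Y
∩∈ X Y (mem p) (mem q) = mem (cong₂ _∧_ p q)

[_∣_] : ∀ {n} (X : Sub n) {P : Fin n → Set} → (∀ v → Dec (P v)) → Sub n
[ X ∣ P? ] v = X v ∧ does (P? v)

∈[] : ∀ {n} (X : Sub n) {P : Fin n → Set} (P? : ∀ v → Dec (P v)) {v} → v ∈ [ X ∣ P? ] → v ∈ X × P v
∈[] X P? {v} p = let a , b = ∈∩ X (does ∘ P?) p in a , does⇒ (P? v) (holds b)

[]∈ : ∀ {n} (X : Sub n) {P : Fin n → Set} (P? : ∀ v → Dec (P v)) {v} → v ∈ X → P v → v ∈ [ X ∣ P? ]
[]∈ X P? {v} p q = ∩∈ X (does ∘ P?) p (mem (⇒does (P? v) q))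

-- Saturation of a finite set under a decidable relation

module _ {n : ℕ} (Ok : Fin n → Set) {R : Fin n → Fin n → Set} (R? : ∀ u v → Dec (R u v))
  (step : ∀ {u v} → Ok u → R u v → Ok v) where

  Saturated : Sub n → Set
  Saturated S = (∀ {v} → v ∈ S → Ok v) × (∀ {u v} → u ∈ S → R u v → v ∈ S)

  -- `d` is fuel. Each added vertex takes one unit and raises `size S` by at least one, so when the
  -- fuel is gone `S` already contains every vertex.
  grow : ∀ d (S : Sub n) → n ≤ d + size S → (∀ {v} → v ∈ S → Ok v) → Σ (Sub n) λ S′ → S ⊆ S′ × Saturated S′
  grow d S n≤ ok with F.any? (λ u → F.any? (λ v → (u ∈? S) ×-dec R? u v ×-dec ¬? (v ∈? S)))
  ... | no ∄ = S , id , ok , λ {u} {v} u∈S r → Dec.decidable-stable (v ∈? S) λ v∉S → ∄ (u , v , u∈S , r , v∉S)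
  grow zero S n≤ ok | yes (_ , _ , _ , _ , v∉S) = contradiction n≤ (ℕ.<⇒≱ (size<n S v∉S))
  grow (suc d) S n≤ ok | yes (u , v , u∈S , r , v∉S) =
    let S′ , S⊆S′ , sat = grow d (S ∪ ⟨ v ⟩) n≤′ ok′ in S′ , S⊆S′ ∘ ∪ˡ S ⟨ v ⟩ , sat
    where
    n≤′ : n ≤ d + size (S ∪ ⟨ v ⟩)
    n≤′ = ℕ.≤-trans n≤ (ℕ.≤-trans (ℕ.≤-reflexive (sym (ℕ.+-suc d (size S))))
      (ℕ.+-monoʳ-≤ d (size-< v (∪ˡ S ⟨ v ⟩) (∪ʳ S ⟨ v ⟩ (v∈⟨v⟩ v)) v∉S)))
    ok′ : ∀ {w} → w ∈ S ∪ ⟨ v ⟩ → Ok w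
    ok′ w∈ with ∈∪ S ⟨ v ⟩ w∈
    ... | inj₁ w∈S = ok w∈S
    ... | inj₂ w∈v = subst Ok (sym (∈⟨⟩ w∈v)) (step (ok u∈S) r)

  saturate : (S : Sub n) → (∀ {v} → v ∈ S → Ok v) → Σ (Sub n) λ S′ → S ⊆ S′ × Saturated S′
  saturate S = grow n S (ℕ.m≤m+n n (size S))

-- Deciding constructibility

open LabelledGraph

adjᵇ : ∀ {n} → Graph n → Fin n → Fin n → Bool
adjᵇ G u v = does (adj? G u v)

Matrix : ℕ → Set
Matrix n = Fin n → Fin n → Bool

Realizes : ∀ {k n} → Expr k n → Matrix n → (Fin n → Fin k) → Set
Realizes e a l = (∀ u v → adjᵇ (graph ⟦ e ⟧) u v ≡ a u v) × (∀ u → label ⟦ e ⟧ u ≡ l u)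

Realizable : ∀ {k n} → Matrix n → (Fin n → Fin k) → Set
Realizable a l = ∃[ e ] Realizes e a l

Joined : ∀ {k n} (i j : Fin k) → Matrix n → (Fin n → Fin k) → Matrix n
Joined i j a l u v = a u v ∨ (does (l u F.≟ i) ∧ does (l v F.≟ j)) ∨ (does (l u F.≟ j) ∧ does (l v F.≟ i))

realizes-join : ∀ {k n} (e : Expr k n) {a l} (i j : Fin k) (i≢j : i ≢ j) →
  Realizes e a l → Realizes (join i j i≢j e) (Joined i j a l) l
realizes-join e {a} {l} i j i≢j (p , q) = eq , q
  where
  eq : ∀ u v → adjᵇ (joinLabels i j i≢j ⟦ e ⟧) u v ≡ Joined i j a l u v
  eq u v rewrite sym (p u v) | sym (q u) | sym (q v) = refl

realizes-rename : ∀ {k n} (e : Expr k n) {a l} (i j : Fin k) →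
  Realizes e a l → Realizes (rename i j e) a (renameLabel i j ∘ l)
realizes-rename e i j (p , q) = p , λ u → cong (renameLabel i j) (q u)

-- Both parts of a union are therefore smaller than the whole, which lets the decision procedure
-- recurse on the order.
Expr-nonempty : ∀ {k n} → Expr k n → 0 < n
Expr-nonempty (vertex i)       = z<s
Expr-nonempty (union {m} e e′) = ℕ.≤-trans (Expr-nonempty e) (ℕ.m≤m+n m _)
Expr-nonempty (join _ _ _ e)   = Expr-nonempty e
Expr-nonempty (rename _ _ e)   = Expr-nonempty e

-- Vertices are transported by `F.cast` along an irrelevant equation, so that all splittings of one
-- fixed `n` can be tested without rewriting `n`.
Cross-free : ∀ m₁ m₂ {n} .(eq : m₁ + m₂ ≡ n) → Matrix n → Set
Cross-free m₁ m₂ eq a = ∀ (u : Fin m₁) (v : Fin m₂) →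
  a (F.cast eq (u ↑ˡ m₂)) (F.cast eq (m₁ ↑ʳ v)) ≡ false × a (F.cast eq (m₁ ↑ʳ v)) (F.cast eq (u ↑ˡ m₂)) ≡ false

Union : ∀ {k} m₁ m₂ {n} .(eq : m₁ + m₂ ≡ n) → Matrix n → (Fin n → Fin k) → Set
Union m₁ m₂ eq a l =
  Realizable (λ u v → a (F.cast eq (u ↑ˡ m₂)) (F.cast eq (v ↑ˡ m₂))) (λ u → l (F.cast eq (u ↑ˡ m₂))) ×
  Realizable (λ u v → a (F.cast eq (m₁ ↑ʳ u)) (F.cast eq (m₁ ↑ʳ v))) (λ u → l (F.cast eq (m₁ ↑ʳ u))) ×
  Cross-free m₁ m₂ eq a

adjᵇ-⊕ : ∀ {m n} (G : Graph m) (H : Graph n) u v → adjᵇ (G ⊕ H) u v ≡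
  [ (λ u → [ (λ v → adjᵇ G u v) , (λ _ → false) ]′ (splitAt m v))
  , (λ u → [ (λ _ → false) , (λ v → adjᵇ H u v) ]′ (splitAt m v)) ]′ (splitAt m u)
adjᵇ-⊕ {m} G H u v with splitAt m u | splitAt m v
... | inj₁ u | inj₁ v = refl
... | inj₁ u | inj₂ v = refl
... | inj₂ u | inj₁ v = refl
... | inj₂ u | inj₂ v = refl

realizable-union : ∀ {k} m₁ m₂ {n} (eq : m₁ + m₂ ≡ n) {a : Matrix n} {l : Fin n → Fin k} → Union m₁ m₂ eq a l → Realizable a l
realizable-union m₁ m₂ refl {a} {l} ((e₁ , a₁ , l₁) , (e₂ , a₂ , l₂) , x) = union e₁ e₂ , adj-ok , label-ok
  where
  c : ∀ w → F.cast refl w ≡ w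
  c = F.cast-is-id refl
  adj-ok : ∀ u v → adjᵇ (graph ⟦ union e₁ e₂ ⟧) u v ≡ a u v
  adj-ok u v rewrite adjᵇ-⊕ (graph ⟦ e₁ ⟧) (graph ⟦ e₂ ⟧) u v
    with splitAt m₁ u in p | splitAt m₁ v in q
  ... | inj₁ u′ | inj₁ v′ = trans (a₁ u′ v′) (cong₂ a (trans (c _) (F.splitAt⁻¹-↑ˡ p)) (trans (c _) (F.splitAt⁻¹-↑ˡ q)))
  ... | inj₂ u′ | inj₂ v′ = trans (a₂ u′ v′) (cong₂ a (trans (c _) (F.splitAt⁻¹-↑ʳ p)) (trans (c _) (F.splitAt⁻¹-↑ʳ q)))
  ... | inj₁ u′ | inj₂ v′ = trans (sym (proj₁ (x u′ v′))) (cong₂ a (trans (c _) (F.splitAt⁻¹-↑ˡ p)) (trans (c _) (F.splitAt⁻¹-↑ʳ q)))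
  ... | inj₂ u′ | inj₁ v′ = trans (sym (proj₂ (x v′ u′))) (cong₂ a (trans (c _) (F.splitAt⁻¹-↑ʳ p)) (trans (c _) (F.splitAt⁻¹-↑ˡ q)))
  label-ok : ∀ u → label ⟦ union e₁ e₂ ⟧ u ≡ l u
  label-ok u with splitAt m₁ u in p
  ... | inj₁ u′ = trans (l₁ u′) (cong l (trans (c _) (F.splitAt⁻¹-↑ˡ p)))
  ... | inj₂ u′ = trans (l₂ u′) (cong l (trans (c _) (F.splitAt⁻¹-↑ʳ p)))

union-realizes : ∀ {k m₁ m₂} (e₁ : Expr k m₁) (e₂ : Expr k m₂) {a l} → Realizes (union e₁ e₂) a l → Union m₁ m₂ refl a l
union-realizes {k} {m₁} {m₂} e₁ e₂ {a} {l} (p , q) = (e₁ , ll , lˡ) , (e₂ , rr , lʳ) , λ u v → lr u v , rl u v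
  where
  c : ∀ {w} → F.cast refl w ≡ w
  c {w} = F.cast-is-id refl w
  ad : Matrix (m₁ + m₂)
  ad = adjᵇ (graph ⟦ union e₁ e₂ ⟧)
  ad-eq : ∀ u v → a (F.cast refl u) (F.cast refl v) ≡ ad u v
  ad-eq u v = trans (cong₂ a c c) (sym (p u v))
  ll : ∀ u v → adjᵇ (graph ⟦ e₁ ⟧) u v ≡ a (F.cast refl (u ↑ˡ m₂)) (F.cast refl (v ↑ˡ m₂))
  ll u v rewrite ad-eq (u ↑ˡ m₂) (v ↑ˡ m₂) | adjᵇ-⊕ (graph ⟦ e₁ ⟧) (graph ⟦ e₂ ⟧) (u ↑ˡ m₂) (v ↑ˡ m₂)
    | F.splitAt-↑ˡ m₁ u m₂ | F.splitAt-↑ˡ m₁ v m₂ = refl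
  rr : ∀ u v → adjᵇ (graph ⟦ e₂ ⟧) u v ≡ a (F.cast refl (m₁ ↑ʳ u)) (F.cast refl (m₁ ↑ʳ v))
  rr u v rewrite ad-eq (m₁ ↑ʳ u) (m₁ ↑ʳ v) | adjᵇ-⊕ (graph ⟦ e₁ ⟧) (graph ⟦ e₂ ⟧) (m₁ ↑ʳ u) (m₁ ↑ʳ v)
    | F.splitAt-↑ʳ m₁ m₂ u | F.splitAt-↑ʳ m₁ m₂ v = refl
  lr : ∀ u v → a (F.cast refl (u ↑ˡ m₂)) (F.cast refl (m₁ ↑ʳ v)) ≡ false
  lr u v rewrite ad-eq (u ↑ˡ m₂) (m₁ ↑ʳ v) | adjᵇ-⊕ (graph ⟦ e₁ ⟧) (graph ⟦ e₂ ⟧) (u ↑ˡ m₂) (m₁ ↑ʳ v)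
    | F.splitAt-↑ˡ m₁ u m₂ | F.splitAt-↑ʳ m₁ m₂ v = refl
  rl : ∀ u v → a (F.cast refl (m₁ ↑ʳ v)) (F.cast refl (u ↑ˡ m₂)) ≡ false
  rl u v rewrite ad-eq (m₁ ↑ʳ v) (u ↑ˡ m₂) | adjᵇ-⊕ (graph ⟦ e₁ ⟧) (graph ⟦ e₂ ⟧) (m₁ ↑ʳ v) (u ↑ˡ m₂)
    | F.splitAt-↑ˡ m₁ u m₂ | F.splitAt-↑ʳ m₁ m₂ v = refl
  lˡ : ∀ u → label ⟦ e₁ ⟧ u ≡ l (F.cast refl (u ↑ˡ m₂))
  lˡ u = trans (trans (cong [ label ⟦ e₁ ⟧ , label ⟦ e₂ ⟧ ]′ (sym (F.splitAt-↑ˡ m₁ u m₂))) (q (u ↑ˡ m₂))) (cong l (sym c))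
  lʳ : ∀ u → label ⟦ e₂ ⟧ u ≡ l (F.cast refl (m₁ ↑ʳ u))
  lʳ u = trans (trans (cong [ label ⟦ e₁ ⟧ , label ⟦ e₂ ⟧ ]′ (sym (F.splitAt-↑ʳ m₁ m₂ u))) (q (m₁ ↑ʳ u))) (cong l (sym c))

-- Labelled graphs on Fin n are coded by a finite type, so that the constructible ones can be found by saturation.

module Code (k n : ℕ) where

  Codes : ℕ
  Codes = 2 ^ (n * n) * k ^ n

  private
    toBool : Fin 2 → Bool
    toBool zero    = false
    toBool (suc _) = true

    fromBool : Bool → Fin 2
    fromBool false = zero
    fromBool true  = suc zero

    toBool-fromBool : ∀ b → toBool (fromBool b) ≡ b
    toBool-fromBool false = refl
    toBool-fromBool true  = refl

  mat : Fin Codes → Matrix n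
  mat s u v = toBool (finToFun (proj₁ (remQuot {2 ^ (n * n)} (k ^ n) s)) (combine u v))

  lab : Fin Codes → Fin n → Fin k
  lab s = finToFun (proj₂ (remQuot {2 ^ (n * n)} (k ^ n) s))

  code : Matrix n → (Fin n → Fin k) → Fin Codes
  code a l = combine (funToFin (λ p → fromBool (uncurry a (remQuot n p)))) (funToFin l)

  mat-code : ∀ a l u v → mat (code a l) u v ≡ a u v
  mat-code a l u v = begin
    toBool (finToFun (proj₁ (remQuot {2 ^ (n * n)} (k ^ n) (combine A (funToFin l)))) (combine u v))
      ≡⟨ cong (λ x → toBool (finToFun (proj₁ x) (combine u v))) (F.remQuot-combine {2 ^ (n * n)} {k ^ n} A (funToFin l)) ⟩
    toBool (finToFun A (combine u v))
      ≡⟨ cong toBool (F.finToFun-funToFin entry (combine u v)) ⟩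
    toBool (entry (combine u v))
      ≡⟨ cong (λ x → toBool (fromBool (uncurry a x))) (F.remQuot-combine u v) ⟩
    toBool (fromBool (a u v))
      ≡⟨ toBool-fromBool (a u v) ⟩
    a u v ∎
    where
    open ≡-Reasoning
    entry : Fin (n * n) → Fin 2
    entry p = fromBool (uncurry a (remQuot n p))
    A = funToFin entry

  lab-code : ∀ a l u → lab (code a l) u ≡ l u
  lab-code a l u = trans
    (cong (λ x → finToFun (proj₂ x) u) (F.remQuot-combine {2 ^ (n * n)} {k ^ n} (funToFin (λ p → fromBool (uncurry a (remQuot n p)))) (funToFin l)))
    (F.finToFun-funToFin l u)

realizable-resp : ∀ {k n} {a a′ : Matrix n} {l l′ : Fin n → Fin k} →
  (∀ u v → a u v ≡ a′ u v) → (∀ u → l u ≡ l′ u) → Realizable a l → Realizable a′ l′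
realizable-resp p q (e , x , y) = e , (λ u v → trans (x u v) (p u v)) , λ u → trans (y u) (q u)

Dec-Realizable : ℕ → ℕ → Set
Dec-Realizable k n = (a : Matrix n) (l : Fin n → Fin k) → Dec (Realizable a l)

dec-Union : ∀ {k n} m₁ m₂ (eq : m₁ + m₂ ≡ n) → Dec-Realizable k m₁ → Dec-Realizable k m₂ → ∀ a l → Dec (Union m₁ m₂ eq a l)
dec-Union m₁ m₂ eq d₁ d₂ a l =
  d₁ _ _ ×-dec d₂ _ _ ×-dec F.all? (λ u → F.all? (λ v → (_ 𝔹.≟ _) ×-dec (_ 𝔹.≟ _)))

module _ (k n : ℕ) (rec : ∀ {m} → m < n → Dec-Realizable k m) where
  open Code k n

  private
    Vertex : Matrix n → Set
    Vertex a = n ≡ 1 × (∀ u v → a u v ≡ false)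

    SplitAs : Matrix n → (Fin n → Fin k) → Fin n → Fin n → Set
    SplitAs a l m₁ m₂ = Σ (toℕ m₁ + toℕ m₂ ≡ n) λ eq → Union (toℕ m₁) (toℕ m₂) eq a l

    -- Joins and renamings keep the order `n`; only a vertex or a union creates a graph of order
    -- `n`, and a union does so from smaller orders, which are decided by recursion. Everything else
    -- of order `n` is reached from these seeds by `Step`.
    Seed : Fin Codes → Set
    Seed s = Vertex (mat s) ⊎ ∃₂ (SplitAs (mat s) (lab s))

    splitAs? : ∀ a l m₁ m₂ → Dec (SplitAs a l m₁ m₂)
    splitAs? a l m₁ m₂ with toℕ m₁ + toℕ m₂ ℕ.≟ n
    ... | no ¬eq = no (¬eq ∘ proj₁)
    ... | yes eq = Dec.map′ (eq ,_) proj₂ (dec-Union (toℕ m₁) (toℕ m₂) eq (rec (F.toℕ<n m₁)) (rec (F.toℕ<n m₂)) a l)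

    seed? : ∀ s → Dec (Seed s)
    seed? s = ((n ℕ.≟ 1) ×-dec F.all? (λ u → F.all? (λ v → _ 𝔹.≟ _)))
      ⊎-dec F.any? (λ m₁ → F.any? (λ m₂ → splitAs? (mat s) (lab s) m₁ m₂))

    JoinStep RenameStep Step : Fin Codes → Fin Codes → Set
    JoinStep s t = ∃₂ λ i j → i ≢ j × (∀ u v → Joined i j (mat s) (lab s) u v ≡ mat t u v) × (∀ u → lab s u ≡ lab t u)
    RenameStep s t = ∃₂ λ i j → (∀ u v → mat s u v ≡ mat t u v) × (∀ u → renameLabel i j (lab s u) ≡ lab t u)
    Step s t = JoinStep s t ⊎ RenameStep s t

    step? : ∀ s t → Dec (Step s t)
    step? s t =
      F.any? (λ i → F.any? (λ j → ¬? (i F.≟ j) ×-dec F.all? (λ u → F.all? (λ v → _ 𝔹.≟ _)) ×-dec F.all? (λ u → _ F.≟ _)))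
      ⊎-dec F.any? (λ i → F.any? (λ j → F.all? (λ u → F.all? (λ v → _ 𝔹.≟ _)) ×-dec F.all? (λ u → _ F.≟ _)))

    Ok : Fin Codes → Set
    Ok s = Realizable (mat s) (lab s)

    vertex-ok : ∀ {m} → m ≡ 1 → {a : Matrix m} {l : Fin m → Fin k} → (∀ u v → a u v ≡ false) → Realizable a l
    vertex-ok refl {a} {l} a≡ = vertex (l zero) , (λ { zero zero → sym (a≡ zero zero) }) , λ { zero → refl }

    seed-ok : ∀ {s} → Seed s → Ok s
    seed-ok (inj₁ (n≡1 , a≡))          = vertex-ok n≡1 a≡
    seed-ok (inj₂ (m₁ , m₂ , eq , un)) = realizable-union (toℕ m₁) (toℕ m₂) eq un

    step-ok : ∀ {s t} → Ok s → Step s t → Ok t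
    step-ok (e , r) (inj₁ (i , j , i≢j , p , q)) = realizable-resp p q (join i j i≢j e , realizes-join e i j i≢j r)
    step-ok (e , r) (inj₂ (i , j , p , q))       = realizable-resp p q (rename i j e , realizes-rename e i j r)

    seeds : Sub Codes
    seeds s = does (seed? s)

    sat = saturate Ok step? step-ok seeds (λ {s} s∈ → seed-ok (does⇒ (seed? s) (holds s∈)))

    S : Sub Codes
    S = proj₁ sat

    union-seed : ∀ {m₁ m₂} (eq : m₁ + m₂ ≡ n) → 0 < m₁ → 0 < m₂ → ∀ a l → Union m₁ m₂ eq a l → ∃₂ (SplitAs a l)
    union-seed {m₁} {m₂} eq 0<m₁ 0<m₂ a l un = F.fromℕ< m₁<n , F.fromℕ< m₂<n , go (F.toℕ-fromℕ< m₁<n) (F.toℕ-fromℕ< m₂<n) eq un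
      where
      m₁<n : m₁ < n
      m₁<n = subst (m₁ <_) eq (subst (_< m₁ + m₂) (ℕ.+-identityʳ m₁) (ℕ.+-monoʳ-< m₁ 0<m₂))
      m₂<n : m₂ < n
      m₂<n = subst (m₂ <_) eq (ℕ.+-monoˡ-< m₂ 0<m₁)
      go : ∀ {x₁ x₂} → x₁ ≡ m₁ → x₂ ≡ m₂ → (eq : m₁ + m₂ ≡ n) → Union m₁ m₂ eq a l → Σ (x₁ + x₂ ≡ n) λ eq → Union x₁ x₂ eq a l
      go refl refl eq un = eq , un

    -- Matching on an expression refines its order, which the module parameter `n` cannot undergo;
    -- hence the separate `m` with an equation. A subexpression of the same order is replaced by the
    -- code `s′` of its labelled graph, and the last operation becomes a `Step` from `s′` to `s`.
    complete : ∀ {m} (m≡n : m ≡ n) (e : Expr k m) s → Realizes (subst (Expr k) m≡n e) (mat s) (lab s) → s ∈ S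
    complete refl (vertex i) s (p , q) = proj₁ (proj₂ sat) (mem (⇒does (seed? s) (inj₁ (refl , λ { zero zero → sym (p zero zero) }))))
    complete refl (union e₁ e₂) s r =
      proj₁ (proj₂ sat) (mem (⇒does (seed? s) (inj₂ (union-seed refl (Expr-nonempty e₁) (Expr-nonempty e₂) (mat s) (lab s) (union-realizes e₁ e₂ r)))))
    complete refl (join i j i≢j e) s (p , q) = proj₂ (proj₂ (proj₂ sat)) {u = s′} (complete refl e s′ r′) (inj₁ (i , j , i≢j , p′ , q′))
      where
      s′ = code (adjᵇ (graph ⟦ e ⟧)) (label ⟦ e ⟧)
      r′ : Realizes e (mat s′) (lab s′)
      r′ = (λ u v → sym (mat-code _ (label ⟦ e ⟧) u v)) , λ u → sym (lab-code (adjᵇ (graph ⟦ e ⟧)) _ u)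
      p′ : ∀ u v → Joined i j (mat s′) (lab s′) u v ≡ mat s u v
      p′ u v = trans (sym (proj₁ (realizes-join e i j i≢j r′) u v)) (p u v)
      q′ : ∀ u → lab s′ u ≡ lab s u
      q′ u = trans (sym (proj₂ r′ u)) (q u)
    complete refl (rename i j e) s (p , q) = proj₂ (proj₂ (proj₂ sat)) {u = s′} (complete refl e s′ r′) (inj₂ (i , j , p′ , q′))
      where
      s′ = code (adjᵇ (graph ⟦ e ⟧)) (label ⟦ e ⟧)
      r′ : Realizes e (mat s′) (lab s′)
      r′ = (λ u v → sym (mat-code _ (label ⟦ e ⟧) u v)) , λ u → sym (lab-code (adjᵇ (graph ⟦ e ⟧)) _ u)
      p′ : ∀ u v → mat s′ u v ≡ mat s u v
      p′ u v = trans (sym (proj₁ r′ u v)) (p u v)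
      q′ : ∀ u → renameLabel i j (lab s′ u) ≡ lab s u
      q′ u = trans (cong (renameLabel i j) (sym (proj₂ r′ u))) (q u)

  realizable-step? : Dec-Realizable k n
  realizable-step? a l = Dec.map′
    (λ s∈S → realizable-resp (mat-code a l) (lab-code a l) (proj₁ (proj₂ (proj₂ sat)) s∈S))
    (λ { (e , p , q) → complete refl e (code a l) ((λ u v → trans (p u v) (sym (mat-code a l u v))) , λ u → trans (q u) (sym (lab-code a l u))) })
    (code a l ∈? S)

realizable? : ∀ k n → Dec-Realizable k n
realizable? k = <-rec (Dec-Realizable k) (λ n rec → realizable-step? k n (λ m<n → rec m<n))

open LabelledGraph

module _ {n : ℕ} (G : Graph n) (k : ℕ) where

  private
    map : Fin (n ^ n) → Fin n → Fin n
    map = finToFun {n} {n}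

    -- The labelling, the isomorphism and its inverse are all numbers below a bound, so their
    -- existence is a finite search.
    Encoded : Fin (k ^ n) → Fin (n ^ n) → Fin (n ^ n) → Set
    Encoded l f g = Realizable (λ u v → adjᵇ G (map f u) (map f v)) (finToFun {k} {n} l) ×
      (∀ u → map f (map g u) ≡ u) × (∀ u → map g (map f u) ≡ u)

    to : ∃ (λ l → ∃₂ (Encoded l)) → Constructible k G
    to (l , f , g , (e , a , _) , fg , gf) = e , mk↔ₛ′ (map f) (map g) fg gf , λ u v → mk⇔
      (λ p → does⇒ (adj? G _ _) (trans (sym (a u v)) (⇒does (adj? (graph ⟦ e ⟧) u v) p)))
      (λ p → does⇒ (adj? (graph ⟦ e ⟧) u v) (trans (a u v) (⇒does (adj? G _ _) p)))

    from : Constructible k G → ∃ (λ l → ∃₂ (Encoded l))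
    from (e , φ , iso) = funToFin (label ⟦ e ⟧) , funToFin f , funToFin g ,
      (e , adj-eq , λ u → sym (F.finToFun-funToFin (label ⟦ e ⟧) u)) ,
      (λ u → trans (f≗ _) (trans (cong f (g≗ u)) (Inverse.strictlyInverseˡ φ u))) ,
      (λ u → trans (g≗ _) (trans (cong g (f≗ u)) (Inverse.strictlyInverseʳ φ u)))
      where
      f = Inverse.to φ
      g = Inverse.from φ
      f≗ = F.finToFun-funToFin f
      g≗ = F.finToFun-funToFin g
      adj-eq : ∀ u v → adjᵇ (graph ⟦ e ⟧) u v ≡ adjᵇ G (map (funToFin f) u) (map (funToFin f) v)
      adj-eq u v rewrite f≗ u | f≗ v =
        does-⇔ (adj? (graph ⟦ e ⟧) u v) (adj? G (f u) (f v)) (Equivalence.to (iso u v)) (Equivalence.from (iso u v))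

  constructible? : Dec (Constructible k G)
  constructible? = Dec.map′ to from (F.any? (λ l → F.any? (λ f → F.any? (λ g →
    realizable? k n _ (finToFun {k} {n} l) ×-dec
    F.all? (λ u → map f (map g u) F.≟ u) ×-dec F.all? (λ u → map g (map f u) F.≟ u)))))

least : ∀ {P : ℕ → Set} → (∀ k → Dec (P k)) → ∀ {c} → P c → ∃[ w ] P w × w ≤ c × (∀ k → P k → w ≤ k)
least {P} P? {c} Pc = search 0 c refl (λ ())
  where
  search : ∀ w d → w + d ≡ c → (∀ {k} → k < w → ¬ P k) → ∃[ w ] P w × w ≤ c × (∀ k → P k → w ≤ k)
  search w d eq below with P? w
  ... | yes Pw = w , Pw , subst (w ≤_) eq (ℕ.m≤m+n w d) , λ k Pk → ℕ.≮⇒≥ (λ k<w → below k<w Pk)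
  search w zero    eq below | no ¬Pw = contradiction (subst P (sym (trans (sym (ℕ.+-identityʳ w)) eq)) Pc) ¬Pw
  search w (suc d) eq below | no ¬Pw = search (suc w) d (trans (sym (ℕ.+-suc w d)) eq) below′
    where
    below′ : ∀ {k} → k < suc w → ¬ P k
    below′ k<1+w Pk with ℕ.m<1+n⇒m<n∨m≡n k<1+w
    ... | inj₁ k<w  = below k<w Pk
    ... | inj₂ refl = ¬Pw Pk

-- Decompositions yield only some expression with `c` labels; decidability turns this into an exact
-- minimum below `c`.
bounded-cliqueWidth : ∀ (C : GraphClass) c → (∀ n .{{_ : NonZero n}} (G : Graph n) → C G → Constructible c G) → BoundedCliqueWidth C
bounded-cliqueWidth C c build = c , λ n G CG →
  let w , cw , w≤c , minimal = least (constructible? G) (build n G CG) in w , (cw , minimal) , w≤c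

-- Decomposition trees

open LabelledGraph

-- Decomposition trees in the style of NLC-width. The classes of a node are given by the
-- global labelling τ together with a local labelling by Fin k.

data Tree {n} (ad : Matrix n) {L : Set} (τ : Fin n → L) (k : ℕ) : Sub n → (Fin n → Fin k) → Set where
  leaf : ∀ {X c} v → v ∈ X → (∀ {u} → u ∈ X → u ≡ v) → Tree ad τ k X c
  node : ∀ {X Y Z c c₁ c₂} → Tree ad τ k Y c₁ → Tree ad τ k Z c₂ →
    (∀ {v} → v ∈ X → v ∈ Y ⊎ v ∈ Z) → Y ⊆ X → Z ⊆ X → (∀ {v} → v ∈ Y → v ∉ Z) →
    (∀ {u u′} → u ∈ Y → u′ ∈ Y → τ u ≡ τ u′ → c₁ u ≡ c₁ u′ → c u ≡ c u′) →
    (∀ {u u′} → u ∈ Z → u′ ∈ Z → τ u ≡ τ u′ → c₂ u ≡ c₂ u′ → c u ≡ c u′) →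
    (∀ {u u′ v v′} → u ∈ Y → u′ ∈ Y → v ∈ Z → v′ ∈ Z →
      τ u ≡ τ u′ → c₁ u ≡ c₁ u′ → τ v ≡ τ v′ → c₂ v ≡ c₂ v′ → ad u v ≡ ad u′ v′) →
    Tree ad τ k X c

-- factor sends h u to g u for u ∈ Y, if this is well defined, and is the identity outside of the image of Y.

module _ {n k} (Y : Sub n) (h g : Fin n → Fin k) where

  private
    found? : ∀ i → Dec (∃ λ u → u ∈ Y × h u ≡ i)
    found? i = F.any? (λ u → (u ∈? Y) ×-dec (h u F.≟ i))

    pick : ∀ {i} → Dec (∃ λ u → u ∈ Y × h u ≡ i) → Fin k
    pick     (yes (u , _)) = g u
    pick {i} (no _)        = i

  factor : Fin k → Fin k
  factor i = pick (found? i)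

  factor-≡ : (∀ {u u′} → u ∈ Y → u′ ∈ Y → h u ≡ h u′ → g u ≡ g u′) → ∀ {u} → u ∈ Y → factor (h u) ≡ g u
  factor-≡ det {u} u∈Y with found? (h u)
  ... | yes (u′ , u′∈Y , eq) = det u′∈Y u∈Y eq
  ... | no ∄                 = contradiction (u , u∈Y , refl) ∄

-- One copy of the label set Fin k for each child of a node and a third one for passing to the labels of the node itself.

module Copies (k K : ℕ) (⟪_,_⟫ : Fin 3 → Fin k → Fin K)
  (⟪⟫-copy : ∀ {a b i j} → ⟪ a , i ⟫ ≡ ⟪ b , j ⟫ → a ≡ b)
  (⟪⟫-index : ∀ {a b i j} → ⟪ a , i ⟫ ≡ ⟪ b , j ⟫ → i ≡ j) where

  renameLabel-≡ : ∀ {i j l : Fin K} → l ≡ i → renameLabel i j l ≡ j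
  renameLabel-≡ {i = i} {l = l} eq with l F.≟ i
  ... | yes _ = refl
  ... | no ne = contradiction eq ne

  renameLabel-≢ : ∀ {i j l : Fin K} → l ≢ i → renameLabel i j l ≡ l
  renameLabel-≢ {i = i} {l = l} ne with l F.≟ i
  ... | yes eq = contradiction eq ne
  ... | no _   = refl

  module _ (a b : Fin 3) (a≢b : a ≢ b) (ρ : Fin k → Fin k) where

    moveAll : ∀ {m} → List (Fin k) → Expr K m → Expr K m
    moveAll []       e = e
    moveAll (i ∷ is) e = moveAll is (rename ⟪ a , i ⟫ ⟪ b , ρ i ⟫ e)

    moveAll-adj : ∀ {m} is (e : Expr K m) u v → adjᵇ (graph ⟦ moveAll is e ⟧) u v ≡ adjᵇ (graph ⟦ e ⟧) u v
    moveAll-adj []       e u v = refl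
    moveAll-adj (i ∷ is) e u v = moveAll-adj is (rename ⟪ a , i ⟫ ⟪ b , ρ i ⟫ e) u v

    moveAll-other : ∀ {m} is (e : Expr K m) {u c j} → c ≢ a → label ⟦ e ⟧ u ≡ ⟪ c , j ⟫ →
      label ⟦ moveAll is e ⟧ u ≡ ⟪ c , j ⟫
    moveAll-other []       e c≢a eq = eq
    moveAll-other (i ∷ is) e c≢a eq =
      moveAll-other is (rename ⟪ a , i ⟫ ⟪ b , ρ i ⟫ e) c≢a
        (trans (renameLabel-≢ (λ eq′ → c≢a (⟪⟫-copy (trans (sym eq) eq′)))) eq)

    -- The target copy `b` differs from `a`, so a label that has been moved is untouched by the
    -- later renamings. This is why `ρ` may identify labels and still be applied one label at a
    -- time.
    moveAll-moved : ∀ {m} is (e : Expr K m) {u i} → i L.∈ is → label ⟦ e ⟧ u ≡ ⟪ a , i ⟫ →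
      label ⟦ moveAll is e ⟧ u ≡ ⟪ b , ρ i ⟫
    moveAll-moved (j ∷ is) e {u} {i} i∈ eq with i F.≟ j | i∈
    ... | yes refl | _ = moveAll-other is (rename ⟪ a , j ⟫ ⟪ b , ρ j ⟫ e) (a≢b ∘ sym) (renameLabel-≡ eq)
    ... | no i≢j | here i≡j  = contradiction i≡j i≢j
    ... | no i≢j | there i∈is = moveAll-moved is (rename ⟪ a , j ⟫ ⟪ b , ρ j ⟫ e) i∈is
      (trans (renameLabel-≢ (λ eq′ → i≢j (⟪⟫-index (trans (sym eq) eq′)))) eq)

    move : ∀ {m} → Expr K m → Expr K m
    move = moveAll (allFin k)

  0≢1 : ∀ {i j} → ⟪ zero , i ⟫ ≢ ⟪ suc zero , j ⟫
  0≢1 eq with () ← ⟪⟫-copy eq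

  module _ (D : Fin k → Fin k → Bool) where

    joinIf : ∀ {m} → Bool → Fin k → Fin k → Expr K m → Expr K m
    joinIf true  i j e = join ⟪ zero , i ⟫ ⟪ suc zero , j ⟫ 0≢1 e
    joinIf false i j e = e

    joinAll : ∀ {m} → List (Fin k × Fin k) → Expr K m → Expr K m
    joinAll []             e = e
    joinAll ((i , j) ∷ ps) e = joinAll ps (joinIf (D i j) i j e)

    joinIf-label : ∀ {m} b i j (e : Expr K m) → label ⟦ joinIf b i j e ⟧ ≡ label ⟦ e ⟧
    joinIf-label true  i j e = refl
    joinIf-label false i j e = refl

    joinAll-label : ∀ {m} ps (e : Expr K m) → label ⟦ joinAll ps e ⟧ ≡ label ⟦ e ⟧
    joinAll-label []             e = refl
    joinAll-label ((i , j) ∷ ps) e = trans (joinAll-label ps (joinIf (D i j) i j e)) (joinIf-label (D i j) i j e)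

    private
      AdjOf : ∀ {m} → Expr K m → Fin m → Fin m → Set
      AdjOf e = Adj (graph ⟦ e ⟧)

      joinIf-mono : ∀ {m} b i j (e : Expr K m) {u v} → AdjOf e u v → AdjOf (joinIf b i j e) u v
      joinIf-mono true  i j e p = inj₁ p
      joinIf-mono false i j e p = p

    joinAll-mono : ∀ {m} ps (e : Expr K m) {u v} → Adj (graph ⟦ e ⟧) u v → Adj (graph ⟦ joinAll ps e ⟧) u v
    joinAll-mono []             e p = p
    joinAll-mono ((i , j) ∷ ps) e p = joinAll-mono ps (joinIf (D i j) i j e) (joinIf-mono (D i j) i j e p)

    joinAll-new : ∀ {m} ps (e : Expr K m) {u v i j} → label ⟦ e ⟧ u ≡ ⟪ zero , i ⟫ → label ⟦ e ⟧ v ≡ ⟪ suc zero , j ⟫ →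
      D i j ≡ true → (i , j) L.∈ ps → Adj (graph ⟦ joinAll ps e ⟧) u v
    joinAll-new ((i , j) ∷ ps) e p q d (here refl) rewrite d =
      joinAll-mono ps (joinIf true i j e) (inj₂ (inj₁ (p , q)))
    joinAll-new ((i′ , j′) ∷ ps) e {u} {v} p q d (there ∈ps) =
      joinAll-new ps (joinIf (D i′ j′) i′ j′ e)
        (trans (cong (λ l → l u) (joinIf-label (D i′ j′) i′ j′ e)) p)
        (trans (cong (λ l → l v) (joinIf-label (D i′ j′) i′ j′ e)) q) d ∈ps

    private
      joinIf-inv : ∀ {m} b i j (e : Expr K m) {u v} → AdjOf (joinIf b i j e) u v → AdjOf e u v ⊎
        (b ≡ true × ((label ⟦ e ⟧ u ≡ ⟪ zero , i ⟫ × label ⟦ e ⟧ v ≡ ⟪ suc zero , j ⟫) ⊎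
                    (label ⟦ e ⟧ v ≡ ⟪ zero , i ⟫ × label ⟦ e ⟧ u ≡ ⟪ suc zero , j ⟫)))
      joinIf-inv true  i j e (inj₁ p)               = inj₁ p
      joinIf-inv true  i j e (inj₂ (inj₁ (p , q)))  = inj₂ (refl , inj₁ (p , q))
      joinIf-inv true  i j e (inj₂ (inj₂ (p , q)))  = inj₂ (refl , inj₂ (q , p))
      joinIf-inv false i j e p                      = inj₁ p

    joinAll-inv : ∀ {m} ps (e : Expr K m) {u v} → Adj (graph ⟦ joinAll ps e ⟧) u v → Adj (graph ⟦ e ⟧) u v ⊎
      ∃₂ λ i j → D i j ≡ true × ((label ⟦ e ⟧ u ≡ ⟪ zero , i ⟫ × label ⟦ e ⟧ v ≡ ⟪ suc zero , j ⟫) ⊎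
                               (label ⟦ e ⟧ v ≡ ⟪ zero , i ⟫ × label ⟦ e ⟧ u ≡ ⟪ suc zero , j ⟫))
    joinAll-inv []             e p = inj₁ p
    joinAll-inv ((i , j) ∷ ps) e {u} {v} p with joinAll-inv ps (joinIf (D i j) i j e) p
    ... | inj₂ (i′ , j′ , d , r) rewrite joinIf-label (D i j) i j e = inj₂ (i′ , j′ , d , r)
    ... | inj₁ p′ with joinIf-inv (D i j) i j e p′
    ...   | inj₁ p″      = inj₁ p″
    ...   | inj₂ (d , r) = inj₂ (i , j , d , r)

    joinPairs : ∀ {m} → Expr K m → Expr K m
    joinPairs = joinAll (cartesianProduct (allFin k) (allFin k))

    module _ {m} (e : Expr K m) {u v : Fin m} where

      private
        pairs = cartesianProduct (allFin k) (allFin k)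

      joinPairs-same : ∀ {a x y} → label ⟦ e ⟧ u ≡ ⟪ a , x ⟫ → label ⟦ e ⟧ v ≡ ⟪ a , y ⟫ →
        adjᵇ (graph ⟦ joinPairs e ⟧) u v ≡ adjᵇ (graph ⟦ e ⟧) u v
      joinPairs-same p q = does-⇔ (adj? (graph ⟦ joinPairs e ⟧) u v) (adj? (graph ⟦ e ⟧) u v) old (joinAll-mono pairs e)
        where
        old : Adj (graph ⟦ joinPairs e ⟧) u v → Adj (graph ⟦ e ⟧) u v
        old r with joinAll-inv pairs e r
        ... | inj₁ r′ = r′
        ... | inj₂ (_ , _ , _ , inj₁ (p′ , q′)) with () ← trans (sym (⟪⟫-copy (trans (sym p) p′))) (⟪⟫-copy (trans (sym q) q′))
        ... | inj₂ (_ , _ , _ , inj₂ (q′ , p′)) with () ← trans (sym (⟪⟫-copy (trans (sym p) p′))) (⟪⟫-copy (trans (sym q) q′))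

      joinPairs-diff : ∀ {x y} → label ⟦ e ⟧ u ≡ ⟪ zero , x ⟫ → label ⟦ e ⟧ v ≡ ⟪ suc zero , y ⟫ →
        adjᵇ (graph ⟦ e ⟧) u v ≡ false → adjᵇ (graph ⟦ joinPairs e ⟧) u v ≡ D x y
      joinPairs-diff {x} {y} p q none = trans
        (does-⇔ (adj? (graph ⟦ joinPairs e ⟧) u v) (D x y 𝔹.≟ true) old
          (λ d → joinAll-new pairs e p q d (∈-cartesianProduct⁺ (∈-allFin x) (∈-allFin y))))
        (does-true (D x y))
        where
        does-true : ∀ b → does (b 𝔹.≟ true) ≡ b
        does-true true  = refl
        does-true false = refl
        old : Adj (graph ⟦ joinPairs e ⟧) u v → D x y ≡ true
        old r with joinAll-inv pairs e r
        ... | inj₁ r′ = contradiction (trans (sym (⇒does (adj? (graph ⟦ e ⟧) u v) r′)) none) λ ()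
        ... | inj₂ (_ , _ , _ , inj₂ (q′ , _)) with () ← ⟪⟫-copy (trans (sym q) q′)
        ... | inj₂ (_ , _ , d , inj₁ (p′ , q′)) =
          trans (cong₂ D (⟪⟫-index (trans (sym p) p′)) (⟪⟫-index (trans (sym q) q′))) d

  module _ {n} {ad : Matrix n} (ad-sym : ∀ u v → ad u v ≡ ad v u) (ad-irrefl : ∀ v → ad v v ≡ false) where

    record Built (X : Sub n) (c : Fin n → Fin k) : Set where
      field
        {order}   : ℕ
        expr      : Expr K order
        place     : Fin order → Fin n
        place-inj : ∀ {i j} → place i ≡ place j → i ≡ j
        place-∈   : ∀ i → place i ∈ X
        place-sur : ∀ {v} → v ∈ X → ∃ λ i → place i ≡ v
        adjacency : ∀ i j → adjᵇ (graph ⟦ expr ⟧) i j ≡ ad (place i) (place j)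
        labels    : ∀ i → label ⟦ expr ⟧ i ≡ ⟪ zero , c (place i) ⟫

    open Built

    -- The second part is moved to copy 1 before the union, so that joins between copies 0 and 1
    -- create exactly the edges across. Both copies then pass through copy 2 on their way back to
    -- copy 0; renaming inside copy 0 directly would confuse old classes with new ones.
    graft : ∀ {X Y Z : Sub n} {c c₁ c₂ : Fin n → Fin k} → Built Y c₁ → Built Z c₂ →
      (∀ {v} → v ∈ X → v ∈ Y ⊎ v ∈ Z) → Y ⊆ X → Z ⊆ X → (∀ {v} → v ∈ Y → v ∉ Z) →
      (∀ {u u′} → u ∈ Y → u′ ∈ Y → c₁ u ≡ c₁ u′ → c u ≡ c u′) →
      (∀ {u u′} → u ∈ Z → u′ ∈ Z → c₂ u ≡ c₂ u′ → c u ≡ c u′) →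
      (∀ {u u′ v v′} → u ∈ Y → u′ ∈ Y → v ∈ Z → v′ ∈ Z → c₁ u ≡ c₁ u′ → c₂ v ≡ c₂ v′ → ad u v ≡ ad u′ v′) →
      Built X c
    graft {X} {Y} {Z} {c} {c₁} {c₂} B₁ B₂ cover Y⊆X Z⊆X disj mergeY mergeZ cross = record
      { expr      = e₅
      ; place     = pl
      ; place-inj = pl-inj
      ; place-∈   = pl-∈
      ; place-sur = pl-sur
      ; adjacency = λ i j → trans (g₅ i j) (adj₂ i j)
      ; labels    = lab₅
      }
      where
      m₁ = order B₁
      m₂ = order B₂
      p₁ = place B₁
      p₂ = place B₂

      -- Classes are joined if some pair of vertices in them is adjacent; by `cross` the choice of
      -- the pair does not matter.
      D : Fin k → Fin k → Bool
      D i j = does (F.any? (λ u → F.any? (λ v →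
        (u ∈? Y) ×-dec (v ∈? Z) ×-dec (c₁ u F.≟ i) ×-dec (c₂ v F.≟ j) ×-dec (ad u v 𝔹.≟ true))))

      D-ad : ∀ {u v} → u ∈ Y → v ∈ Z → D (c₁ u) (c₂ v) ≡ ad u v
      D-ad {u} {v} u∈Y v∈Z with F.any? (λ u′ → F.any? (λ v′ →
        (u′ ∈? Y) ×-dec (v′ ∈? Z) ×-dec (c₁ u′ F.≟ c₁ u) ×-dec (c₂ v′ F.≟ c₂ v) ×-dec (ad u′ v′ 𝔹.≟ true)))
      ... | yes (u′ , v′ , u′∈ , v′∈ , p , q , a) = trans (sym a) (cross u′∈ u∈Y v′∈ v∈Z p q)
      ... | no ∄ with ad u v in a
      ...   | true  = contradiction (u , v , u∈Y , v∈Z , refl , refl , a) ∄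
      ...   | false = refl

      e₂ = move zero (suc zero) (λ ()) id (expr B₂)
      e₁₂ = union (expr B₁) e₂
      ej = joinPairs D e₁₂
      e₃ = move zero (suc (suc zero)) (λ ()) (factor Y c₁ c) ej
      e₄ = move (suc zero) (suc (suc zero)) (λ ()) (factor Z c₂ c) e₃
      e₅ = move (suc (suc zero)) zero (λ ()) id e₄

      g₅ : ∀ i j → adjᵇ (graph ⟦ e₅ ⟧) i j ≡ adjᵇ (graph ⟦ ej ⟧) i j
      g₅ i j = trans (moveAll-adj (suc (suc zero)) zero (λ ()) id (allFin k) e₄ i j)
        (trans (moveAll-adj (suc zero) (suc (suc zero)) (λ ()) (factor Z c₂ c) (allFin k) e₃ i j)
          (moveAll-adj zero (suc (suc zero)) (λ ()) (factor Y c₁ c) (allFin k) ej i j))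

      pl : Fin (m₁ + m₂) → Fin n
      pl = [ p₁ , p₂ ]′ ∘ splitAt m₁

      pl-∈ : ∀ i → pl i ∈ X
      pl-∈ i with splitAt m₁ i
      ... | inj₁ i = Y⊆X (place-∈ B₁ i)
      ... | inj₂ i = Z⊆X (place-∈ B₂ i)

      pl-sur : ∀ {v} → v ∈ X → ∃ λ i → pl i ≡ v
      pl-sur v∈X with cover v∈X
      ... | inj₁ v∈Y = let i , eq = place-sur B₁ v∈Y in i ↑ˡ m₂ , trans (cong [ p₁ , p₂ ]′ (F.splitAt-↑ˡ m₁ i m₂)) eq
      ... | inj₂ v∈Z = let i , eq = place-sur B₂ v∈Z in m₁ ↑ʳ i , trans (cong [ p₁ , p₂ ]′ (F.splitAt-↑ʳ m₁ m₂ i)) eq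

      pl-inj : ∀ {i j} → pl i ≡ pl j → i ≡ j
      pl-inj {i} {j} eq with splitAt m₁ i in p | splitAt m₁ j in q
      ... | inj₁ i′ | inj₁ j′ = trans (sym (F.splitAt⁻¹-↑ˡ p)) (trans (cong (_↑ˡ m₂) (place-inj B₁ eq)) (F.splitAt⁻¹-↑ˡ q))
      ... | inj₂ i′ | inj₂ j′ = trans (sym (F.splitAt⁻¹-↑ʳ p)) (trans (cong (m₁ ↑ʳ_) (place-inj B₂ eq)) (F.splitAt⁻¹-↑ʳ q))
      ... | inj₁ i′ | inj₂ j′ = contradiction (subst (_∈ Z) (sym eq) (place-∈ B₂ j′)) (disj (place-∈ B₁ i′))
      ... | inj₂ i′ | inj₁ j′ = contradiction (subst (_∈ Z) eq (place-∈ B₂ i′)) (disj (place-∈ B₁ j′))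

      lab₂ : ∀ i → label ⟦ e₂ ⟧ i ≡ ⟪ suc zero , c₂ (p₂ i) ⟫
      lab₂ i = moveAll-moved zero (suc zero) (λ ()) id (allFin k) (expr B₂) (∈-allFin _) (labels B₂ i)

      labˡ : ∀ {i i′} → splitAt m₁ i ≡ inj₁ i′ → label ⟦ e₁₂ ⟧ i ≡ ⟪ zero , c₁ (p₁ i′) ⟫
      labˡ {i} {i′} eq = trans (cong [ label ⟦ expr B₁ ⟧ , label ⟦ e₂ ⟧ ]′ eq) (labels B₁ i′)

      labʳ : ∀ {i i′} → splitAt m₁ i ≡ inj₂ i′ → label ⟦ e₁₂ ⟧ i ≡ ⟪ suc zero , c₂ (p₂ i′) ⟫
      labʳ {i} {i′} eq = trans (cong [ label ⟦ expr B₁ ⟧ , label ⟦ e₂ ⟧ ]′ eq) (lab₂ i′)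

      labⱼ : ∀ i → label ⟦ ej ⟧ i ≡ label ⟦ e₁₂ ⟧ i
      labⱼ i = cong (λ l → l i) (joinAll-label D (cartesianProduct (allFin k) (allFin k)) e₁₂)

      lab₅ : ∀ i → label ⟦ e₅ ⟧ i ≡ ⟪ zero , c (pl i) ⟫
      lab₅ i = moveAll-moved (suc (suc zero)) zero (λ ()) id (allFin k) e₄ (∈-allFin _) (go (splitAt m₁ i) refl)
        where
        go : ∀ s → splitAt m₁ i ≡ s → label ⟦ e₄ ⟧ i ≡ ⟪ suc (suc zero) , c ([ p₁ , p₂ ]′ (splitAt m₁ i)) ⟫
        go (inj₁ i′) eq = moveAll-other (suc zero) _ (λ ()) _ (allFin k) e₃ (λ ())
          (trans (moveAll-moved zero _ (λ ()) _ (allFin k) ej (∈-allFin _) (trans (labⱼ i) (labˡ eq)))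
            (cong ⟪ suc (suc zero) ,_⟫ (trans (factor-≡ Y c₁ c mergeY (place-∈ B₁ i′)) (cong (c ∘ [ p₁ , p₂ ]′) (sym eq)))))
        go (inj₂ i′) eq = trans (moveAll-moved (suc zero) _ (λ ()) _ (allFin k) e₃ (∈-allFin _)
            (moveAll-other zero _ (λ ()) _ (allFin k) ej (λ ()) (trans (labⱼ i) (labʳ eq))))
            (cong ⟪ suc (suc zero) ,_⟫ (trans (factor-≡ Z c₂ c mergeZ (place-∈ B₂ i′)) (cong (c ∘ [ p₁ , p₂ ]′) (sym eq))))

      union-adj : ∀ i j → adjᵇ (graph ⟦ e₁₂ ⟧) i j ≡
        [ (λ i → [ (λ j → ad (p₁ i) (p₁ j)) , (λ _ → false) ]′ (splitAt m₁ j))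
        , (λ i → [ (λ _ → false) , (λ j → ad (p₂ i) (p₂ j)) ]′ (splitAt m₁ j)) ]′ (splitAt m₁ i)
      union-adj i j = trans (adjᵇ-⊕ (graph ⟦ expr B₁ ⟧) (graph ⟦ e₂ ⟧) i j) (parts (splitAt m₁ i) (splitAt m₁ j))
        where
        parts : ∀ s t →
          [ (λ i → [ (λ j → adjᵇ (graph ⟦ expr B₁ ⟧) i j) , (λ _ → false) ]′ t)
          , (λ i → [ (λ _ → false) , (λ j → adjᵇ (graph ⟦ e₂ ⟧) i j) ]′ t) ]′ s ≡
          [ (λ i → [ (λ j → ad (p₁ i) (p₁ j)) , (λ _ → false) ]′ t)
          , (λ i → [ (λ _ → false) , (λ j → ad (p₂ i) (p₂ j)) ]′ t) ]′ s
        parts (inj₁ i) (inj₁ j) = adjacency B₁ i j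
        parts (inj₁ i) (inj₂ j) = refl
        parts (inj₂ i) (inj₁ j) = refl
        parts (inj₂ i) (inj₂ j) = trans (moveAll-adj zero (suc zero) (λ ()) id (allFin k) (expr B₂) i j) (adjacency B₂ i j)

      adjᵇ-sym : ∀ i j → adjᵇ (graph ⟦ ej ⟧) i j ≡ adjᵇ (graph ⟦ ej ⟧) j i
      adjᵇ-sym i j = does-⇔ (adj? (graph ⟦ ej ⟧) i j) (adj? (graph ⟦ ej ⟧) j i) (adj-sym (graph ⟦ ej ⟧)) (adj-sym (graph ⟦ ej ⟧))

      AdjParts : Fin m₁ ⊎ Fin m₂ → Fin m₁ ⊎ Fin m₂ → Bool
      AdjParts s t = [ (λ i → [ (λ j → ad (p₁ i) (p₁ j)) , (λ _ → false) ]′ t)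
                     , (λ i → [ (λ _ → false) , (λ j → ad (p₂ i) (p₂ j)) ]′ t) ]′ s

      union-adj′ : ∀ {i j s t} → splitAt m₁ i ≡ s → splitAt m₁ j ≡ t → adjᵇ (graph ⟦ e₁₂ ⟧) i j ≡ AdjParts s t
      union-adj′ {i} {j} p q = trans (union-adj i j) (cong₂ AdjParts p q)

      diff : ∀ {i j i′ j′} → splitAt m₁ i ≡ inj₁ i′ → splitAt m₁ j ≡ inj₂ j′ → adjᵇ (graph ⟦ ej ⟧) i j ≡ ad (p₁ i′) (p₂ j′)
      diff {i′ = i′} {j′} p q = trans (joinPairs-diff D e₁₂ (labˡ p) (labʳ q) (union-adj′ p q)) (D-ad (place-∈ B₁ i′) (place-∈ B₂ j′))

      adj₂ : ∀ i j → adjᵇ (graph ⟦ ej ⟧) i j ≡ ad (pl i) (pl j)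
      adj₂ i j = go (splitAt m₁ i) (splitAt m₁ j) refl refl
        where
        go : ∀ s t → splitAt m₁ i ≡ s → splitAt m₁ j ≡ t → adjᵇ (graph ⟦ ej ⟧) i j ≡ ad ([ p₁ , p₂ ]′ (splitAt m₁ i)) ([ p₁ , p₂ ]′ (splitAt m₁ j))
        go s t p q = trans (value s t p q) (cong₂ ad (cong [ p₁ , p₂ ]′ (sym p)) (cong [ p₁ , p₂ ]′ (sym q)))
          where
          value : ∀ s t → splitAt m₁ i ≡ s → splitAt m₁ j ≡ t → adjᵇ (graph ⟦ ej ⟧) i j ≡ ad ([ p₁ , p₂ ]′ s) ([ p₁ , p₂ ]′ t)
          value (inj₁ i′) (inj₁ j′) p q = trans (joinPairs-same D e₁₂ (labˡ p) (labˡ q)) (union-adj′ p q)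
          value (inj₂ i′) (inj₂ j′) p q = trans (joinPairs-same D e₁₂ (labʳ p) (labʳ q)) (union-adj′ p q)
          value (inj₁ i′) (inj₂ j′) p q = diff p q
          value (inj₂ i′) (inj₁ j′) p q = trans (adjᵇ-sym i j) (trans (diff q p) (ad-sym (p₁ j′) (p₂ i′)))

    build : ∀ {X c} → Tree ad (λ _ → tt) k X c → Built X c
    build {c = c} (leaf v v∈X only) = record
      { expr      = vertex ⟪ zero , c v ⟫
      ; place     = λ _ → v
      ; place-inj = λ { {zero} {zero} _ → refl }
      ; place-∈   = λ _ → v∈X
      ; place-sur = λ u∈X → zero , sym (only u∈X)
      ; adjacency = λ { zero zero → sym (ad-irrefl v) }
      ; labels    = λ _ → refl
      }
    build (node t₁ t₂ cover Y⊆X Z⊆X disj mergeY mergeZ cross) =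
      graft (build t₁) (build t₂) cover Y⊆X Z⊆X disj
        (λ p q → mergeY p q refl) (λ p q → mergeZ p q refl) (λ p p′ q q′ e e′ → cross p p′ q q′ refl e refl e′)

tree⇒constructible : ∀ {n} (G : Graph n) {k c} → Tree (adjᵇ G) (λ _ → tt) k (λ _ → true) c → Constructible (3 * k) G
tree⇒constructible {n} G {k} t = go B (F.injective⇒≤ {f = place B} (place-inj B)) (F.injective⇒≤ {f = pre} pre-inj)
  where
  ad-sym′ : ∀ u v → adjᵇ G u v ≡ adjᵇ G v u
  ad-sym′ u v = does-⇔ (adj? G u v) (adj? G v u) (adj-sym G) (adj-sym G)
  ad-irrefl′ : ∀ v → adjᵇ G v v ≡ false
  ad-irrefl′ v with adj? G v v
  ... | yes p = contradiction p (adj-irrefl G)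
  ... | no _  = refl
  open Copies k (3 * k) combine (λ {a} {b} {i} {j} → F.combine-injectiveˡ a i b j) (λ {a} {b} {i} {j} → F.combine-injectiveʳ a i b j)
  open Built
  B = build ad-sym′ ad-irrefl′ t
  pre : Fin n → Fin (order B)
  pre v = proj₁ (place-sur B {v} (mem refl))
  pre-place : ∀ v → place B (pre v) ≡ v
  pre-place v = proj₂ (place-sur B {v} (mem refl))
  pre-inj : ∀ {u v} → pre u ≡ pre v → u ≡ v
  pre-inj {u} {v} eq = trans (sym (pre-place u)) (trans (cong (place B) eq) (pre-place v))
  -- The order of the built expression equals `n` only provably, by an injection in each direction;
  -- it is abstracted here so that the equation can be matched.
  go : (B′ : Built ad-sym′ ad-irrefl′ (λ _ → true) _) → order B′ ≤ n → n ≤ order B′ → Constructible (3 * k) G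
  go record { order = m ; expr = e ; place = f ; place-inj = inj ; place-sur = sur ; adjacency = a } m≤n n≤m
    with ℕ.≤-antisym m≤n n≤m
  ... | refl = e , mk↔ₛ′ f (λ v → proj₁ (sur {v} (mem refl))) (λ v → proj₂ (sur {v} (mem refl))) (λ i → inj (proj₂ (sur {f i} (mem refl)))) ,
    λ u v → mk⇔ (λ p → does⇒ (adj? G _ _) (trans (sym (a u v)) (⇒does (adj? (graph ⟦ e ⟧) u v) p)))
      (λ p → does⇒ (adj? (graph ⟦ e ⟧) u v) (trans (a u v) (⇒does (adj? G _ _) p)))

-- Operations on decomposition trees, splittings and connectedness

module _ {n : ℕ} where

  W : (ad : Matrix n) {L : Set} (τ : Fin n → L) (k : ℕ) → Sub n → Set
  W ad τ k X = Σ (Fin n → Fin k) (Tree ad τ k X)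

  Inhabited : Sub n → Set
  Inhabited X = ∃ (_∈ X)

  inhabited? : ∀ X → Dec (Inhabited X)
  inhabited? X = F.any? (_∈? X)

  module _ {ad : Matrix n} {L L′ : Set} {τ : Fin n → L} {τ′ : Fin n → L′} {k : ℕ} where

    refine-labels : (∀ {u v} → τ′ u ≡ τ′ v → τ u ≡ τ v) → ∀ {X} → W ad τ k X → W ad τ′ k X
    refine-labels finer (c , t) = c , go t
      where
      go : ∀ {X c} → Tree ad τ k X c → Tree ad τ′ k X c
      go (leaf v v∈X only) = leaf v v∈X only
      go (node t₁ t₂ co Y⊆ Z⊆ dj mY mZ cr) = node (go t₁) (go t₂) co Y⊆ Z⊆ dj
        (λ p q e → mY p q (finer e)) (λ p q e → mZ p q (finer e))
        (λ p p′ q q′ e f e′ f′ → cr p p′ q q′ (finer e) f (finer e′) f′)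

    -- This is where the global labels are paid for: `t` keys make `t` copies of every local class.
    absorb-labels : ∀ {t} (key : Fin n → Fin t) → (∀ {u v} → key u ≡ key v → τ′ u ≡ τ′ v) → ∀ {X} → W ad τ′ k X → W ad τ (t * k) X
    absorb-labels {t} key finer (c , tr) = _ , go tr
      where
      new : (Fin n → Fin k) → Fin n → Fin (t * k)
      new c v = combine (key v) (c v)
      old : ∀ {c u v} → new c u ≡ new c v → key u ≡ key v × c u ≡ c v
      old {c} {u} {v} eq = let p , q = F.combine-injective (key u) (c u) (key v) (c v) eq in p , q
      merge : ∀ {Y : Sub n} {c c₁} → (∀ {u u′} → u ∈ Y → u′ ∈ Y → τ′ u ≡ τ′ u′ → c₁ u ≡ c₁ u′ → c u ≡ c u′) →
        ∀ {u u′} → u ∈ Y → u′ ∈ Y → τ u ≡ τ u′ → new c₁ u ≡ new c₁ u′ → new c u ≡ new c u′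
      merge {c₁ = c₁} m p q _ eq = let e , f = old {c₁} eq in cong₂ combine e (m p q (finer e) f)
      go : ∀ {X c} → Tree ad τ′ k X c → Tree ad τ (t * k) X (new c)
      go (leaf v v∈X only) = leaf v v∈X only
      go (node {c₁ = c₁} {c₂} t₁ t₂ co Y⊆ Z⊆ dj mY mZ cr) = node (go t₁) (go t₂) co Y⊆ Z⊆ dj (merge mY) (merge mZ)
        (λ p p′ q q′ _ e _ f → let e₁ , e₂ = old {c₁} e ; f₁ , f₂ = old {c₂} f in cr p p′ q q′ (finer e₁) e₂ (finer f₁) f₂)

  module _ {ad : Matrix n} {L : Set} {τ : Fin n → L} where

    more-classes : ∀ {k k′} → k ≤ k′ → ∀ {X} → W ad τ k X → W ad τ k′ X
    more-classes {k} {k′} k≤k′ (c , t) = _ , go t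
      where
      new : (Fin n → Fin k) → Fin n → Fin k′
      new c v = F.inject≤ (c v) k≤k′
      old : ∀ {c u v} → new c u ≡ new c v → c u ≡ c v
      old = F.inject≤-injective k≤k′ k≤k′ _ _
      go : ∀ {X c} → Tree ad τ k X c → Tree ad τ k′ X (new c)
      go (leaf v v∈X only) = leaf v v∈X only
      go (node {c₁ = c₁} {c₂} t₁ t₂ co Y⊆ Z⊆ dj mY mZ cr) = node (go t₁) (go t₂) co Y⊆ Z⊆ dj
        (λ p q e f → cong (λ i → F.inject≤ i k≤k′) (mY p q e (old {c₁} f)))
        (λ p q e f → cong (λ i → F.inject≤ i k≤k′) (mZ p q e (old {c₂} f)))
        (λ p p′ q q′ e f e′ f′ → cr p p′ q q′ e (old {c₁} f) e′ (old {c₂} f′))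

    -- A node only asks for adjacencies across it to be constant on classes, and classes refine the
    -- labels. A change of adjacency that depends on the two labels respects this, so complementing
    -- between types needs no new class.
    transform : ∀ {ad′ : Matrix n} (f : L → L → Bool → Bool) {X₀ : Sub n} →
      (∀ {u v} → u ∈ X₀ → v ∈ X₀ → u ≢ v → ad u v ≡ f (τ u) (τ v) (ad′ u v)) → ∀ {k X} → X ⊆ X₀ → W ad′ τ k X → W ad τ k X
    transform {ad′} f {X₀} eq {k} X⊆ (c , t) = c , go t X⊆
      where
      go : ∀ {X c} → Tree ad′ τ k X c → X ⊆ X₀ → Tree ad τ k X c
      go (leaf v v∈X only) _ = leaf v v∈X only
      go (node {Z = Z} t₁ t₂ co Y⊆ Z⊆ dj mY mZ cr) X⊆ = node (go t₁ (X⊆ ∘ Y⊆)) (go t₂ (X⊆ ∘ Z⊆)) co Y⊆ Z⊆ dj mY mZ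
        (λ {u} {u′} {v} {v′} p p′ q q′ e g e′ g′ →
          trans (eq (X⊆ (Y⊆ p)) (X⊆ (Z⊆ q)) (λ u≡v → dj p (subst (_∈ Z) (sym u≡v) q)))
          (trans (trans (cong₂ (λ x y → f x y (ad′ u v)) e e′) (cong (f (τ u′) (τ v′)) (cr p p′ q q′ e g e′ g′)))
          (sym (eq (X⊆ (Y⊆ p′)) (X⊆ (Z⊆ q′)) (λ u≡v → dj p′ (subst (_∈ Z) (sym u≡v) q′))))))

    Uniform : Sub n → Sub n → Set
    Uniform Y Z = ∀ {u u′ v v′} → u ∈ Y → u′ ∈ Y → v ∈ Z → v′ ∈ Z → τ u ≡ τ u′ → τ v ≡ τ v′ → ad u v ≡ ad u′ v′

    -- The cut is described by the labels alone, so the local classes of both parts can be forgotten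
    -- and merged into `zero`; repeated gluing does not accumulate classes.
    glue : ∀ {k} (X S : Sub n) → W ad τ (suc k) (X ∩ S) → W ad τ (suc k) (X ∖ S) → Uniform (X ∩ S) (X ∖ S) → W ad τ (suc k) X
    glue X S (_ , t₁) (_ , t₂) uni = (λ _ → zero) , node t₁ t₂ cover
      (proj₁ ∘ ∈∩ X S) (proj₁ ∘ ∈∖ X S) (λ p q → proj₂ (∈∖ X S q) (proj₂ (∈∩ X S p)))
      (λ _ _ _ _ → refl) (λ _ _ _ _ → refl) (λ p p′ q q′ e _ e′ _ → uni p p′ q q′ e e′)
      where
      cover : ∀ {v} → v ∈ X → v ∈ X ∩ S ⊎ v ∈ X ∖ S
      cover {v} v∈X with v ∈? S
      ... | yes v∈S = inj₁ (∩∈ X S v∈X v∈S)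
      ... | no v∉S  = inj₂ (∖∈ X S v∈X v∉S)

    single : ∀ {k} {X : Sub n} v → v ∈ X → (∀ {u} → u ∈ X → u ≡ v) → W ad τ (suc k) X
    single v v∈X only = (λ _ → zero) , leaf v v∈X only

    peel : ∀ {k} (X : Sub n) v → v ∈ X → (Inhabited (X ∖ ⟨ v ⟩) → W ad τ (suc k) (X ∖ ⟨ v ⟩)) →
      (∀ {w w′} → w ∈ X → w′ ∈ X → w ≢ v → w′ ≢ v → τ w ≡ τ w′ → ad v w ≡ ad v w′) → W ad τ (suc k) X
    peel X v v∈X rest uni with inhabited? (X ∖ ⟨ v ⟩)
    ... | yes more = glue X ⟨ v ⟩ (single v (∩∈ X ⟨ v ⟩ v∈X (v∈⟨v⟩ v)) (∈⟨⟩ ∘ proj₂ ∘ ∈∩ X ⟨ v ⟩)) (rest more)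
      λ {u} {u′} p p′ q q′ _ e → at (∈⟨⟩ (proj₂ (∈∩ X ⟨ v ⟩ p))) (∈⟨⟩ (proj₂ (∈∩ X ⟨ v ⟩ p′))) (∈∖ X ⟨ v ⟩ q) (∈∖ X ⟨ v ⟩ q′) e
      where
      at : ∀ {u u′ w w′} → u ≡ v → u′ ≡ v → w ∈ X × w ∉ ⟨ v ⟩ → w′ ∈ X × w′ ∉ ⟨ v ⟩ → τ w ≡ τ w′ → ad u w ≡ ad u′ w′
      at refl refl (q , x) (q′ , y) e = uni q q′ (λ { refl → x (v∈⟨v⟩ v) }) (λ { refl → y (v∈⟨v⟩ v) }) e
    ... | no none = single v v∈X only
      where
      only : ∀ {u} → u ∈ X → u ≡ v
      only {u} u∈X with u F.≟ v
      ... | yes u≡v = u≡v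
      ... | no u≢v  = contradiction (u , ∖∈ X ⟨ v ⟩ u∈X (u≢v ∘ ∈⟨⟩)) none

    Splitting : Sub n → Set
    Splitting X = Σ (Sub n) λ S → Inhabited (X ∩ S) × Inhabited (X ∖ S) × Uniform (X ∩ S) (X ∖ S)

    decompose : ∀ {k} (P : Sub n → Set) → (∀ {X Y} → Y ⊆ X → P X → P Y) →
      (∀ X → P X → Inhabited X → W ad τ (suc k) X ⊎ Splitting X) → ∀ X → P X → Inhabited X → W ad τ (suc k) X
    decompose {k} P down step X = <-rec Q rec (size X) X refl
      where
      Q : ℕ → Set
      Q s = ∀ X → size X ≡ s → P X → Inhabited X → W ad τ (suc k) X
      rec : ∀ s → (∀ {t} → t < s → Q t) → Q s
      rec s ih X refl PX inh with step X PX inh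
      ... | inj₁ w = w
      ... | inj₂ (S , (v , p) , (w , q) , uni) = glue X S
        (ih (size-< w (proj₁ ∘ ∈∩ X S) (proj₁ (∈∖ X S q)) (λ r → proj₂ (∈∖ X S q) (proj₂ (∈∩ X S r)))) (X ∩ S) refl (down (proj₁ ∘ ∈∩ X S) PX) (v , p))
        (ih (size-< v (proj₁ ∘ ∈∖ X S) (proj₁ (∈∩ X S p)) (λ r → proj₂ (∈∖ X S r) (proj₂ (∈∩ X S p)))) (X ∖ S) refl (down (proj₁ ∘ ∈∖ X S) PX) (w , q))
        uni

    uniform-tree : ∀ {k} X → (∀ {u u′ v v′} → u ∈ X → u′ ∈ X → v ∈ X → v′ ∈ X → u ≢ v → u′ ≢ v′ →
      τ u ≡ τ u′ → τ v ≡ τ v′ → ad u v ≡ ad u′ v′) → Inhabited X → W ad τ (suc k) X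
    uniform-tree X₀ uni = decompose (_⊆ X₀) (λ Y⊆X X⊆ → X⊆ ∘ Y⊆X) step X₀ id
      where
      step : ∀ X → X ⊆ X₀ → Inhabited X → W ad τ _ X ⊎ Splitting X
      step X X⊆ (v , v∈X) with inhabited? (X ∖ ⟨ v ⟩)
      ... | no none = inj₁ (peel X v v∈X (λ more → contradiction more none)
        (λ w∈ w′∈ w≢ w′≢ e → uni (X⊆ v∈X) (X⊆ v∈X) (X⊆ w∈) (X⊆ w′∈) (w≢ ∘ sym) (w′≢ ∘ sym) refl e))
      ... | yes more = inj₂ (⟨ v ⟩ , (v , ∩∈ X ⟨ v ⟩ v∈X (v∈⟨v⟩ v)) , more , λ p p′ q q′ →
        uni (X⊆ (proj₁ (∈∩ X ⟨ v ⟩ p))) (X⊆ (proj₁ (∈∩ X ⟨ v ⟩ p′))) (X⊆ (proj₁ (∈∖ X ⟨ v ⟩ q))) (X⊆ (proj₁ (∈∖ X ⟨ v ⟩ q′)))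
          (apart p q) (apart p′ q′))
        where
        apart : ∀ {u w} → u ∈ X ∩ ⟨ v ⟩ → w ∈ X ∖ ⟨ v ⟩ → u ≢ w
        apart p q refl = proj₂ (∈∖ X ⟨ v ⟩ q) (proj₂ (∈∩ X ⟨ v ⟩ p))

  -- Connectedness, phrased as an induction principle over closed sets.

  Closed : Matrix n → Sub n → Sub n → Set
  Closed r X S = ∀ {u v} → u ∈ X → v ∈ X → r u v ≡ true → u ∈ S → v ∈ S

  Connected : Matrix n → Sub n → Set
  Connected r X = ∀ S → Closed r X S → ∀ {u v} → u ∈ X → v ∈ X → u ∈ S → v ∈ S

  -- `Ok` says that a vertex lies in every closed set containing `u`, so the saturated set is the
  -- least closed one. For a relation that is not symmetric this is the set of vertices reachable
  -- from `u`, as used for the tournament below.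
  component : ∀ (r : Matrix n) X u → u ∈ X →
    Σ (Sub n) λ S → u ∈ S × S ⊆ X × Closed r X S × (∀ T → Closed r X T → u ∈ T → S ⊆ T)
  component r X u u∈X =
    let S , seed , ok , closed = saturate Ok step? step ⟨ u ⟩ (λ v∈ → subst Ok (sym (∈⟨⟩ v∈)) (u∈X , λ _ _ u∈T → u∈T))
    in S , seed (v∈⟨v⟩ u) , proj₁ ∘ ok , (λ p q e s → closed s (p , q , e)) , λ T cl u∈T s → proj₂ (ok s) T cl u∈T
    where
    Ok : Fin n → Set
    Ok v = v ∈ X × (∀ T → Closed r X T → u ∈ T → v ∈ T)
    Step : Fin n → Fin n → Set
    Step v w = v ∈ X × w ∈ X × r v w ≡ true
    step? : ∀ v w → Dec (Step v w)
    step? v w = (v ∈? X) ×-dec (w ∈? X) ×-dec (r v w 𝔹.≟ true)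
    step : ∀ {v w} → Ok v → Step v w → Ok w
    step (_ , f) (v∈ , w∈ , e) = w∈ , λ T cl u∈T → cl v∈ w∈ e (f T cl u∈T)

  -- Closed sets are Boolean, but `Ok` is an arbitrary property: saturation carries it along as an
  -- invariant instead of deciding it.
  connected-induction : ∀ {r : Matrix n} {X} → Connected r X → (Ok : Fin n → Set) → (∀ {u v} → u ∈ X → v ∈ X → r u v ≡ true → Ok u → Ok v) →
    ∀ {u v} → u ∈ X → v ∈ X → Ok u → Ok v
  connected-induction {r} {X} conn Ok step {u} u∈ v∈ ok =
    let S , seed , good , closed = saturate Ok step? (λ o (p , q , e) → step p q e o) ⟨ u ⟩ (λ w∈ → subst Ok (sym (∈⟨⟩ w∈)) ok)
    in good (conn S (λ p q e s → closed s (p , q , e)) u∈ v∈ (seed (v∈⟨v⟩ u)))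
    where
    Step : Fin n → Fin n → Set
    Step v w = v ∈ X × w ∈ X × r v w ≡ true
    step? : ∀ v w → Dec (Step v w)
    step? v w = (v ∈? X) ×-dec (w ∈? X) ×-dec (r v w 𝔹.≟ true)

  module _ (r : Matrix n) (r-sym : ∀ u v → r u v ≡ r v u) where

    closed-complement : ∀ {X S} → Closed r X S → Closed r X (λ v → not (S v))
    closed-complement {X} {S} cl {u} {v} p q e (mem s) with S v in v∈S
    ... | false = mem (cong not v∈S)
    ... | true  = contradiction (trans (sym s) (cong not (holds (cl q p (trans (r-sym v u) e) (mem v∈S))))) λ ()

    connected-or-split : ∀ X → Inhabited X →
      Connected r X ⊎ Σ (Sub n) λ S → Inhabited (X ∩ S) × Inhabited (X ∖ S) × (∀ {u v} → u ∈ X ∩ S → v ∈ X ∖ S → r u v ≡ false)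
    connected-or-split X (u , u∈X) with component r X u u∈X
    ... | S , u∈S , S⊆X , cl , least with inhabited? (X ∖ S)
    ...   | yes more = inj₂ (S , (u , ∩∈ X S u∈X u∈S) , more , λ {v} {w} p q → 𝔹.¬-not λ e →
      proj₂ (∈∖ X S q) (cl (proj₁ (∈∩ X S p)) (proj₁ (∈∖ X S q)) e (proj₂ (∈∩ X S p))))
    ...   | no none = inj₁ conn
      where
      all : X ⊆ S
      all {v} v∈X with v ∈? S
      ... | yes v∈S = v∈S
      ... | no v∉S  = contradiction (v , ∖∈ X S v∈X v∉S) none
      conn : Connected r X
      conn T clT {v} {w} v∈X w∈X v∈T with u ∈? T
      ... | yes u∈T = least T clT u∈T (all w∈X)
      ... | no u∉T  = contradiction
        (trans (sym (holds (least (λ v → not (T v)) (closed-complement clT) (mem (cong not (∉⇒false T u∉T))) (all v∈X)))) (cong not (holds v∈T))) λ ()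

  by-components : ∀ {ad : Matrix n} (ad-sym : ∀ u v → ad u v ≡ ad v u) {L : Set} {τ : Fin n → L} {k} (X₀ : Sub n) →
    (∀ X → X ⊆ X₀ → Inhabited X → Connected ad X → W ad τ (suc k) X) → Inhabited X₀ → W ad τ (suc k) X₀
  by-components {ad} ad-sym {τ = τ} X₀ conn = decompose (_⊆ X₀) (λ Y⊆X X⊆ → X⊆ ∘ Y⊆X) step X₀ id
    where
    step : ∀ X → X ⊆ X₀ → Inhabited X → W ad τ _ X ⊎ Splitting X
    step X X⊆ inh with connected-or-split ad ad-sym X inh
    ... | inj₁ c = inj₁ (conn X X⊆ inh c)
    ... | inj₂ (S , i , j , none) = inj₂ (S , i , j , λ p p′ q q′ _ _ → trans (none p q) (sym (none p′ q′)))

-- Graphs of degree at most two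

module _ {n : ℕ} (ad : Matrix n) (ad-sym : ∀ u v → ad u v ≡ ad v u) where

  ∪-elim : ∀ {Y : Sub n} {v w} {P : Set} → w ∈ Y ∪ ⟨ v ⟩ → (w ∈ Y → P) → (w ≡ v → P) → P
  ∪-elim {Y} {v} w∈ f g = [ f , g ∘ ∈⟨⟩ ]′ (∈∪ Y ⟨ v ⟩ w∈)

  tree-resp : ∀ {L : Set} {τ : Fin n → L} {k X Y c} → X ⊆ Y → Y ⊆ X → Tree ad τ k Y c → Tree ad τ k X c
  tree-resp X⊆Y Y⊆X (leaf v v∈Y only) = leaf v (Y⊆X v∈Y) (only ∘ X⊆Y)
  tree-resp X⊆Y Y⊆X (node t₁ t₂ co Y⊆ Z⊆ dj mY mZ cr) = node t₁ t₂ (co ∘ X⊆Y) (Y⊆X ∘ Y⊆) (Y⊆X ∘ Z⊆) dj mY mZ cr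

  -- A graph of maximum degree two is built by growing paths at both ends: only the two
  -- distinguished vertices of the part built so far have neighbours outside of it.

  module _ (X : Sub n) (deg≤2 : ∀ {v a b c} → v ∈ X → a ∈ X → b ∈ X → c ∈ X →
      ad v a ≡ true → ad v b ≡ true → ad v c ≡ true → a ≡ b ⊎ b ≡ c ⊎ a ≡ c) where

    private
      Out : Sub n → Fin n → Fin n → Set
      Out Y v w = w ∈ X × w ∉ Y × ad v w ≡ true

      out? : ∀ Y v → Dec (∃ (Out Y v))
      out? Y v = F.any? (λ w → (w ∈? X) ×-dec ¬? (w ∈? Y) ×-dec (ad v w 𝔹.≟ true))

      Unique-Out : Sub n → Fin n → Set
      Unique-Out Y v = ∀ {w w′} → Out Y v w → Out Y v w′ → w ≡ w′

      mark : ∀ {P Q : Set} → Dec P → Dec Q → Fin 3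
      mark (yes _) _       = zero
      mark (no _)  (yes _) = suc zero
      mark (no _)  (no _)  = suc (suc zero)

      cls : Fin n → Fin n → Fin n → Fin 3
      cls p q v = mark (v F.≟ p) (v F.≟ q)

      cls-other : ∀ {p q v} → v ≢ p → v ≢ q → cls p q v ≡ suc (suc zero)
      cls-other {p} {q} {v} a b with v F.≟ p | v F.≟ q
      ... | yes c | _     = contradiction c a
      ... | no _  | yes c = contradiction c b
      ... | no _  | no _  = refl

      cls-≡ : ∀ {p q u v} → cls p q u ≡ cls p q v → (u ≡ v) ⊎ ((u ≢ p × u ≢ q) × (v ≢ p × v ≢ q))
      cls-≡ {p} {q} {u} {v} eq = go (u F.≟ p) (u F.≟ q) (v F.≟ p) (v F.≟ q) eq
        where
        go : (a : Dec (u ≡ p)) (b : Dec (u ≡ q)) (c : Dec (v ≡ p)) (d : Dec (v ≡ q)) → mark a b ≡ mark c d →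
          (u ≡ v) ⊎ ((u ≢ p × u ≢ q) × (v ≢ p × v ≢ q))
        go (yes a) _       (yes c) _       _ = inj₁ (trans a (sym c))
        go (no _)  (yes b) (no _)  (yes d) _ = inj₁ (trans b (sym d))
        go (no a)  (no b)  (no c)  (no d)  _ = inj₂ ((a , b) , (c , d))
        go (yes _) _       (no _)  (yes _) ()
        go (yes _) _       (no _)  (no _)  ()
        go (no _)  (yes _) (yes _) _       ()
        go (no _)  (yes _) (no _)  (no _)  ()
        go (no _)  (no _)  (yes _) _       ()
        go (no _)  (no _)  (no _)  (yes _) ()

      -- `p` and `q` coincide only at the start of a new path. Such a vertex can still have two
      -- neighbours outside, so uniqueness is demanded only for distinct ends.
      record Grown (Y : Sub n) : Set where
        field
          {p q}  : Fin n
          p∈Y    : p ∈ Y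
          q∈Y    : q ∈ Y
          Y⊆X    : Y ⊆ X
          tree   : Tree ad (λ _ → tt) 3 Y (cls p q)
          inner  : ∀ {v w} → v ∈ Y → v ≢ p → v ≢ q → ¬ Out Y v w
          out-p  : p ≢ q → Unique-Out Y p
          out-q  : p ≢ q → Unique-Out Y q

      open Grown

      fewer : ∀ {Y v w x} → Out (Y ∪ ⟨ w ⟩) v x → Out Y v x × x ≢ w
      fewer {Y} {v} {w} (x∈X , x∉ , e) = (x∈X , x∉ ∘ ∪ˡ Y ⟨ w ⟩ , e) , λ { refl → x∉ (∪ʳ Y ⟨ w ⟩ (v∈⟨v⟩ w)) }

      extend : ∀ {Y} (g : Grown Y) w p′ q′ → w ∈ X → w ∉ Y →
        (p′ ≡ w ⊎ p′ ≡ p g ⊎ p′ ≡ q g) → (q′ ≡ w ⊎ q′ ≡ p g ⊎ q′ ≡ q g) → Tree ad (λ _ → tt) 3 (Y ∪ ⟨ w ⟩) (cls p′ q′)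
      extend {Y} g w p′ q′ w∈X w∉Y p′≡ q′≡ =
        node (tree g) (leaf {c = cls p′ q′} w (v∈⟨v⟩ w) ∈⟨⟩) (∈∪ Y ⟨ w ⟩) (∪ˡ Y ⟨ w ⟩) (∪ʳ Y ⟨ w ⟩)
          (λ v∈Y v∈w → w∉Y (subst (_∈ Y) (∈⟨⟩ v∈w) v∈Y))
          (λ a b _ e → merge a b (cls-≡ e)) (λ _ _ _ e → e)
          (λ a b c d _ e _ _ → cross a b (cls-≡ e) (∈⟨⟩ c) (∈⟨⟩ d))
        where
        old : ∀ {u r} → u ∈ Y → u ≢ p g × u ≢ q g → (r ≡ w ⊎ r ≡ p g ⊎ r ≡ q g) → u ≢ r
        old u∈Y (a , b) (inj₁ refl)        refl = w∉Y u∈Y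
        old u∈Y (a , b) (inj₂ (inj₁ refl)) u≡r  = a u≡r
        old u∈Y (a , b) (inj₂ (inj₂ refl)) u≡r  = b u≡r
        merge : ∀ {u u′} → u ∈ Y → u′ ∈ Y → _ → cls p′ q′ u ≡ cls p′ q′ u′
        merge a b (inj₁ refl)    = refl
        merge a b (inj₂ (x , y)) = trans (cls-other (old a x p′≡) (old a x q′≡)) (sym (cls-other (old b y p′≡) (old b y q′≡)))
        cross : ∀ {u u′ v v′} → u ∈ Y → u′ ∈ Y → _ → v ≡ w → v′ ≡ w → ad u v ≡ ad u′ v′
        cross a b (inj₁ refl) refl refl = refl
        cross a b (inj₂ (x , y)) refl refl = trans
          (𝔹.¬-not (λ r → inner g a (proj₁ x) (proj₂ x) (w∈X , w∉Y , r)))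
          (sym (𝔹.¬-not (λ r → inner g b (proj₁ y) (proj₂ y) (w∈X , w∉Y , r))))

      adjoin⊆ : ∀ {Y w} → Y ⊆ X → w ∈ X → Y ∪ ⟨ w ⟩ ⊆ X
      adjoin⊆ Y⊆X w∈X v∈ = ∪-elim v∈ Y⊆X (λ { refl → w∈X })

      -- w has the neighbour r inside, hence at most one outside
      new-end : ∀ {Y w r} → Y ⊆ X → r ∈ Y → Out Y r w → Unique-Out (Y ∪ ⟨ w ⟩) w
      new-end {Y} {w} {r} Y⊆X r∈Y (w∈X , w∉Y , e) o o′
        with (x∈X , x∉Y , f) , _ ← fewer o | (x′∈X , x′∉Y , f′) , _ ← fewer o′
        with deg≤2 w∈X (Y⊆X r∈Y) x∈X x′∈X (trans (ad-sym w r) e) f f′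
      ... | inj₁ refl        = contradiction r∈Y x∉Y
      ... | inj₂ (inj₁ eq)   = eq
      ... | inj₂ (inj₂ refl) = contradiction r∈Y x′∉Y

      grow-p : ∀ {Y} (g : Grown Y) {w} → Out Y (p g) w → Grown (Y ∪ ⟨ w ⟩)
      grow-p {Y} g {w} o@(w∈X , w∉Y , e) with p g F.≟ q g
      -- A path consisting of one vertex: it stays behind as the second end and has at most one
      -- neighbour left besides `w`.
      ... | yes p≡q = record
        { p∈Y = ∪ʳ Y ⟨ w ⟩ (v∈⟨v⟩ w) ; q∈Y = ∪ˡ Y ⟨ w ⟩ (p∈Y g) ; Y⊆X = adjoin⊆ (Y⊆X g) w∈X
        ; tree  = extend g w w (p g) w∈X w∉Y (inj₁ refl) (inj₂ (inj₁ refl))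
        ; inner = λ v∈ v≢w v≢p out → ∪-elim v∈ (λ v∈Y → inner g v∈Y v≢p (λ v≡q → v≢p (trans v≡q (sym p≡q))) (proj₁ (fewer out))) v≢w
        ; out-p = λ _ → new-end (Y⊆X g) (p∈Y g) o
        ; out-q = λ _ → last
        }
        where
        last : Unique-Out (Y ∪ ⟨ w ⟩) (p g)
        last o₁ o₂ with (a , _ , f) , x≢w ← fewer o₁ | (b , _ , f′) , x′≢w ← fewer o₂
          with deg≤2 (Y⊆X g (p∈Y g)) w∈X a b e f f′
        ... | inj₁ eq        = contradiction (sym eq) x≢w
        ... | inj₂ (inj₁ eq) = eq
        ... | inj₂ (inj₂ eq) = contradiction (sym eq) x′≢w
      ... | no p≢q = record
        { p∈Y = ∪ʳ Y ⟨ w ⟩ (v∈⟨v⟩ w) ; q∈Y = ∪ˡ Y ⟨ w ⟩ (q∈Y g) ; Y⊆X = adjoin⊆ (Y⊆X g) w∈X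
        ; tree  = extend g w w (q g) w∈X w∉Y (inj₁ refl) (inj₂ (inj₂ refl))
        ; inner = λ {v} v∈ v≢w v≢q out → ∪-elim v∈ (λ v∈Y → done v∈Y v≢q out (v F.≟ p g)) v≢w
        ; out-p = λ _ → new-end (Y⊆X g) (p∈Y g) o
        ; out-q = λ _ o₁ o₂ → out-q g p≢q (proj₁ (fewer o₁)) (proj₁ (fewer o₂))
        }
        where
        done : ∀ {v x} → v ∈ Y → v ≢ q g → Out (Y ∪ ⟨ w ⟩) v x → Dec (v ≡ p g) → ⊥
        done v∈Y v≢q out (no v≢p)  = inner g v∈Y v≢p v≢q (proj₁ (fewer out))
        done v∈Y v≢q out (yes refl) = proj₂ (fewer out) (out-p g p≢q (proj₁ (fewer out)) o)

      -- The ends change roles: the exhausted end `p` becomes the second one, and the path goes on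
      -- from the new vertex as its first end.
      grow-q : ∀ {Y} (g : Grown Y) → p g ≢ q g → ¬ ∃ (Out Y (p g)) → ∀ {w} → Out Y (q g) w → Grown (Y ∪ ⟨ w ⟩)
      grow-q {Y} g p≢q none {w} o@(w∈X , w∉Y , e) = record
        { p∈Y = ∪ʳ Y ⟨ w ⟩ (v∈⟨v⟩ w) ; q∈Y = ∪ˡ Y ⟨ w ⟩ (p∈Y g) ; Y⊆X = adjoin⊆ (Y⊆X g) w∈X
        ; tree  = extend g w w (p g) w∈X w∉Y (inj₁ refl) (inj₂ (inj₁ refl))
        ; inner = λ {v} v∈ v≢w v≢p out → ∪-elim v∈ (λ v∈Y → done v∈Y v≢p out (v F.≟ q g)) v≢w
        ; out-p = λ _ → new-end (Y⊆X g) (q∈Y g) o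
        ; out-q = λ _ o₁ o₂ → contradiction (_ , proj₁ (fewer o₁)) none
        }
        where
        done : ∀ {v x} → v ∈ Y → v ≢ p g → Out (Y ∪ ⟨ w ⟩) v x → Dec (v ≡ q g) → ⊥
        done v∈Y v≢p out (no v≢q)  = inner g v∈Y v≢p v≢q (proj₁ (fewer out))
        done v∈Y v≢p out (yes refl) = proj₂ (fewer out) (out-q g p≢q (proj₁ (fewer out)) o)

      restart : ∀ {Y} (g : Grown Y) → ¬ ∃ (Out Y (p g)) → ¬ ∃ (Out Y (q g)) → ∀ {w} → w ∈ X → w ∉ Y → Grown (Y ∪ ⟨ w ⟩)
      restart {Y} g no-p no-q {w} w∈X w∉Y = record
        { p∈Y = ∪ʳ Y ⟨ w ⟩ (v∈⟨v⟩ w) ; q∈Y = ∪ʳ Y ⟨ w ⟩ (v∈⟨v⟩ w) ; Y⊆X = adjoin⊆ (Y⊆X g) w∈X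
        ; tree  = extend g w w w w∈X w∉Y (inj₁ refl) (inj₁ refl)
        ; inner = λ {v} v∈ v≢w _ out → ∪-elim v∈ (λ v∈Y → done v∈Y (proj₁ (fewer out)) (v F.≟ p g) (v F.≟ q g)) v≢w
        ; out-p = λ w≢w → contradiction refl w≢w
        ; out-q = λ w≢w → contradiction refl w≢w
        }
        where
        done : ∀ {v x} → v ∈ Y → Out Y v x → Dec (v ≡ p g) → Dec (v ≡ q g) → ⊥
        done v∈Y out (yes refl) _          = no-p (_ , out)
        done v∈Y out (no _)     (yes refl) = no-q (_ , out)
        done v∈Y out (no a)     (no b)     = inner g v∈Y a b out

      next : ∀ {Y} → Grown Y → ∀ {w} → w ∈ X → w ∉ Y → ∃ λ w → w ∉ Y × Grown (Y ∪ ⟨ w ⟩)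
      next {Y} g {w} w∈X w∉Y with out? Y (p g)
      ... | yes (x , o) = x , proj₁ (proj₂ o) , grow-p g o
      ... | no no-p with p g F.≟ q g | out? Y (q g)
      ...   | no p≢q  | yes (x , o) = x , proj₁ (proj₂ o) , grow-q g p≢q no-p o
      ...   | _       | no no-q     = w , w∉Y , restart g no-p no-q w∈X w∉Y
      ...   | yes p≡q | yes (x , o) = contradiction (x , subst (λ r → Out Y r x) (sym p≡q) o) no-p

      finish : ∀ d Y → n ≤ d + size Y → Grown Y → W ad (λ _ → tt) 3 X
      finish d Y n≤ g with F.any? (λ w → (w ∈? X) ×-dec ¬? (w ∈? Y))
      ... | no none = _ , tree-resp (λ {w} w∈X → Dec.decidable-stable (w ∈? Y) (λ w∉Y → none (w , w∈X , w∉Y))) (Y⊆X g) (tree g)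
      finish zero Y n≤ g | yes (w , _ , w∉Y) = contradiction n≤ (ℕ.<⇒≱ (size<n Y w∉Y))
      finish (suc d) Y n≤ g | yes (w , w∈X , w∉Y) = let x , x∉Y , g′ = next g w∈X w∉Y in
        finish d (Y ∪ ⟨ x ⟩) (ℕ.≤-trans n≤ (ℕ.≤-trans (ℕ.≤-reflexive (sym (ℕ.+-suc d (size Y))))
          (ℕ.+-monoʳ-≤ d (size-< x (∪ˡ Y ⟨ x ⟩) (∪ʳ Y ⟨ x ⟩ (v∈⟨v⟩ x)) x∉Y)))) g′

    degree≤2-tree : Inhabited X → W ad (λ _ → tt) 3 X
    degree≤2-tree (v , v∈X) = finish n ⟨ v ⟩ (ℕ.m≤m+n n _) record
      { p∈Y = v∈⟨v⟩ v ; q∈Y = v∈⟨v⟩ v ; Y⊆X = λ w∈ → subst (_∈ X) (sym (∈⟨⟩ w∈)) v∈X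
      ; tree = leaf v (v∈⟨v⟩ v) ∈⟨⟩
      ; inner = λ w∈ w≢v _ _ → w≢v (∈⟨⟩ w∈)
      ; out-p = λ v≢v → contradiction refl v≢v
      ; out-q = λ v≢v → contradiction refl v≢v
      }

  -- Twins, and graphs of degree at most two up to twins

  Twins : Sub n → Fin n → Fin n → Set
  Twins X u v = ∀ {w} → w ∈ X → ad u w ≡ ad v w

  twins? : ∀ X u v → Dec (Twins X u v)
  twins? X u v = Dec.map′ (λ f {w} → f w) (λ f w → f {w}) (F.all? (λ w → (w ∈? X) →-dec (ad u w 𝔹.≟ ad v w)))

  private
    clone : ∀ {k} → Fin n → Fin n → (Fin n → Fin k) → Fin n → Fin k
    clone u v c w with w F.≟ v
    ... | yes _ = c u
    ... | no _  = c w

    clone-new : ∀ {k} u v (c : Fin n → Fin k) → clone u v c v ≡ c u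
    clone-new u v c with v F.≟ v
    ... | yes _ = refl
    ... | no ne = contradiction refl ne

    clone-old : ∀ {k} u v (c : Fin n → Fin k) {w} → w ≢ v → clone u v c w ≡ c w
    clone-old u v c {w} ne with w F.≟ v
    ... | yes e = contradiction e ne
    ... | no _  = refl

  -- The leaf of `u` is replaced by a node holding `u` and `v`, and above it `v` always follows the
  -- class of `u`. Since `v` looks like `u` from outside, no further class is needed.
  add-twin : ∀ {k X₀ X c} u v → Twins X₀ u v → v ∉ X → u ∈ X → X ⊆ X₀ →
    Tree ad (λ _ → tt) k X c → Tree ad (λ _ → tt) k (X ∪ ⟨ v ⟩) (clone u v c)
  add-twin {X₀ = X₀} u v tw = go
    where
    sub : ∀ {X X′} → X ⊆ X′ → X ∪ ⟨ v ⟩ ⊆ X′ ∪ ⟨ v ⟩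
    sub {X} {X′} X⊆ w∈ = ∪-elim w∈ (∪ˡ X′ ⟨ v ⟩ ∘ X⊆) (λ { refl → ∪ʳ X′ ⟨ v ⟩ (v∈⟨v⟩ v) })
    -- A representative in the old part with the same class and the same neighbours: `u` for `v`,
    -- and every other vertex for itself.
    Rep : ∀ {k} → Sub n → (Fin n → Fin k) → Fin n → Set
    Rep X c w = Σ (Fin n) λ w′ → w′ ∈ X × clone u v c w ≡ c w′ × (∀ {x} → x ∈ X₀ → ad w x ≡ ad w′ x) × (w ≡ v → w′ ≡ u) × (w ≢ v → w′ ≡ w)
    rep : ∀ {X k} (c : Fin n → Fin k) → u ∈ X → v ∉ X → ∀ {w} → w ∈ X ∪ ⟨ v ⟩ → Rep X c w
    rep {X} c u∈X v∉X {w} w∈ = pick (w F.≟ v)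
      where
      pick : Dec (w ≡ v) → Rep X c w
      pick (yes refl) = u , u∈X , clone-new u v c , (λ x∈ → sym (tw x∈)) , (λ _ → refl) , λ ne → contradiction refl ne
      pick (no ne)    = w , ∪-elim w∈ id (λ e → contradiction e ne) , clone-old u v c ne , (λ _ → refl) , (λ e → contradiction e ne) , λ _ → refl
    repc : ∀ {k} (c : Fin n → Fin k) {w w′} → (w ≡ v → w′ ≡ u) → (w ≢ v → w′ ≡ w) → clone u v c w ≡ c w′
    repc c {w} f g with w F.≟ v
    ... | yes e = cong c (sym (f e))
    ... | no ne = cong c (sym (g ne))
    go : ∀ {k X c} → v ∉ X → u ∈ X → X ⊆ X₀ → Tree ad (λ _ → tt) k X c → Tree ad (λ _ → tt) k (X ∪ ⟨ v ⟩) (clone u v c)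
    go {X = X} {c} v∉X u∈X X⊆ (leaf x x∈X only) = node (leaf {c = clone u v c} x x∈X only) (leaf {c = clone u v c} v (v∈⟨v⟩ v) ∈⟨⟩)
      (∈∪ X ⟨ v ⟩) (∪ˡ X ⟨ v ⟩) (∪ʳ X ⟨ v ⟩) (λ w∈X w∈v → v∉X (subst (_∈ X) (∈⟨⟩ w∈v) w∈X))
      (λ _ _ _ e → e) (λ _ _ _ e → e)
      (λ a b c d _ _ _ _ → cong₂ ad (trans (only a) (sym (only b))) (trans (∈⟨⟩ c) (sym (∈⟨⟩ d))))
    go {X = X} {c} v∉X u∈X X⊆ (node {Y = Y} {Z} {c₁ = c₁} {c₂} t₁ t₂ co Y⊆ Z⊆ dj mY mZ cr) with co u∈X
    ... | inj₁ u∈Y = node (go (v∉X ∘ Y⊆) u∈Y (X⊆ ∘ Y⊆) t₁) t₂ cover (sub Y⊆) (∪ˡ X ⟨ v ⟩ ∘ Z⊆)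
        (λ w∈ w∈Z → ∪-elim w∈ (λ w∈Y → dj w∈Y w∈Z) (λ { refl → v∉X (Z⊆ w∈Z) }))
        merge
        (λ a b _ e → trans (clone-old u v c (v≢ a)) (trans (mZ a b refl e) (sym (clone-old u v c (v≢ b)))))
        cross
      where
      v≢ : ∀ {w} → w ∈ Z → w ≢ v
      v≢ w∈Z refl = v∉X (Z⊆ w∈Z)
      cover : ∀ {w} → w ∈ X ∪ ⟨ v ⟩ → w ∈ Y ∪ ⟨ v ⟩ ⊎ w ∈ Z
      cover w∈ = ∪-elim w∈ (λ w∈X → [ inj₁ ∘ ∪ˡ Y ⟨ v ⟩ , inj₂ ]′ (co w∈X)) (λ { refl → inj₁ (∪ʳ Y ⟨ v ⟩ (v∈⟨v⟩ v)) })
      merge : ∀ {w w′} → w ∈ Y ∪ ⟨ v ⟩ → w′ ∈ Y ∪ ⟨ v ⟩ → tt ≡ tt → clone u v c₁ w ≡ clone u v c₁ w′ → clone u v c w ≡ clone u v c w′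
      merge a b _ e with rep c₁ u∈Y (v∉X ∘ Y⊆) a | rep c₁ u∈Y (v∉X ∘ Y⊆) b
      ... | w , w∈ , x , _ , p , q | w′ , w′∈ , x′ , _ , p′ , q′ =
        trans (repc c p q) (trans (mY w∈ w′∈ refl (trans (sym x) (trans e x′))) (sym (repc c p′ q′)))
      cross : ∀ {w w′ y y′} → w ∈ Y ∪ ⟨ v ⟩ → w′ ∈ Y ∪ ⟨ v ⟩ → y ∈ Z → y′ ∈ Z → tt ≡ tt → clone u v c₁ w ≡ clone u v c₁ w′ →
        tt ≡ tt → c₂ y ≡ c₂ y′ → ad w y ≡ ad w′ y′
      cross a b y∈ y′∈ _ e _ f with rep c₁ u∈Y (v∉X ∘ Y⊆) a | rep c₁ u∈Y (v∉X ∘ Y⊆) b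
      ... | w , w∈ , x , t , _ | w′ , w′∈ , x′ , t′ , _ =
        trans (t (X⊆ (Z⊆ y∈))) (trans (cr w∈ w′∈ y∈ y′∈ refl (trans (sym x) (trans e x′)) refl f) (sym (t′ (X⊆ (Z⊆ y′∈)))))
    ... | inj₂ u∈Z = node t₁ (go (v∉X ∘ Z⊆) u∈Z (X⊆ ∘ Z⊆) t₂) cover (∪ˡ X ⟨ v ⟩ ∘ Y⊆) (sub Z⊆)
        (λ w∈Y w∈ → ∪-elim w∈ (dj w∈Y) (λ { refl → v∉X (Y⊆ w∈Y) }))
        (λ a b _ e → trans (clone-old u v c (v≢ a)) (trans (mY a b refl e) (sym (clone-old u v c (v≢ b)))))
        merge
        cross
      where
      v≢ : ∀ {w} → w ∈ Y → w ≢ v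
      v≢ w∈Y refl = v∉X (Y⊆ w∈Y)
      cover : ∀ {w} → w ∈ X ∪ ⟨ v ⟩ → w ∈ Y ⊎ w ∈ Z ∪ ⟨ v ⟩
      cover w∈ = ∪-elim w∈ (λ w∈X → [ inj₁ , inj₂ ∘ ∪ˡ Z ⟨ v ⟩ ]′ (co w∈X)) (λ { refl → inj₂ (∪ʳ Z ⟨ v ⟩ (v∈⟨v⟩ v)) })
      merge : ∀ {w w′} → w ∈ Z ∪ ⟨ v ⟩ → w′ ∈ Z ∪ ⟨ v ⟩ → tt ≡ tt → clone u v c₂ w ≡ clone u v c₂ w′ → clone u v c w ≡ clone u v c w′
      merge a b _ e with rep c₂ u∈Z (v∉X ∘ Z⊆) a | rep c₂ u∈Z (v∉X ∘ Z⊆) b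
      ... | w , w∈ , x , _ , p , q | w′ , w′∈ , x′ , _ , p′ , q′ =
        trans (repc c p q) (trans (mZ w∈ w′∈ refl (trans (sym x) (trans e x′))) (sym (repc c p′ q′)))
      cross : ∀ {y y′ w w′} → y ∈ Y → y′ ∈ Y → w ∈ Z ∪ ⟨ v ⟩ → w′ ∈ Z ∪ ⟨ v ⟩ → tt ≡ tt → c₁ y ≡ c₁ y′ →
        tt ≡ tt → clone u v c₂ w ≡ clone u v c₂ w′ → ad y w ≡ ad y′ w′
      cross {y} {y′} {w₀} {w₀′} y∈ y′∈ a b _ f _ e with rep c₂ u∈Z (v∉X ∘ Z⊆) a | rep c₂ u∈Z (v∉X ∘ Z⊆) b
      ... | w , w∈ , x , t , _ | w′ , w′∈ , x′ , t′ , _ =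
        trans (ad-sym y w₀) (trans (t (X⊆ (Y⊆ y∈))) (trans (ad-sym w y) (trans (cr y∈ y′∈ w∈ w′∈ refl f refl (trans (sym x) (trans e x′)))
          (trans (ad-sym y′ w′) (trans (sym (t′ (X⊆ (Y⊆ y′∈)))) (ad-sym w₀′ y′))))))

  -- Deleting one of two distinct twins preserves the hypothesis, and `add-twin` puts it back. Once
  -- distinct twins are gone, twins are equal and the hypothesis is a degree bound.
  twin-degree≤2-tree : ∀ X → (∀ {v a b c} → v ∈ X → a ∈ X → b ∈ X → c ∈ X → ad v a ≡ true → ad v b ≡ true → ad v c ≡ true →
      Twins X a b ⊎ Twins X b c ⊎ Twins X a c) → Inhabited X → W ad (λ _ → tt) 3 X
  twin-degree≤2-tree X = <-rec Q rec (size X) X refl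
    where
    Few : Sub n → Set
    Few X = ∀ {v a b c} → v ∈ X → a ∈ X → b ∈ X → c ∈ X → ad v a ≡ true → ad v b ≡ true → ad v c ≡ true →
      Twins X a b ⊎ Twins X b c ⊎ Twins X a c
    Q : ℕ → Set
    Q s = ∀ X → size X ≡ s → Few X → Inhabited X → W ad (λ _ → tt) 3 X
    rec : ∀ s → (∀ {t} → t < s → Q t) → Q s
    rec s ih X refl few inh with F.any? (λ u → F.any? (λ v → (u ∈? X) ×-dec (v ∈? X) ×-dec ¬? (u F.≟ v) ×-dec twins? X u v))
    ... | no none = degree≤2-tree X (λ v∈ a∈ b∈ c∈ p q r →
        [ inj₁ ∘ equal a∈ b∈ , [ inj₂ ∘ inj₁ ∘ equal b∈ c∈ , inj₂ ∘ inj₂ ∘ equal a∈ c∈ ]′ ]′ (few v∈ a∈ b∈ c∈ p q r)) inh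
      where
      equal : ∀ {u v} → u ∈ X → v ∈ X → Twins X u v → u ≡ v
      equal {u} {v} u∈ v∈ tw = Dec.decidable-stable (u F.≟ v) (λ ne → none (u , v , u∈ , v∈ , ne , tw))
    ... | yes (u , v , u∈X , v∈X , u≢v , tw) =
      let c , t = ih (size-< v (proj₁ ∘ ∈∖ X ⟨ v ⟩) v∈X (λ p → proj₂ (∈∖ X ⟨ v ⟩ p) (v∈⟨v⟩ v))) X′ refl few′ (u , u∈X′)
      in _ , tree-resp enlarge shrink (add-twin u v tw (λ p → proj₂ (∈∖ X ⟨ v ⟩ p) (v∈⟨v⟩ v)) u∈X′ (proj₁ ∘ ∈∖ X ⟨ v ⟩) t)
      where
      X′ = X ∖ ⟨ v ⟩
      u∈X′ : u ∈ X′
      u∈X′ = ∖∈ X ⟨ v ⟩ u∈X (u≢v ∘ ∈⟨⟩)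
      in-X : X′ ⊆ X
      in-X = proj₁ ∘ ∈∖ X ⟨ v ⟩
      few′ : Few X′
      few′ a b c d p q r with few (in-X a) (in-X b) (in-X c) (in-X d) p q r
      ... | inj₁ e        = inj₁ (e ∘ in-X)
      ... | inj₂ (inj₁ e) = inj₂ (inj₁ (e ∘ in-X))
      ... | inj₂ (inj₂ e) = inj₂ (inj₂ (e ∘ in-X))
      enlarge : X ⊆ X′ ∪ ⟨ v ⟩
      enlarge {w} w∈X = pick (w F.≟ v)
        where
        pick : Dec (w ≡ v) → w ∈ X′ ∪ ⟨ v ⟩
        pick (yes refl) = ∪ʳ X′ ⟨ v ⟩ (v∈⟨v⟩ v)
        pick (no ne)    = ∪ˡ X′ ⟨ v ⟩ (∖∈ X ⟨ v ⟩ w∈X (ne ∘ ∈⟨⟩))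
      shrink : X′ ∪ ⟨ v ⟩ ⊆ X
      shrink w∈ = ∪-elim w∈ in-X (λ { refl → v∈X })

-- Bipartite graphs

module Bipartite {n : ℕ} (ad : Matrix n) (ad-sym : ∀ u v → ad u v ≡ ad v u) (X₀ : Sub n) (side : Fin n → Bool)
  (across : ∀ {u v} → u ∈ X₀ → v ∈ X₀ → ad u v ≡ true → side u ≡ not (side v)) where

  infix 4 _~_
  _~_ : Fin n → Fin n → Set
  u ~ v = ad u v ≡ true

  _~?_ : ∀ u v → Dec (u ~ v)
  u ~? v = ad u v 𝔹.≟ true

  ~-sym : ∀ {u v} → u ~ v → v ~ u
  ~-sym {u} {v} = trans (ad-sym v u)

  module _ {L : Set} (τ : Fin n → L) (side-τ : ∀ {u v} → τ u ≡ τ v → side u ≡ side v) where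

    uniform-by-sides : ∀ (f : Bool → Bool → Bool) {Y Z : Sub n} → (∀ {u v} → u ∈ Y → v ∈ Z → ad u v ≡ f (side u) (side v)) →
      Uniform {ad = ad} {τ = τ} Y Z
    uniform-by-sides f eq p p′ q q′ e e′ =
      trans (eq p q) (trans (cong₂ f (side-τ e) (side-τ e′)) (sym (eq p′ q′)))

    module Step (X : Sub n) (X⊆ : X ⊆ X₀) (conn : Connected ad X) where

      nb : Fin n → Sub n
      nb v w = X w ∧ ad v w

      nb∈ : ∀ {v w} → w ∈ nb v → w ∈ X × v ~ w
      nb∈ {v} {w} p = let a , b = ∈∩ X (ad v) {w} (mem (holds p)) in a , holds b

      ∈nb : ∀ {v w} → w ∈ X → v ~ w → w ∈ nb v
      ∈nb {v} p e = mem (holds (∩∈ X (ad v) p (mem e)))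

      Maximal : Fin n → Set
      Maximal y = ∀ {a} → a ∈ X → (∀ {b} → b ∈ X → y ~ b → a ~ b) → ∀ {b} → b ∈ X → a ~ b → y ~ b

      maximal : ∀ d v → v ∈ X → n ≤ d + size (nb v) → ∃ λ y → y ∈ X × (∀ {b} → b ∈ X → v ~ b → y ~ b) × Maximal y
      maximal d v v∈X n≤ with F.any? (λ a → (a ∈? X) ×-dec F.all? (λ b → (b ∈? X) →-dec (v ~? b) →-dec (a ~? b)) ×-dec
        F.any? (λ b → (b ∈? X) ×-dec (a ~? b) ×-dec ¬? (v ~? b)))
      ... | no none = v , v∈X , (λ _ e → e) , λ {a} a∈X le {b} b∈X e →
        Dec.decidable-stable (v ~? b) (λ ne → none (a , a∈X , (λ b → le) , b , b∈X , e , ne))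
      maximal zero v v∈X n≤ | yes (a , a∈X , le , b , b∈X , e , ne) =
        contradiction n≤ (ℕ.<⇒≱ (size<n (nb v) (ne ∘ proj₂ ∘ nb∈)))
      maximal (suc d) v v∈X n≤ | yes (a , a∈X , le , b , b∈X , e , ne) =
        let y , y∈X , ge , mx = maximal d a a∈X (ℕ.≤-trans n≤ (ℕ.≤-trans (ℕ.≤-reflexive (sym (ℕ.+-suc d (size (nb v)))))
              (ℕ.+-monoʳ-≤ d (size-< b (λ p → ∈nb (proj₁ (nb∈ p)) (le _ (proj₁ (nb∈ p)) (proj₂ (nb∈ p)))) (∈nb b∈X e) (ne ∘ proj₂ ∘ nb∈)))))
        in y , y∈X , (λ p q → ge p (le _ p q)) , mx

      Split = Splitting {ad = ad} {τ = τ} X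

      split : ∀ {P : Fin n → Set} (P? : ∀ v → Dec (P v)) (f : Bool → Bool → Bool) → (∃ λ u → u ∈ X × P u) → (∃ λ v → v ∈ X × ¬ P v) →
        (∀ {u v} → u ∈ X → v ∈ X → P u → ¬ P v → ad u v ≡ f (side u) (side v)) → Split
      split {P} P? f (u , u∈X , Pu) (v , v∈X , ¬Pv) eq = S , (u , ∩∈ X S u∈X (inS Pu)) , (v , ∖∈ X S v∈X (¬Pv ∘ outS)) ,
        uniform-by-sides f λ p q → eq (proj₁ (∈∩ X S p)) (proj₁ (∈∖ X S q)) (outS (proj₂ (∈∩ X S p))) (λ Pv → proj₂ (∈∖ X S q) (inS Pv))
        where
        S : Sub n
        S v = does (P? v)
        inS : ∀ {v} → P v → v ∈ S
        inS {v} p = mem (⇒does (P? v) p)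
        outS : ∀ {v} → v ∈ S → P v
        outS {v} (mem p) = does⇒ (P? v) p

      same-side : ∀ {u v} → u ∈ X → v ∈ X → side u ≡ side v → ad u v ≡ false
      same-side {u} {v} p q e = 𝔹.¬-not λ r → 𝔹.not-¬ e (across (X⊆ p) (X⊆ q) r)

      module Around (y : Fin n) (y∈X : y ∈ X) (y-max : Maximal y) where

        s : Bool
        s = side y

        opposite : ∀ {b} → b ∈ X → y ~ b → side b ≡ not s
        opposite b∈X e = across (X⊆ b∈X) (X⊆ y∈X) (~-sym e)

        Meets : Fin n → Fin n → Fin n → Set
        Meets y a e = e ∈ X × y ~ e × a ~ e

        -- Neighbourhoods meeting that of `y` stay inside it, so the neighbours of `y` together with
        -- their neighbours are closed. Connectedness makes this all of `X`; hence `y` is complete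
        -- to the opposite side and can be split off alone.
        no-crossing : (¬ ∃ λ w → w ∈ X × (∃ λ e → Meets y w e) × ∃ λ r → r ∈ X × w ~ r × ¬ y ~ r) →
          (∃ λ b → b ∈ X × y ~ b) → Split
        no-crossing none (b , b∈X , y~b) = split (F._≟ y) f (y , y∈X , refl) (b , b∈X , λ { refl → y≁y y~b }) value
          where
          y≁y : ¬ y ~ y
          y≁y e = 𝔹.not-¬ refl (across (X⊆ y∈X) (X⊆ y∈X) e)
          f : Bool → Bool → Bool
          f _ t = not (does (t 𝔹.≟ s))
          meets? : ∀ v → Dec (∃ λ e → Meets y v e)
          meets? v = F.any? (λ e → (e ∈? X) ×-dec (y ~? e) ×-dec (v ~? e))
          In? : ∀ v → Dec (y ~ v ⊎ ∃ λ e → Meets y v e)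
          In? v = (y ~? v) ⊎-dec meets? v
          T : Sub n
          T v = does (In? v)
          closed : Closed ad X T
          closed {u} {v} u∈X v∈X u~v (mem t) with does⇒ (In? u) t
          ... | inj₁ y~u = mem (⇒does (In? v) (inj₂ (u , u∈X , y~u , ~-sym u~v)))
          ... | inj₂ m   = mem (⇒does (In? v) (inj₁ (Dec.decidable-stable (y ~? v) λ ne → none (u , u∈X , m , v , v∈X , u~v , ne))))
          all : ∀ {v} → v ∈ X → y ~ v ⊎ ∃ λ e → Meets y v e
          all {v} v∈X = does⇒ (In? v) (holds (conn T closed b∈X v∈X (mem (⇒does (In? b) (inj₁ y~b)))))
          value : ∀ {u v} → u ∈ X → v ∈ X → u ≡ y → v ≢ y → ad u v ≡ f (side u) (side v)
          value {v = v} _ v∈X refl _ with side v 𝔹.≟ s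
          ... | yes e = same-side y∈X v∈X (sym e)
          ... | no ne with all v∈X
          ...   | inj₁ y~v               = y~v
          ...   | inj₂ (e , e∈X , p , q) = contradiction
            (trans (across (X⊆ v∈X) (X⊆ e∈X) q) (trans (cong not (opposite e∈X p)) (𝔹.not-involutive s))) ne

    -- The first configuration is the tree with legs 1, 1, 3 at its centre `c`, the long leg being
    -- `e`, `a`, `d`. The second is the four-cycle `x`, `b`, `c`, `b′` with the pendant path `d`,
    -- `a` at `x`. Each is a P₂ + P₃ (edge `a d`, path `b c b′`) together with a vertex complete to
    -- one side of it: `e` to `a` and `c`, or `x` to `b`, `b′` and `d`.
    module _
      (S₁₁₃-free : ∀ {a c e b b′ d} → a ∈ X₀ → c ∈ X₀ → e ∈ X₀ → b ∈ X₀ → b′ ∈ X₀ → d ∈ X₀ →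
        a ~ e → c ~ e → c ~ b → c ~ b′ → b ≢ b′ → ¬ a ~ b → ¬ a ~ b′ → a ~ d → ¬ c ~ d → ⊥)
      (Q-free : ∀ {x c a b b′ d} → x ∈ X₀ → c ∈ X₀ → a ∈ X₀ → b ∈ X₀ → b′ ∈ X₀ → d ∈ X₀ →
        x ~ b → x ~ b′ → x ~ d → c ~ b → c ~ b′ → b ≢ b′ → ¬ c ~ d → a ~ d → ¬ a ~ b → ¬ a ~ b′ → ⊥)
      where

      private module Cross (X : Sub n) (X⊆ : X ⊆ X₀) (conn : Connected ad X) where
        open Step X X⊆ conn

        -- Two vertices `b`, `b′` private to `c` would give the forbidden tree with centre `c` and
        -- long leg `x`, `a`, `d`. So two intersecting, incomparable neighbourhoods differ by one
        -- vertex in either direction.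
        at-most-one : ∀ {a c x b b′ d} → a ∈ X → c ∈ X → x ∈ X → b ∈ X → b′ ∈ X → d ∈ X → a ~ x → c ~ x → a ~ d → ¬ c ~ d →
          c ~ b → ¬ a ~ b → c ~ b′ → ¬ a ~ b′ → b ≡ b′
        at-most-one {b = b} {b′} a∈ c∈ x∈ b∈ b′∈ d∈ ax cx ad′ cd cb ab cb′ ab′ = Dec.decidable-stable (b F.≟ b′) λ ne →
          S₁₁₃-free (X⊆ a∈) (X⊆ c∈) (X⊆ x∈) (X⊆ b∈) (X⊆ b′∈) (X⊆ d∈) ax cx cb cb′ ne ab ab′ ad′ cd

        module _ (y : Fin n) (y∈X : y ∈ X) (y-max : Maximal y) where
          open Around y y∈X y-max

          -- y and w have intersecting, incomparable neighbourhoods; p and p′ are common neighbours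
          module Crossing {w e r q p p′ : Fin n} (w∈X : w ∈ X) (m : Meets y w e) (r∈X : r ∈ X) (w~r : w ~ r) (y≁r : ¬ y ~ r)
            (q∈X : q ∈ X) (y~q : y ~ q) (w≁q : ¬ w ~ q)
            (p-core : p ∈ X × y ~ p × w ~ p) (p′-core : p′ ∈ X × y ~ p′ × w ~ p′) (p≢p′ : p ≢ p′) where

            private
              e∈X = proj₁ m
              y~e = proj₁ (proj₂ m)
              w~e = proj₂ (proj₂ m)

            q≢r : q ≢ r
            q≢r q≡r = y≁r (subst (y ~_) q≡r y~q)

            only-q : ∀ {b} → b ∈ X → y ~ b → ¬ w ~ b → b ≡ q
            only-q b∈X yb wb = at-most-one w∈X y∈X e∈X b∈X q∈X r∈X w~e y~e w~r y≁r yb wb y~q w≁q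

            only-r : ∀ {b} → b ∈ X → w ~ b → ¬ y ~ b → b ≡ r
            only-r b∈X wb yb = at-most-one y∈X w∈X e∈X b∈X r∈X q∈X y~e w~e y~q w≁q wb yb w~r y≁r

            Core : Fin n → Set
            Core b = b ∈ X × y ~ b × w ~ b

            core? : ∀ b → Dec (Core b)
            core? b = (b ∈? X) ×-dec (y ~? b) ×-dec (w ~? b)

            in-core : ∀ {b} → b ∈ X → y ~ b → b ≢ q → Core b
            in-core {b} b∈X yb ne = b∈X , yb , Dec.decidable-stable (w ~? b) (λ wb → ne (only-q b∈X yb wb))

            core≢q : ∀ {b} → Core b → b ≢ q
            core≢q (_ , _ , wb) refl = w≁q wb
            core≢r : ∀ {b} → Core b → b ≢ r
            core≢r (_ , yb , _) refl = y≁r yb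

            Contains-core : Fin n → Set
            Contains-core a = ∀ {b} → Core b → a ~ b

            -- If `a` missed both `p` and `p′`, then `y`, `w` and `a` would give the forbidden
            -- four-cycle with a path. So `a` meets the core, and `at-most-one` against `w`
            -- identifies the neighbourhood of `a` with that of `y`.
            like-y : ∀ {a} → a ∈ X → a ~ q → ¬ a ~ r → Contains-core a × (∀ {b} → b ∈ X → a ~ b → y ~ b)
            like-y {a} a∈X aq ar = contains , inside
              where
              common : ∃ λ c → Core c × a ~ c
              common with a ~? p | a ~? p′
              ... | yes ap | _      = p , p-core , ap
              ... | no _   | yes ap = p′ , p′-core , ap
              ... | no np  | no np′ = ⊥-elim (Q-free (X⊆ y∈X) (X⊆ w∈X) (X⊆ a∈X) (X⊆ (proj₁ p-core)) (X⊆ (proj₁ p′-core)) (X⊆ q∈X)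
                (proj₁ (proj₂ p-core)) (proj₁ (proj₂ p′-core)) y~q (proj₂ (proj₂ p-core)) (proj₂ (proj₂ p′-core)) p≢p′ w≁q aq np np′)
              x = proj₁ common
              x-core = proj₁ (proj₂ common)
              ax = proj₂ (proj₂ common)
              contains : Contains-core a
              contains {b} bc@(b∈X , _ , wb) = Dec.decidable-stable (a ~? b) λ ab → core≢r bc
                (at-most-one a∈X w∈X (proj₁ x-core) b∈X r∈X q∈X ax (proj₂ (proj₂ x-core)) aq w≁q wb ab w~r ar)
              inside : ∀ {b} → b ∈ X → a ~ b → y ~ b
              inside {b} b∈X ab with w ~? b
              ... | no wb  = subst (y ~_) (sym (at-most-one w∈X a∈X (proj₁ x-core) b∈X q∈X r∈X (proj₂ (proj₂ x-core)) ax w~r ar ab wb aq w≁q)) y~q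
              ... | yes wb = Dec.decidable-stable (y ~? b) λ yb → ar (subst (a ~_) (only-r b∈X wb yb) ab)

            like-w : ∀ {a} → a ∈ X → a ~ r → ¬ a ~ q → Contains-core a × (∀ {b} → b ∈ X → a ~ b → w ~ b)
            like-w {a} a∈X ar aq = contains , inside
              where
              common : ∃ λ c → Core c × a ~ c
              common with a ~? p | a ~? p′
              ... | yes ap | _      = p , p-core , ap
              ... | no _   | yes ap = p′ , p′-core , ap
              ... | no np  | no np′ = ⊥-elim (Q-free (X⊆ w∈X) (X⊆ y∈X) (X⊆ a∈X) (X⊆ (proj₁ p-core)) (X⊆ (proj₁ p′-core)) (X⊆ r∈X)
                (proj₂ (proj₂ p-core)) (proj₂ (proj₂ p′-core)) w~r (proj₁ (proj₂ p-core)) (proj₁ (proj₂ p′-core)) p≢p′ y≁r ar np np′)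
              x = proj₁ common
              x-core = proj₁ (proj₂ common)
              ax = proj₂ (proj₂ common)
              contains : Contains-core a
              contains {b} bc@(b∈X , yb , _) = Dec.decidable-stable (a ~? b) λ ab → core≢q bc
                (at-most-one a∈X y∈X (proj₁ x-core) b∈X q∈X r∈X ax (proj₁ (proj₂ x-core)) ar y≁r yb ab y~q aq)
              inside : ∀ {b} → b ∈ X → a ~ b → w ~ b
              inside {b} b∈X ab with y ~? b
              ... | no yb  = subst (w ~_) (sym (at-most-one y∈X a∈X (proj₁ x-core) b∈X r∈X q∈X (proj₁ (proj₂ x-core)) ax y~q aq ab yb ar y≁r)) w~r
              ... | yes yb = Dec.decidable-stable (w ~? b) λ wb → aq (subst (a ~_) (only-q b∈X yb wb) ab)

            -- Maximality of `y` provides a neighbour `u` of `y` missed by `a`, as `a` also has the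
            -- neighbour `r` outside. By `at-most-one` the neighbourhood of `a` is the core with `q`
            -- and `r`, except for the single vertex `u`.
            co-type : ∀ {a} → a ∈ X → a ~ q → a ~ r → (∃ λ u → Core u × ¬ a ~ u × (∀ {b} → Core b → b ≢ u → a ~ b)) ×
              (∀ {b} → b ∈ X → a ~ b → y ~ b ⊎ b ≡ r)
            co-type {a} a∈X aq ar = (u , in-core u∈X yu u≢q , au , λ {b} bc ne → Dec.decidable-stable (a ~? b) λ ab → ne
                (at-most-one a∈X y∈X q∈X (proj₁ bc) u∈X r∈X aq y~q ar y≁r (proj₁ (proj₂ bc)) ab yu au)) , inside
              where
              missed : ∃ λ u → u ∈ X × y ~ u × ¬ a ~ u
              missed with F.any? (λ u → (u ∈? X) ×-dec (y ~? u) ×-dec ¬? (a ~? u))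
              ... | yes r = r
              ... | no none = contradiction (y-max a∈X (λ {b} b∈X yb → Dec.decidable-stable (a ~? b) (λ ne → none (b , b∈X , yb , ne))) r∈X ar) y≁r
              u = proj₁ missed
              u∈X = proj₁ (proj₂ missed)
              yu = proj₁ (proj₂ (proj₂ missed))
              au = proj₂ (proj₂ (proj₂ missed))
              u≢q : u ≢ q
              u≢q u≡q = au (subst (a ~_) (sym u≡q) aq)
              inside : ∀ {b} → b ∈ X → a ~ b → y ~ b ⊎ b ≡ r
              inside {b} b∈X ab with y ~? b
              ... | yes yb = inj₁ yb
              ... | no yb  = inj₂ (at-most-one y∈X a∈X q∈X b∈X r∈X u∈X y~q aq yu au ab yb ar y≁r)

            -- The neighbourhood of `a` turns out to be the core plus one petal `z`.
            sunflower : ∀ {a x z} → a ∈ X → ¬ a ~ q → Core x → a ~ x → z ∈ X → a ~ z → ¬ y ~ z →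
              Contains-core a × (∀ {b} → b ∈ X → a ~ b → ¬ y ~ b → b ≡ z)
            sunflower {a} {x} {z} a∈X aq xc ax z∈X az yz =
              (λ {b} bc → Dec.decidable-stable (a ~? b) λ ab → core≢q bc
                (at-most-one a∈X y∈X (proj₁ xc) (proj₁ bc) q∈X z∈X ax (proj₁ (proj₂ xc)) az yz (proj₁ (proj₂ bc)) ab y~q aq)) ,
              λ b∈X ab yb → at-most-one y∈X a∈X (proj₁ xc) b∈X z∈X q∈X (proj₁ (proj₂ xc)) ax y~q aq ab yb az yz

            -- Z is the union of the neighbourhoods of `y` and `w` in `X`, that is, the core with
            -- `q` and `r`.
            MeetsZ : Fin n → Set
            MeetsZ a = a ~ q ⊎ a ~ r ⊎ ∃ λ x → Core x × a ~ x

            meetsZ? : ∀ a → Dec (MeetsZ a)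
            meetsZ? a = (a ~? q) ⊎-dec (a ~? r) ⊎-dec F.any? (λ x → core? x ×-dec (a ~? x))

            escapes : ∀ {a z} → a ∈ X → MeetsZ a → z ∈ X → a ~ z → ¬ y ~ z → z ≢ r → Contains-core a × ¬ a ~ q × ¬ a ~ r
            escapes {a} {z} a∈X mz z∈X az yz z≢r with a ~? q | a ~? r
            ... | yes aq | no ar  = contradiction (proj₂ (like-y a∈X aq ar) z∈X az) yz
            ... | no aq  | yes ar = contradiction (only-r z∈X (proj₂ (like-w a∈X ar aq) z∈X az) yz) z≢r
            ... | yes aq | yes ar = [ (λ yz′ → contradiction yz′ yz) , (λ e → contradiction e z≢r) ]′ (proj₂ (co-type a∈X aq ar) z∈X az)
            ... | no aq  | no ar  = go mz
              where
              go : MeetsZ a → Contains-core a × ¬ a ~ q × ¬ a ~ r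
              go (inj₁ aq′)                  = contradiction aq′ aq
              go (inj₂ (inj₁ ar′))           = contradiction ar′ ar
              go (inj₂ (inj₂ (x , xc , ax))) = proj₁ (sunflower a∈X aq xc ax z∈X az yz) , aq , ar

            private
              In? : ∀ v → Dec (MeetsZ v ⊎ ∃ λ a → a ∈ X × a ~ v × MeetsZ a)
              In? v = meetsZ? v ⊎-dec F.any? (λ a → (a ∈? X) ×-dec (a ~? v) ×-dec meetsZ? a)

              T : Sub n
              T v = does (In? v)

              closed : Closed ad X T
              closed {u} {v} u∈X v∈X u~v (mem t) with does⇒ (In? u) t
              ... | inj₁ mz = mem (⇒does (In? v) (inj₂ (u , u∈X , u~v , mz)))
              ... | inj₂ (a , a∈X , a~u , mz) = mem (⇒does (In? v) (inj₁ meets))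
                where
                meets : MeetsZ v
                meets with y ~? u | u F.≟ r | u F.≟ q
                ... | no yu | yes refl | _ = inj₂ (inj₁ (~-sym u~v))
                ... | yes yu | _ | yes refl = inj₁ (~-sym u~v)
                ... | yes yu | _ | no ne    = inj₂ (inj₂ (u , in-core u∈X yu ne , ~-sym u~v))
                ... | no yu | no u≢r | _ with v ~? p | v ~? p′
                ...   | yes vp | _      = inj₂ (inj₂ (p , p-core , vp))
                ...   | no _   | yes vp = inj₂ (inj₂ (p′ , p′-core , vp))
                -- Here `u` is a petal of `a`. A vertex `v` hanging on it and missing `p` and `p′`
                -- completes the four-cycle `a`, `p`, `y`, `p′` to the forbidden graph.
                ...   | no vp  | no vp′ = let cc , aq , ar = escapes a∈X mz u∈X a~u yu u≢r in
                  ⊥-elim (Q-free (X⊆ a∈X) (X⊆ y∈X) (X⊆ v∈X) (X⊆ (proj₁ p-core)) (X⊆ (proj₁ p′-core)) (X⊆ u∈X)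
                    (cc p-core) (cc p′-core) a~u (proj₁ (proj₂ p-core)) (proj₁ (proj₂ p′-core)) p≢p′ yu (~-sym u~v) vp vp′)

              all-in : ∀ {v} → v ∈ X → MeetsZ v ⊎ ∃ λ a → a ∈ X × a ~ v × MeetsZ a
              all-in {v} v∈X = does⇒ (In? v) (holds (conn T closed y∈X v∈X (mem (⇒does (In? y) (inj₁ (inj₁ y~q))))))

            meets⇒side : ∀ {a} → a ∈ X → MeetsZ a → side a ≡ s
            meets⇒side {a} a∈X mz = let z , z∈X , az , sz = witness mz in
              trans (across (X⊆ a∈X) (X⊆ z∈X) az) (trans (cong not sz) (𝔹.not-involutive s))
              where
              witness : MeetsZ a → ∃ λ z → z ∈ X × a ~ z × side z ≡ not s
              witness (inj₁ aq) = q , q∈X , aq , opposite q∈X y~q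
              witness (inj₂ (inj₂ (x , xc , ax))) = x , proj₁ xc , ax , opposite (proj₁ xc) (proj₁ (proj₂ xc))
              witness (inj₂ (inj₁ ar)) = r , r∈X , ar , trans (across (X⊆ r∈X) (X⊆ w∈X) (~-sym w~r))
                (cong not (trans (across (X⊆ w∈X) (X⊆ e∈X) w~e) (trans (cong not (opposite e∈X y~e)) (𝔹.not-involutive s))))

            A-meets : ∀ {a} → a ∈ X → side a ≡ s → MeetsZ a
            A-meets {a} a∈X sa with all-in a∈X
            ... | inj₁ mz = mz
            ... | inj₂ (x , x∈X , xa , mz) = contradiction (trans (sym (meets⇒side x∈X mz)) (across (X⊆ x∈X) (X⊆ a∈X) xa)) (𝔹.not-¬ (sym sa))

            B-covered : ∀ {b} → b ∈ X → side b ≡ not s → ∃ λ a → a ∈ X × a ~ b × MeetsZ a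
            B-covered {b} b∈X sb with all-in b∈X
            ... | inj₁ mz = contradiction (trans (sym sb) (meets⇒side b∈X mz)) (𝔹.not-¬ refl ∘ sym)
            ... | inj₂ p  = p

            Big : Fin n → Set
            Big a = ∃ λ z → z ∈ X × a ~ z × ¬ Core z

            big? : ∀ a → Dec (Big a)
            big? a = F.any? (λ z → (z ∈? X) ×-dec (a ~? z) ×-dec ¬? (core? z))

            small⇒core : ∀ {a b} → ¬ Big a → b ∈ X → a ~ b → Core b
            small⇒core {b = b} small b∈X ab = Dec.decidable-stable (core? b) (λ nc → small (b , b∈X , ab , nc))

            missing : ∀ {m b} → m ∈ X → side m ≡ s → Big m → Core b → ¬ m ~ b → m ~ q × m ~ r
            missing {m} {b} m∈X sm (z , z∈X , mz , nc) bc mb with m ~? q | m ~? r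
            ... | yes mq | yes mr = mq , mr
            ... | yes mq | no mr  = contradiction (proj₁ (like-y m∈X mq mr) bc) mb
            ... | no mq  | yes mr = contradiction (proj₁ (like-w m∈X mr mq) bc) mb
            ... | no mq  | no mr  = contradiction (proj₁ (escapes m∈X (A-meets m∈X sm) z∈X mz yz (λ { refl → mr mz })) bc) mb
              where
              yz : ¬ y ~ z
              yz yz = nc (in-core z∈X yz (λ { refl → mq mz }))

            -- If `m` missed a neighbour `b` of `a`, it would be of the kind described in `co-type`,
            -- with `b` as its only missing core vertex. A common neighbour of `a` and `m` then
            -- gives the forbidden tree, with `q` and `r` private to `m`; without one, `y`, `m`, `a`
            -- and a second core vertex give the forbidden four-cycle with a path.
            small⊆big : ∀ {a m b} → a ∈ X → side a ≡ s → ¬ Big a → m ∈ X → side m ≡ s → Big m → b ∈ X → a ~ b → m ~ b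
            small⊆big {a} {m} {b} a∈X sa small m∈X sm big b∈X ab = Dec.decidable-stable (m ~? b) go
              where
              bc = small⇒core small b∈X ab
              aq : ¬ a ~ q
              aq aq = core≢q (small⇒core small q∈X aq) refl
              ar : ¬ a ~ r
              ar ar = core≢r (small⇒core small r∈X ar) refl
              go : ¬ ¬ m ~ b
              go mb with missing m∈X sm big bc mb
              ... | mq , mr with co-type m∈X mq mr
              ... | (u , uc , mu , rest) , _ with F.any? (λ x → (x ∈? X) ×-dec (a ~? x) ×-dec (m ~? x))
              ...   | yes (x , x∈X , ax , mx) =
                S₁₁₃-free (X⊆ a∈X) (X⊆ m∈X) (X⊆ x∈X) (X⊆ q∈X) (X⊆ r∈X) (X⊆ b∈X) ax mx mq mr q≢r aq ar ab mb
              ...   | no none = Q-free (X⊆ y∈X) (X⊆ m∈X) (X⊆ a∈X) (X⊆ q∈X) (X⊆ (proj₁ (proj₁ (proj₂ oc)))) (X⊆ b∈X)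
                  y~q (proj₁ (proj₂ (proj₁ (proj₂ oc)))) (proj₁ (proj₂ bc)) mq m~o (λ e → core≢q (proj₁ (proj₂ oc)) (sym e)) mb ab aq
                  (λ ao → none (proj₁ oc , proj₁ (proj₁ (proj₂ oc)) , ao , m~o))
                where
                oc : ∃ λ o → Core o × o ≢ b
                oc with p F.≟ b
                ... | yes refl = p′ , p′-core , p≢p′ ∘ sym
                ... | no ne    = p , p-core , ne
                b≡u : b ≡ u
                b≡u = Dec.decidable-stable (b F.≟ u) (λ ne → mb (rest bc ne))
                m~o : m ~ proj₁ oc
                m~o = rest (proj₁ (proj₂ oc)) (λ e → proj₂ (proj₂ oc) (trans e (sym b≡u)))

            Upper : Fin n → Set
            Upper b = ∀ m → m ∈ X → side m ≡ s → Big m → m ~ b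

            upper? : ∀ b → Dec (Upper b)
            upper? b = F.all? (λ m → (m ∈? X) →-dec (side m 𝔹.≟ s) →-dec big? m →-dec (m ~? b))

            First : Fin n → Set
            First v = (side v ≡ s × Big v) ⊎ (side v ≡ not s × ¬ Upper v)

            first? : ∀ v → Dec (First v)
            first? v = ((side v 𝔹.≟ s) ×-dec big? v) ⊎-dec ((side v 𝔹.≟ not s) ×-dec ¬? (upper? v))

            y-big : Big y
            y-big = q , q∈X , y~q , λ c → core≢q c refl

            dichotomy : ∀ t → t ≡ s ⊎ t ≡ not s
            dichotomy t with t 𝔹.≟ s
            ... | yes e = inj₁ e
            ... | no ne = inj₂ (𝔹.¬-not ne)

            -- Big vertices and vertices not adjacent to all of them form one part, small vertices
            -- and upper ones the other: big and upper vertices are completely joined, and by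
            -- `small⊆big` small and non-upper ones are not joined at all. This degenerates when
            -- every vertex is in the first part, and then `r` provides another split.
            crossing-split : Split
            crossing-split with F.any? (λ v → (v ∈? X) ×-dec ¬? (first? v))
            ... | yes (v , v∈X , nf) = split first? f (y , y∈X , inj₁ (refl , y-big)) (v , v∈X , nf) value
              where
              f : Bool → Bool → Bool
              f t t′ = does (t 𝔹.≟ s) ∧ not (does (t′ 𝔹.≟ s))
              value : ∀ {u v} → u ∈ X → v ∈ X → First u → ¬ First v → ad u v ≡ f (side u) (side v)
              value {u} {v} u∈X v∈X (inj₁ (su , big)) nf with side u 𝔹.≟ s | side v 𝔹.≟ s
              ... | no ne | _     = contradiction su ne
              ... | yes _ | yes e = same-side u∈X v∈X (trans su (sym e))
              ... | yes _ | no ne = Dec.decidable-stable (upper? v) (λ nu → nf (inj₂ (𝔹.¬-not ne , nu))) u u∈X su big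
              value {u} {v} u∈X v∈X (inj₂ (su , nu)) nf with side u 𝔹.≟ s | side v 𝔹.≟ s
              ... | yes e | _     = contradiction (trans (sym su) e) (𝔹.not-¬ refl ∘ sym)
              ... | no ne | no nv = same-side u∈X v∈X (trans su (sym (𝔹.¬-not nv)))
              ... | no ne | yes e = 𝔹.¬-not λ uv → nu λ m m∈X sm big →
                small⊆big v∈X e (λ b → nf (inj₁ (e , b))) m∈X sm big u∈X (~-sym uv)
            ... | no none = split second? f (y , y∈X , inj₁ (refl , y≁r)) (w , w∈X , λ { (inj₁ (_ , nr)) → nr w~r ; (inj₂ refl) → w≁w w~r }) value
              where
              w≁w : ¬ w ~ w
              w≁w e = 𝔹.not-¬ refl (across (X⊆ w∈X) (X⊆ w∈X) e)
              all-first : ∀ {v} → v ∈ X → First v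
              all-first {v} v∈X = Dec.decidable-stable (first? v) (λ nf → none (v , v∈X , nf))
              r-side : side r ≡ not s
              r-side = across (X⊆ r∈X) (X⊆ w∈X) (~-sym w~r) ∙ meets⇒side w∈X (inj₂ (inj₁ w~r))
                where
                _∙_ : ∀ {t} → side r ≡ not t → t ≡ s → side r ≡ not s
                e ∙ refl = e
              -- `r` with its non-neighbours on side `s`. These turn out to be complete to the
              -- opposite side except for `r`, and `r` is complete to the remaining vertices of side
              -- `s`.
              Second : Fin n → Set
              Second v = (side v ≡ s × ¬ v ~ r) ⊎ v ≡ r
              second? : ∀ v → Dec (Second v)
              second? v = ((side v 𝔹.≟ s) ×-dec ¬? (v ~? r)) ⊎-dec (v F.≟ r)
              f : Bool → Bool → Bool
              f t t′ = not (does (t 𝔹.≟ t′))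
              -- some big neighbourhood misses p, so no sunflower petal exists
              avoider : ∃ λ m → m ∈ X × side m ≡ s × Big m × ¬ m ~ p
              avoider with all-first (proj₁ p-core)
              ... | inj₁ (sp , _) = contradiction (trans (sym (opposite (proj₁ p-core) (proj₁ (proj₂ p-core)))) sp) (𝔹.not-¬ refl ∘ sym)
              ... | inj₂ (_ , nu) with F.any? (λ m → (m ∈? X) ×-dec (side m 𝔹.≟ s) ×-dec big? m ×-dec ¬? (m ~? p))
              ...   | yes a = a
              ...   | no na = contradiction (λ m a b c → Dec.decidable-stable (m ~? p) (λ d → na (m , a , b , c , d))) nu
              no-petal : ∀ {a z} → a ∈ X → side a ≡ s → z ∈ X → a ~ z → y ~ z ⊎ z ≡ r
              no-petal {a} {z} a∈X sa z∈X az with y ~? z | z F.≟ r | avoider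
              ... | yes yz | _     | _ = inj₁ yz
              ... | no _   | yes e | _ = inj₂ e
              ... | no yz  | no ne | m , m∈X , sm , big , mp with missing m∈X sm big p-core mp
              ...   | mq , mr with escapes a∈X (A-meets a∈X sa) z∈X az yz ne
              ...     | cc , aq , ar with co-type m∈X mq mr
              ...       | (u , uc , mu , rest) , inside = ⊥-elim (S₁₁₃-free (X⊆ m∈X) (X⊆ a∈X) (X⊆ (proj₁ p′-core)) (X⊆ (proj₁ p-core)) (X⊆ z∈X) (X⊆ q∈X)
                    (rest p′-core (λ e → p≢p′ (trans p≡u (sym e)))) (cc p′-core) (cc p-core) az (λ { refl → yz (proj₁ (proj₂ p-core)) }) mp mz mq aq)
                where
                p≡u : p ≡ u
                p≡u = Dec.decidable-stable (p F.≟ u) (λ n → mp (rest p-core n))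
                mz : ¬ m ~ z
                mz mz = [ yz , ne ]′ (inside z∈X mz)
              full : ∀ {a b} → a ∈ X → side a ≡ s → ¬ a ~ r → b ∈ X → side b ≡ not s → b ≢ r → a ~ b
              full {a} {b} a∈X sa ar b∈X sb b≢r with B-covered b∈X sb
              ... | x , x∈X , xb , mz with no-petal x∈X (meets⇒side x∈X mz) b∈X xb
              ...   | inj₂ e  = contradiction e b≢r
              ...   | inj₁ yb with a ~? q
              ...     | yes aq = y-part (b F.≟ q)
                where
                y-part : Dec (b ≡ q) → a ~ b
                y-part (yes refl) = aq
                y-part (no ne)    = proj₁ (like-y a∈X aq ar) (in-core b∈X yb ne)
              ...     | no aq with all-first a∈X
              ...       | inj₂ (sa′ , _) = contradiction (trans (sym sa′) sa) (𝔹.not-¬ refl ∘ sym)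
              ...       | inj₁ (_ , (z , z∈X , az , nc)) with no-petal a∈X sa z∈X az
              ...         | inj₂ refl = contradiction az ar
              ...         | inj₁ yz   = contradiction (in-core z∈X yz (λ { refl → aq az })) nc
              value : ∀ {u v} → u ∈ X → v ∈ X → Second u → ¬ Second v → ad u v ≡ f (side u) (side v)
              value {u} {v} u∈X v∈X (inj₁ (su , ur)) ns with side u 𝔹.≟ side v
              ... | yes e = same-side u∈X v∈X e
              ... | no ne = full u∈X su ur v∈X (𝔹.¬-not (λ e → ne (trans su (sym e)))) (ns ∘ inj₂)
              value {u} {v} u∈X v∈X (inj₂ refl) ns with side u 𝔹.≟ side v
              ... | yes e = same-side u∈X v∈X e
              ... | no ne with dichotomy (side v)
              ...   | inj₂ e = contradiction (trans r-side (sym e)) ne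
              ...   | inj₁ e = ~-sym (Dec.decidable-stable (v ~? r) (λ vr → ns (inj₁ (e , vr))))

        -- Of three neighbours of `y` at most one, `q`, is missed by `w`; two others lie in the core
        -- and serve as `p` and `p′`.
        crossing : ∀ y → y ∈ X → Maximal y → ∀ {w e r} → w ∈ X → e ∈ X → y ~ e → w ~ e → r ∈ X → w ~ r → ¬ y ~ r →
          ∀ {a b c} → a ∈ X → b ∈ X → c ∈ X → y ~ a → y ~ b → y ~ c → a ≢ b → b ≢ c → a ≢ c → Split
        crossing y y∈X y-max {w} {e} {r} w∈X e∈X ye we r∈X wr yr {a} {b} {c} a∈X b∈X c∈X ya yb yc a≢b b≢c a≢c with
          F.any? (λ q → (q ∈? X) ×-dec (y ~? q) ×-dec ¬? (w ~? q))
        ... | no none = contradiction (y-max w∈X (λ {b} b∈X y~b → Dec.decidable-stable (w ~? b) (λ ne → none (b , b∈X , y~b , ne))) r∈X wr) yr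
        ... | yes (q , q∈X , yq , wq) = pick (a F.≟ q) (b F.≟ q)
          where
          only-q : ∀ {x} → x ∈ X → y ~ x → x ≢ q → x ∈ X × y ~ x × w ~ x
          only-q {x} x∈X yx x≢q = x∈X , yx , Dec.decidable-stable (w ~? x) λ wx →
            x≢q (at-most-one w∈X y∈X e∈X x∈X q∈X r∈X we ye wr yr yx wx yq wq)
          finish : ∀ {p p′} → p ∈ X × y ~ p × w ~ p → p′ ∈ X × y ~ p′ × w ~ p′ → p ≢ p′ → Split
          finish = Crossing.crossing-split y y∈X y-max w∈X (e∈X , ye , we) r∈X wr yr q∈X yq wq
          pick : Dec (a ≡ q) → Dec (b ≡ q) → Split
          pick (yes refl) _          = finish (only-q b∈X yb (a≢b ∘ sym)) (only-q c∈X yc (a≢c ∘ sym)) b≢c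
          pick (no ne)    (yes refl) = finish (only-q a∈X ya ne) (only-q c∈X yc (b≢c ∘ sym)) a≢c
          pick (no ne)    (no ne′)   = finish (only-q a∈X ya ne) (only-q b∈X yb ne′) a≢b

      private
        Claw : Sub n → Set
        Claw X = ∃ λ v → v ∈ X × ∃ λ a → a ∈ X × v ~ a × ∃ λ b → b ∈ X × v ~ b × a ≢ b × ∃ λ c → c ∈ X × v ~ c × b ≢ c × a ≢ c

        claw? : ∀ X → Dec (Claw X)
        claw? X = F.any? λ v → (v ∈? X) ×-dec F.any? λ a → (a ∈? X) ×-dec (v ~? a) ×-dec F.any? λ b → (b ∈? X) ×-dec (v ~? b) ×-dec ¬? (a F.≟ b) ×-dec
          F.any? λ c → (c ∈? X) ×-dec (v ~? c) ×-dec ¬? (b F.≟ c) ×-dec ¬? (a F.≟ c)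

        step : ∀ X → X ⊆ X₀ → Inhabited X → W ad τ 3 X ⊎ Splitting {ad = ad} {τ = τ} X
        step X X⊆ inh with connected-or-split ad ad-sym X inh
        ... | inj₂ (S , i , j , none) = inj₂ (S , i , j , λ p p′ q q′ _ _ → trans (none p q) (sym (none p′ q′)))
        ... | inj₁ conn with claw? X
        ...   | no none = inj₁ (refine-labels (λ _ → refl) (degree≤2-tree ad ad-sym X few inh))
          where
          few : ∀ {v a b c} → v ∈ X → a ∈ X → b ∈ X → c ∈ X → v ~ a → v ~ b → v ~ c → a ≡ b ⊎ b ≡ c ⊎ a ≡ c
          few {v} {a} {b} {c} v∈ a∈ b∈ c∈ va vb vc with a F.≟ b | b F.≟ c | a F.≟ c
          ... | yes e | _     | _     = inj₁ e
          ... | no _  | yes e | _     = inj₂ (inj₁ e)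
          ... | no _  | no _  | yes e = inj₂ (inj₂ e)
          ... | no x  | no y  | no z  = contradiction (v , v∈ , a , a∈ , va , b , b∈ , vb , x , c , c∈ , vc , y , z) none
        -- Passing to an inclusion-maximal neighbourhood above that of `v` keeps the three
        -- neighbours `a`, `b`, `c`.
        ...   | yes (v , v∈ , a , a∈ , va , b , b∈ , vb , a≢b , c , c∈ , vc , b≢c , a≢c)
          with Step.maximal X X⊆ conn n v v∈ (ℕ.m≤m+n n _)
        ...     | y , y∈ , ge , mx
          with F.any? (λ w → (w ∈? X) ×-dec F.any? (λ e → (e ∈? X) ×-dec (y ~? e) ×-dec (w ~? e)) ×-dec
            F.any? (λ r → (r ∈? X) ×-dec (w ~? r) ×-dec ¬? (y ~? r)))
        ...       | no none = inj₂ (Step.Around.no-crossing X X⊆ conn y y∈ mx none (a , a∈ , ge a∈ va))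
        ...       | yes (w , w∈ , (e , m) , r , r∈ , wr , yr) =
          inj₂ (Cross.crossing X X⊆ conn y y∈ mx w∈ (proj₁ m) (proj₁ (proj₂ m)) (proj₂ (proj₂ m)) r∈ wr yr a∈ b∈ c∈ (ge a∈ va) (ge b∈ vb) (ge c∈ vc) a≢b b≢c a≢c)

      bipartite-tree : ∀ {X} → X ⊆ X₀ → Inhabited X → W ad τ 3 X
      bipartite-tree {X} X⊆ = decompose (_⊆ X₀) (λ Y⊆X X⊆ → X⊆ ∘ Y⊆X) step X X⊆

-- Types with transitive adjacency

module Typed {n : ℕ} (ad : Matrix n) (ad-sym : ∀ u v → ad u v ≡ ad v u) (X₀ : Sub n)
  {T : Set} (_≟_ : DecidableEquality T) (typ : Fin n → T)
  (indep : ∀ {u v} → u ∈ X₀ → v ∈ X₀ → typ u ≡ typ v → ad u v ≡ false)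
  (P₂+P₃-free : ∀ {y z b b′ d} → y ∈ X₀ → z ∈ X₀ → b ∈ X₀ → b′ ∈ X₀ → d ∈ X₀ →
    typ y ≡ typ z → typ b ≡ typ b′ → typ b ≡ typ d → typ y ≢ typ b →
    ad y b ≡ true → ad y b′ ≡ true → b ≢ b′ → ad z d ≡ true → ad z b ≡ false → ad z b′ ≡ false → ad y d ≡ false → ⊥)
  {L : Set} (τ : Fin n → L) (typ-τ : ∀ {u v} → τ u ≡ τ v → typ u ≡ typ v) where

  private
    _~_ : Fin n → Fin n → Set
    u ~ v = ad u v ≡ true

    ~-sym : ∀ {u v} → u ~ v → v ~ u
    ~-sym {u} {v} = trans (ad-sym v u)

  Three-types : Sub n → Set
  Three-types X = ∃ λ u → u ∈ X × ∃ λ v → v ∈ X × typ u ≢ typ v × ∃ λ w → w ∈ X × typ v ≢ typ w × typ u ≢ typ w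

  three-types? : ∀ X → Dec (Three-types X)
  three-types? X = F.any? λ u → (u ∈? X) ×-dec F.any? λ v → (v ∈? X) ×-dec ¬? (typ u ≟ typ v) ×-dec
    F.any? λ w → (w ∈? X) ×-dec ¬? (typ v ≟ typ w) ×-dec ¬? (typ u ≟ typ w)

  -- Edges join different types, so the type of `o` against the rest is a bipartition. Vertices with
  -- a common neighbour have equal type, which places the P₂ + P₃ inside each configuration
  -- forbidden for bipartite graphs between two types, where it is excluded.
  two-types-tree : ∀ {X} → X ⊆ X₀ → ¬ Three-types X → Inhabited X → W ad τ 3 X
  two-types-tree {X} X⊆ few inh@(o , o∈X) =
    B.bipartite-tree τ (cong (λ t → does (t ≟ typ o)) ∘ typ-τ) S₁₁₃-free Q-free id inh
    where
    side : Fin n → Bool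
    side v = does (typ v ≟ typ o)
    adjacent : ∀ {u v} → u ∈ X → v ∈ X → u ~ v → typ u ≢ typ v
    adjacent u∈X v∈X e t = contradiction (trans (sym e) (indep (X⊆ u∈X) (X⊆ v∈X) t)) λ ()
    across : ∀ {u v} → u ∈ X → v ∈ X → u ~ v → side u ≡ not (side v)
    across {u} {v} u∈X v∈X e with typ u ≟ typ o | typ v ≟ typ o
    ... | yes p | yes q = contradiction (trans p (sym q)) (adjacent u∈X v∈X e)
    ... | yes p | no _  = refl
    ... | no _  | yes q = refl
    ... | no p  | no q  = contradiction (u , u∈X , v , v∈X , adjacent u∈X v∈X e , o , o∈X , q , p) few
    module B = Bipartite ad ad-sym X side across
    same : ∀ {u v w} → u ∈ X → v ∈ X → w ∈ X → u ~ w → v ~ w → typ u ≡ typ v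
    same {u} {v} {w} u∈X v∈X w∈X p q = Dec.decidable-stable (typ u ≟ typ v) λ ne →
      few (u , u∈X , v , v∈X , ne , w , w∈X , adjacent v∈X w∈X q , adjacent u∈X w∈X p)
    pair-free : ∀ {a c b b′ d} → a ∈ X → c ∈ X → b ∈ X → b′ ∈ X → d ∈ X → typ a ≡ typ c → typ b ≡ typ d →
      c ~ b → c ~ b′ → b ≢ b′ → ¬ a ~ b → ¬ a ~ b′ → a ~ d → ¬ c ~ d → ⊥
    pair-free a∈ c∈ b∈ b′∈ d∈ ac bd cb cb′ ne ab ab′ ad′ cd = P₂+P₃-free (X⊆ c∈) (X⊆ a∈) (X⊆ b∈) (X⊆ b′∈) (X⊆ d∈) (sym ac)
      (same b∈ b′∈ c∈ (~-sym cb) (~-sym cb′)) bd (adjacent c∈ b∈ cb) cb cb′ ne ad′ (𝔹.¬-not ab) (𝔹.¬-not ab′) (𝔹.¬-not cd)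
    S₁₁₃-free : ∀ {a c e b b′ d} → a ∈ X → c ∈ X → e ∈ X → b ∈ X → b′ ∈ X → d ∈ X →
      a ~ e → c ~ e → c ~ b → c ~ b′ → b ≢ b′ → ¬ a ~ b → ¬ a ~ b′ → a ~ d → ¬ c ~ d → ⊥
    S₁₁₃-free a∈ c∈ e∈ b∈ b′∈ d∈ ae ce cb cb′ ne ab ab′ ad′ cd = pair-free a∈ c∈ b∈ b′∈ d∈ (same a∈ c∈ e∈ ae ce)
      (trans (same b∈ e∈ c∈ (~-sym cb) (~-sym ce)) (same e∈ d∈ a∈ (~-sym ae) (~-sym ad′))) cb cb′ ne ab ab′ ad′ cd
    Q-free : ∀ {x c a b b′ d} → x ∈ X → c ∈ X → a ∈ X → b ∈ X → b′ ∈ X → d ∈ X →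
      x ~ b → x ~ b′ → x ~ d → c ~ b → c ~ b′ → b ≢ b′ → ¬ c ~ d → a ~ d → ¬ a ~ b → ¬ a ~ b′ → ⊥
    Q-free x∈ c∈ a∈ b∈ b′∈ d∈ xb xb′ xd cb cb′ ne cd ad′ ab ab′ = pair-free a∈ c∈ b∈ b′∈ d∈
      (trans (same a∈ x∈ d∈ ad′ xd) (same x∈ c∈ b∈ xb cb)) (same b∈ d∈ x∈ (~-sym xb) (~-sym xd)) cb cb′ ne ab ab′ ad′ cd

  -- After complementing between some of the types, adjacency across types is transitive.
  -- A component meeting three types is then complete multipartite.

  module Transitive (φ : T → T → Bool) (φ-sym : ∀ s t → φ s t ≡ φ t s)
    (transitive : ∀ {u v w} → u ∈ X₀ → v ∈ X₀ → w ∈ X₀ → typ u ≢ typ v → typ v ≢ typ w → typ u ≢ typ w →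
      ad u v xor φ (typ u) (typ v) ≡ true → ad v w xor φ (typ v) (typ w) ≡ true → ad u w xor φ (typ u) (typ w) ≡ true) where

    E : Matrix n
    E u v = not (does (typ u ≟ typ v)) ∧ (ad u v xor φ (typ u) (typ v))

    E-elim : ∀ {u v} → E u v ≡ true → typ u ≢ typ v × ad u v xor φ (typ u) (typ v) ≡ true
    E-elim {u} {v} e with typ u ≟ typ v
    ... | no ne = ne , e

    E-intro : ∀ {u v} → typ u ≢ typ v → ad u v xor φ (typ u) (typ v) ≡ true → E u v ≡ true
    E-intro {u} {v} ne e with typ u ≟ typ v
    ... | yes t = contradiction t ne
    ... | no _  = e

    E-sym : ∀ u v → E u v ≡ E v u
    E-sym u v = cong₂ _∧_ (cong not (does-⇔ (typ u ≟ typ v) (typ v ≟ typ u) sym sym)) (cong₂ _xor_ (ad-sym u v) (φ-sym (typ u) (typ v)))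

    E-sym′ : ∀ {u v} → E u v ≡ true → E v u ≡ true
    E-sym′ {u} {v} = trans (E-sym v u)

    E-trans : ∀ {u v w} → u ∈ X₀ → v ∈ X₀ → w ∈ X₀ → typ u ≢ typ w → E u v ≡ true → E v w ≡ true → E u w ≡ true
    E-trans u∈ v∈ w∈ ne p q = let a , b = E-elim p ; c , d = E-elim q in E-intro ne (transitive u∈ v∈ w∈ a c ne b d)

    value : ∀ b {u v} → u ∈ X₀ → v ∈ X₀ → (typ u ≢ typ v → E u v ≡ b) →
      ad u v ≡ not (does (typ u ≟ typ v)) ∧ (b xor φ (typ u) (typ v))
    value b {u} {v} u∈ v∈ f with typ u ≟ typ v
    ... | yes t = indep u∈ v∈ t
    ... | no ne = undo (ad u v) b (φ (typ u) (typ v)) (f ne)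
      where
      undo : ∀ a b c → a xor c ≡ b → a ≡ b xor c
      undo false _ false refl = refl
      undo false _ true  refl = refl
      undo true  _ false refl = refl
      undo true  _ true  refl = refl

    module _ {X} (X⊆ : X ⊆ X₀) (conn : Connected E X) (three : Three-types X) where

      private
        third : ∀ s t → ∃ λ z → z ∈ X × typ z ≢ s × typ z ≢ t
        third s t = choose three
          where
          choose : Three-types X → ∃ λ z → z ∈ X × typ z ≢ s × typ z ≢ t
          choose (u₁ , u₁∈ , u₂ , u₂∈ , u₁≢u₂ , u₃ , u₃∈ , u₂≢u₃ , u₁≢u₃) with typ u₁ ≟ s | typ u₁ ≟ t | typ u₂ ≟ s | typ u₂ ≟ t
          ... | no a     | no b     | _       | _       = u₁ , u₁∈ , a , b
          ... | _        | _        | no a    | no b    = u₂ , u₂∈ , a , b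
          ... | yes refl | _        | yes e   | _       = contradiction (sym e) u₁≢u₂
          ... | _        | yes refl | _       | yes e   = contradiction (sym e) u₁≢u₂
          ... | yes refl | no _     | no _    | yes refl = u₃ , u₃∈ , u₁≢u₃ ∘ sym , u₂≢u₃ ∘ sym
          ... | no _     | yes refl | yes refl | no _   = u₃ , u₃∈ , u₂≢u₃ ∘ sym , u₁≢u₃ ∘ sym

        -- Otherwise the vertices of these two types without `E`-neighbours of a third type would
        -- form a closed set containing `x`, contrary to connectedness and the presence of a third
        -- type.
        triangle : ∀ {x y} → x ∈ X → y ∈ X → E x y ≡ true → ∃ λ z → z ∈ X × typ z ≢ typ x × typ z ≢ typ y × E x z ≡ true × E y z ≡ true
        triangle {x} {y} x∈ y∈ xy with F.any? (λ z → (z ∈? X) ×-dec ¬? (typ z ≟ typ x) ×-dec ¬? (typ z ≟ typ y) ×-dec (E x z 𝔹.≟ true))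
        ... | yes (z , z∈ , a , b , xz) = z , z∈ , a , b , xz , E-trans (X⊆ y∈) (X⊆ x∈) (X⊆ z∈) (b ∘ sym) (E-sym′ xy) xz
        ... | no none = let z , z∈ , a , b = third (typ x) (typ y) in
          ⊥-elim ([ a , b ]′ (proj₁ (does⇒ (S? z) (holds (conn S closed x∈ z∈ (mem (⇒does (S? x) (inj₁ refl , λ z z∈ a b e → none (z , z∈ , a , b , e)))))))))
          where
          Far : Fin n → Set
          Far v = (typ v ≡ typ x ⊎ typ v ≡ typ y) × (∀ z → z ∈ X → typ z ≢ typ x → typ z ≢ typ y → E v z ≢ true)
          S? : ∀ v → Dec (Far v)
          S? v = ((typ v ≟ typ x) ⊎-dec (typ v ≟ typ y)) ×-dec
            F.all? (λ z → (z ∈? X) →-dec ¬? (typ z ≟ typ x) →-dec ¬? (typ z ≟ typ y) →-dec ¬? (E v z 𝔹.≟ true))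
          S : Sub n
          S v = does (S? v)
          closed : Closed E X S
          closed {v} {w} v∈ w∈ vw (mem p) with does⇒ (S? v) p
          ... | t , far = mem (⇒does (S? w) (known , λ z z∈ a b wz → far z z∈ a b (E-trans (X⊆ v∈) (X⊆ w∈) (X⊆ z∈) (other t a b) vw wz)))
            where
            known : typ w ≡ typ x ⊎ typ w ≡ typ y
            known with typ w ≟ typ x | typ w ≟ typ y
            ... | yes e | _     = inj₁ e
            ... | no _  | yes e = inj₂ e
            ... | no a  | no b  = contradiction vw (far w w∈ a b)
            other : ∀ {z} → typ v ≡ typ x ⊎ typ v ≡ typ y → typ z ≢ typ x → typ z ≢ typ y → typ v ≢ typ z
            other (inj₁ e) a b f = a (trans (sym f) e)
            other (inj₂ e) a b f = b (trans (sym f) e)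

        -- Transitivity applies only to three different types. When `w` has the type of `y`, the
        -- third vertex of a triangle on `x y` is used as a detour.
        copy : ∀ {x y x′ w} → x ∈ X → y ∈ X → x′ ∈ X → w ∈ X → E x y ≡ true → E y x′ ≡ true → typ x ≡ typ x′ → E w x ≡ true → E w x′ ≡ true
        copy {x} {y} {x′} {w} x∈ y∈ x′∈ w∈ xy yx′ xx′ wx with typ w ≟ typ y
        ... | no ne = E-trans (X⊆ w∈) (X⊆ y∈) (X⊆ x′∈) w≢x′ (E-trans (X⊆ w∈) (X⊆ x∈) (X⊆ y∈) ne wx xy) yx′
          where
          w≢x′ : typ w ≢ typ x′
          w≢x′ e = proj₁ (E-elim wx) (trans e (sym xx′))
        ... | yes wy with triangle x∈ y∈ xy
        ...   | z , z∈ , zx , zy , xz , yz = E-trans (X⊆ w∈) (X⊆ z∈) (X⊆ x′∈) (λ e → proj₁ (E-elim wx) (trans e (sym xx′)))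
          (E-trans (X⊆ w∈) (X⊆ x∈) (X⊆ z∈) (λ e → zy (trans (sym e) wy)) wx xz)
          (E-trans (X⊆ z∈) (X⊆ y∈) (X⊆ x′∈) (λ e → zx (trans e (sym xx′))) (E-sym′ yz) yx′)

      complete : ∀ {u v} → u ∈ X → v ∈ X → typ u ≢ typ v → E u v ≡ true
      complete {u} {v} u∈ v∈ ne = proj₁ (does⇒ (S? v) (holds (conn S closed u∈ v∈ (mem (⇒does (S? u) start))))) ne
        where
        -- For a vertex of the type of `u` there is no edge to ask for; its part is played by having
        -- the same `E`-neighbours as `u`.
        Good : Fin n → Set
        Good v = (typ u ≢ typ v → E u v ≡ true) × (typ u ≡ typ v → ∀ w → w ∈ X → (E w u ≡ true → E w v ≡ true) × (E w v ≡ true → E w u ≡ true))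
        S? : ∀ v → Dec (Good v)
        S? v = (¬? (typ u ≟ typ v) →-dec (E u v 𝔹.≟ true)) ×-dec ((typ u ≟ typ v) →-dec F.all? (λ w → (w ∈? X) →-dec
          (((E w u 𝔹.≟ true) →-dec (E w v 𝔹.≟ true)) ×-dec ((E w v 𝔹.≟ true) →-dec (E w u 𝔹.≟ true)))))
        S : Sub n
        S v = does (S? v)
        start : Good u
        start = (λ ne → contradiction refl ne) , λ _ w _ → id , id
        closed : Closed E X S
        closed {v} {w} v∈ w∈ vw (mem p) = mem (⇒does (S? w) (go (typ u ≟ typ v)))
          where
          far = proj₁ (does⇒ (S? v) p)
          near = proj₂ (does⇒ (S? v) p)
          go : Dec (typ u ≡ typ v) → Good w
          go (yes uv) = (λ _ → E-sym′ (proj₂ (near uv w w∈) (E-sym′ vw))) , λ uw → contradiction (trans (sym uv) uw) (proj₁ (E-elim vw))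
          go (no ne)  = (λ uw → E-trans (X⊆ u∈) (X⊆ v∈) (X⊆ w∈) uw (far ne) vw) ,
            λ uw x x∈ → copy u∈ v∈ w∈ x∈ (far ne) vw uw , copy w∈ v∈ u∈ x∈ (E-sym′ vw) (E-sym′ (far ne)) (sym uw)

    transitive-tree : ∀ {X} → X ⊆ X₀ → Inhabited X → W ad τ 3 X
    transitive-tree {X} X⊆ = decompose (_⊆ X₀) (λ Y⊆X X⊆ → X⊆ ∘ Y⊆X) step X X⊆
      where
      pattern-eq : ∀ b {u u′ v v′} → u ∈ X₀ → u′ ∈ X₀ → v ∈ X₀ → v′ ∈ X₀ → (typ u ≢ typ v → E u v ≡ b) → (typ u′ ≢ typ v′ → E u′ v′ ≡ b) →
        τ u ≡ τ u′ → τ v ≡ τ v′ → ad u v ≡ ad u′ v′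
      pattern-eq b p p′ q q′ f f′ e e′ = trans (value b p q f)
        (trans (cong₂ (λ s t → not (does (s ≟ t)) ∧ (b xor φ s t)) (typ-τ e) (typ-τ e′)) (sym (value b p′ q′ f′)))
      step : ∀ X → X ⊆ X₀ → Inhabited X → W ad τ 3 X ⊎ Splitting {ad = ad} {τ = τ} X
      step X X⊆ inh with connected-or-split E E-sym X inh
      ... | inj₂ (S , i , j , none) = inj₂ (S , i , j , λ p p′ q q′ →
        pattern-eq false (X⊆ (proj₁ (∈∩ X S p))) (X⊆ (proj₁ (∈∩ X S p′))) (X⊆ (proj₁ (∈∖ X S q))) (X⊆ (proj₁ (∈∖ X S q′))) (λ _ → none p q) (λ _ → none p′ q′))
      ... | inj₁ conn with three-types? X
      ...   | no few = inj₁ (two-types-tree X⊆ few inh)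
      ...   | yes three = inj₁ (uniform-tree X (λ p p′ q q′ _ _ →
        pattern-eq true (X⊆ p) (X⊆ p′) (X⊆ q) (X⊆ q′) (complete X⊆ conn three p q) (complete X⊆ conn three p′ q′)) inh)

-- Three classes without triangles and independent transversals

-- With three independent classes, neither triangles nor independent transversals, orient the pairs
-- between consecutive classes forwards along edges and backwards along non-edges. The resulting
-- tripartite tournament has no directed triangle, so a strong part meets at most two classes.

orient : Fin 3 → Fin 3 → Bool → Bool
orient zero          (suc zero)       b = b
orient (suc zero)    (suc (suc zero)) b = b
orient (suc (suc zero)) zero          b = b
orient (suc zero)    zero             b = not b
orient (suc (suc zero)) (suc zero)    b = not b
orient zero          (suc (suc zero)) b = not b
orient _             _                b = false

orient-flip : ∀ i j b → i ≢ j → orient i j b ≡ not (orient j i b)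
orient-flip zero             zero             b ne = contradiction refl ne
orient-flip zero             (suc zero)       b ne = sym (𝔹.not-involutive b)
orient-flip zero             (suc (suc zero)) b ne = refl
orient-flip (suc zero)       zero             b ne = refl
orient-flip (suc zero)       (suc zero)       b ne = contradiction refl ne
orient-flip (suc zero)       (suc (suc zero)) b ne = sym (𝔹.not-involutive b)
orient-flip (suc (suc zero)) zero             b ne = sym (𝔹.not-involutive b)
orient-flip (suc (suc zero)) (suc zero)       b ne = refl
orient-flip (suc (suc zero)) (suc (suc zero)) b ne = contradiction refl ne

-- the adjacency from i to j for a pair that is not oriented from i to j
unoriented : Fin 3 → Fin 3 → Bool
unoriented (suc zero)       zero             = true
unoriented (suc (suc zero)) (suc zero)       = true
unoriented zero             (suc (suc zero)) = true
unoriented _                _                = false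

unoriented-≡ : ∀ i j b → i ≢ j → orient i j b ≡ false → b ≡ unoriented i j
unoriented-≡ zero             zero             b ne e = contradiction refl ne
unoriented-≡ zero             (suc zero)       b ne e = e
unoriented-≡ zero             (suc (suc zero)) true ne e = refl
unoriented-≡ (suc zero)       zero             true ne e = refl
unoriented-≡ (suc zero)       (suc zero)       b ne e = contradiction refl ne
unoriented-≡ (suc zero)       (suc (suc zero)) b ne e = e
unoriented-≡ (suc (suc zero)) zero             b ne e = e
unoriented-≡ (suc (suc zero)) (suc zero)       true ne e = refl
unoriented-≡ (suc (suc zero)) (suc (suc zero)) b ne e = contradiction refl ne

unoriented-irrefl : ∀ i → unoriented i i ≡ false
unoriented-irrefl zero             = refl
unoriented-irrefl (suc zero)       = refl
unoriented-irrefl (suc (suc zero)) = refl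

module Cyclic {n : ℕ} (ad : Matrix n) (ad-sym : ∀ u v → ad u v ≡ ad v u) (X₀ : Sub n) (lam : Fin n → Fin 3)
  (indep : ∀ {u v} → u ∈ X₀ → v ∈ X₀ → lam u ≡ lam v → ad u v ≡ false)
  (P₂+P₃-free : ∀ {y z b b′ d} → y ∈ X₀ → z ∈ X₀ → b ∈ X₀ → b′ ∈ X₀ → d ∈ X₀ →
    lam y ≡ lam z → lam b ≡ lam b′ → lam b ≡ lam d → lam y ≢ lam b →
    ad y b ≡ true → ad y b′ ≡ true → b ≢ b′ → ad z d ≡ true → ad z b ≡ false → ad z b′ ≡ false → ad y d ≡ false → ⊥)
  (no-triangle : ∀ {u v w} → u ∈ X₀ → v ∈ X₀ → w ∈ X₀ → lam u ≡ zero → lam v ≡ suc zero → lam w ≡ suc (suc zero) →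
    ad u v ≡ true → ad v w ≡ true → ad u w ≡ true → ⊥)
  (no-transversal : ∀ {u v w} → u ∈ X₀ → v ∈ X₀ → w ∈ X₀ → lam u ≡ zero → lam v ≡ suc zero → lam w ≡ suc (suc zero) →
    ad u v ≡ false → ad v w ≡ false → ad u w ≡ false → ⊥)
  {L : Set} (τ : Fin n → L) (lam-τ : ∀ {u v} → τ u ≡ τ v → lam u ≡ lam v) where

  private
    module Ty = Typed ad ad-sym X₀ F._≟_ lam indep P₂+P₃-free τ lam-τ

    R : Matrix n
    R u v = orient (lam u) (lam v) (ad u v)

    R-flip : ∀ {u v} → lam u ≢ lam v → R u v ≡ not (R v u)
    R-flip {u} {v} ne = trans (orient-flip (lam u) (lam v) (ad u v) ne) (cong (λ b → not (orient (lam v) (lam u) b)) (ad-sym u v))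

    off : ∀ {b} → not b ≡ true → b ≡ false
    off {false} _ = refl

    no-3-cycle : ∀ {u v w} → u ∈ X₀ → v ∈ X₀ → w ∈ X₀ → R u v ≡ true → R v w ≡ true → R w u ≡ true → ⊥
    no-3-cycle {u} {v} {w} u∈ v∈ w∈ uv vw wu with lam u in a | lam v in b | lam w in c
    ... | zero | suc zero | suc (suc zero) = no-triangle u∈ v∈ w∈ a b c uv vw (trans (ad-sym u w) wu)
    ... | suc zero | suc (suc zero) | zero = no-triangle w∈ u∈ v∈ c a b wu uv (trans (ad-sym w v) vw)
    ... | suc (suc zero) | zero | suc zero = no-triangle v∈ w∈ u∈ b c a vw wu (trans (ad-sym v u) uv)
    ... | zero | suc (suc zero) | suc zero = no-transversal u∈ w∈ v∈ a c b (trans (ad-sym u w) (off wu)) (trans (ad-sym w v) (off vw)) (off uv)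
    ... | suc (suc zero) | suc zero | zero = no-transversal w∈ v∈ u∈ c b a (trans (ad-sym w v) (off vw)) (trans (ad-sym v u) (off uv)) (off wu)
    ... | suc zero | zero | suc (suc zero) = no-transversal v∈ u∈ w∈ b a c (trans (ad-sym v u) (off uv)) (trans (ad-sym u w) (off wu)) (off vw)
    no-3-cycle _ _ _ () _ _ | zero | zero | _
    no-3-cycle _ _ _ () _ _ | suc zero | suc zero | _
    no-3-cycle _ _ _ () _ _ | suc (suc zero) | suc (suc zero) | _
    no-3-cycle _ _ _ _ () _ | _ | zero | zero
    no-3-cycle _ _ _ _ () _ | _ | suc zero | suc zero
    no-3-cycle _ _ _ _ () _ | _ | suc (suc zero) | suc (suc zero)
    no-3-cycle _ _ _ _ _ () | zero | _ | zero
    no-3-cycle _ _ _ _ _ () | suc zero | _ | suc zero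
    no-3-cycle _ _ _ _ _ () | suc (suc zero) | _ | suc (suc zero)

    R-trans : ∀ {u v w} → u ∈ X₀ → v ∈ X₀ → w ∈ X₀ → lam u ≢ lam w → R u v ≡ true → R v w ≡ true → R u w ≡ true
    R-trans {u} {v} {w} u∈ v∈ w∈ ne uv vw with R u w in e
    ... | true  = refl
    ... | false = ⊥-elim (no-3-cycle u∈ v∈ w∈ uv vw (trans (R-flip (ne ∘ sym)) (cong not e)))

    module Strong {X} (X⊆ : X ⊆ X₀) (conn : Connected R X) where

      Pair : Fin 3 → Fin 3 → Sub n
      Pair i j = [ X ∣ (λ v → (lam v F.≟ i) ⊎-dec (lam v F.≟ j)) ]

      pair⊆ : ∀ {i j v} → v ∈ Pair i j → v ∈ X × (lam v ≡ i ⊎ lam v ≡ j)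
      pair⊆ {i} {j} = ∈[] X (λ v → (lam v F.≟ i) ⊎-dec (lam v F.≟ j))

      ∈pair : ∀ {i j v} → v ∈ X → (lam v ≡ i ⊎ lam v ≡ j) → v ∈ Pair i j
      ∈pair {i} {j} = []∈ X (λ v → (lam v F.≟ i) ⊎-dec (lam v F.≟ j))

      -- By `R-trans` the out-neighbourhood of `x` is closed within two classes that do not contain
      -- `x`, so an arc from `x` propagates to everything reachable there.
      precedes : ∀ {i j k x v} → i ≢ k → j ≢ k → lam x ≡ k → x ∈ X → v ∈ Pair i j → ∀ T → (∀ {S} → Closed R (Pair i j) S → v ∈ S → T ∈ S) →
        R x v ≡ true → R x T ≡ true
      precedes {i} {j} {k} {x} {v} i≢k j≢k xk x∈ v∈ t reach xv =
        holds (reach {S = R x} (λ {u} {w} u∈ w∈ uw (mem xu) → mem (R-trans (X⊆ x∈) (X⊆ (proj₁ (pair⊆ u∈))) (X⊆ (proj₁ (pair⊆ w∈))) (λ e → apart w∈ (trans (sym e) xk)) xu uw)) (mem xv))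
        where
        apart : ∀ {w} → w ∈ Pair i j → lam w ≢ k
        apart w∈ e with proj₂ (pair⊆ w∈)
        ... | inj₁ f = i≢k (trans (sym f) e)
        ... | inj₂ f = j≢k (trans (sym f) e)

      module _ {i j k} (i≢j : i ≢ j) (j≢k : j ≢ k) (i≢k : i ≢ k) (any3 : ∀ l → l ≡ i ⊎ l ≡ j ⊎ l ≡ k)
        {x} (x∈ : x ∈ X) (xi : lam x ≡ i) where

        private
          CJ = component R (Pair i j) x (∈pair x∈ (inj₁ xi))
          CK = component R (Pair i k) x (∈pair x∈ (inj₁ xi))
          SJ = proj₁ CJ
          SK = proj₁ CK
          leastJ : ∀ T → Closed R (Pair i j) T → x ∈ T → SJ ⊆ T
          leastJ = proj₂ (proj₂ (proj₂ (proj₂ CJ)))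
          leastK : ∀ T → Closed R (Pair i k) T → x ∈ T → SK ⊆ T
          leastK = proj₂ (proj₂ (proj₂ (proj₂ CK)))
          SJ⊆ = proj₁ (proj₂ (proj₂ CJ))
          SK⊆ = proj₁ (proj₂ (proj₂ CK))
          clJ : Closed R (Pair i j) SJ
          clJ = proj₁ (proj₂ (proj₂ (proj₂ CJ)))
          clK : Closed R (Pair i k) SK
          clK = proj₁ (proj₂ (proj₂ (proj₂ CK)))

          -- an arc leaving the two classes can be taken from x already
          leave : ∀ {m v w} → m ≢ i → lam w ≢ i → lam w ≢ m → w ∈ X → x ∈ Pair i m → v ∈ Pair i m →
            (∀ T → Closed R (Pair i m) T → x ∈ T → v ∈ T) → R v w ≡ true → R x w ≡ true
          leave {m} {v} {w} m≢i wi wm w∈ x∈P v∈P reach vw with R x w in e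
          ... | true  = refl
          ... | false = contradiction (trans (sym vw) (trans (R-flip v≢w) (cong not
              (precedes (wi ∘ sym) (wm ∘ sym) refl w∈ x∈P v (λ {S} cl s → reach S cl s) (trans (R-flip (λ f → wi (trans f xi))) (cong not e)))))) λ ()
            where
            v≢w : lam v ≢ lam w
            v≢w f with proj₂ (pair⊆ v∈P)
            ... | inj₁ g = wi (trans (sym f) g)
            ... | inj₂ g = wm (trans (sym f) g)

          closed : Closed R X (SJ ∪ SK)
          closed {v} {w} v∈ w∈ vw s with ∈∪ SJ SK s
          ... | inj₁ sj with any3 (lam w)
          ...   | inj₁ wi        = ∪ˡ SJ SK (clJ (SJ⊆ sj) (∈pair w∈ (inj₁ wi)) vw sj)
          ...   | inj₂ (inj₁ wj) = ∪ˡ SJ SK (clJ (SJ⊆ sj) (∈pair w∈ (inj₂ wj)) vw sj)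
          ...   | inj₂ (inj₂ wk) = ∪ʳ SJ SK (clK (∈pair x∈ (inj₁ xi)) (∈pair w∈ (inj₂ wk))
            (leave (i≢j ∘ sym) (λ e → i≢k (trans (sym e) wk)) (λ e → j≢k (trans (sym e) wk)) w∈ (∈pair x∈ (inj₁ xi)) (SJ⊆ sj) (λ T cl x∈T → leastJ T cl x∈T sj) vw)
            (proj₁ (proj₂ CK)))
          closed {v} {w} v∈ w∈ vw s | inj₂ sk with any3 (lam w)
          ...   | inj₁ wi        = ∪ʳ SJ SK (clK (SK⊆ sk) (∈pair w∈ (inj₁ wi)) vw sk)
          ...   | inj₂ (inj₂ wk) = ∪ʳ SJ SK (clK (SK⊆ sk) (∈pair w∈ (inj₂ wk)) vw sk)
          ...   | inj₂ (inj₁ wj) = ∪ˡ SJ SK (clJ (∈pair x∈ (inj₁ xi)) (∈pair w∈ (inj₂ wj))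
            (leave (i≢k ∘ sym) (λ e → i≢j (trans (sym e) wj)) (λ e → j≢k (trans (sym wj) e)) w∈ (∈pair x∈ (inj₁ xi)) (SK⊆ sk) (λ T cl x∈T → leastK T cl x∈T sk) vw)
            (proj₁ (proj₂ CJ)))

        -- By `leave`, an arc into the third class could have started at `x` itself. So the vertices
        -- reached from `x` within classes i, j and those reached within i, k form a closed set
        -- together, which is all of `X` by strong connectedness.
        reaches : ∀ {y} → y ∈ X → lam y ≡ j → ∀ T → Closed R (Pair i j) T → x ∈ T → y ∈ T
        reaches {y} y∈ yj T cl x∈T with ∈∪ SJ SK (conn (SJ ∪ SK) closed x∈ y∈ (∪ˡ SJ SK (proj₁ (proj₂ CJ))))
        ... | inj₁ sj = leastJ T cl x∈T sj
        ... | inj₂ sk with proj₂ (pair⊆ (SK⊆ sk))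
        ...   | inj₁ yi = contradiction (trans (sym yi) yj) i≢j
        ...   | inj₂ yk = contradiction (trans (sym yj) yk) j≢k

        shift : ∀ {y z} → y ∈ X → lam y ≡ j → z ∈ X → lam z ≡ k → R z x ≡ true → R z y ≡ true
        shift {y} y∈ yj z∈ zk zx = precedes i≢k j≢k zk z∈ (∈pair x∈ (inj₁ xi)) y (λ {S} cl s → reaches y∈ yj S cl s) zx

      private
        exclude : ∀ {u v} → lam u ≢ lam v → R u v ≡ true → R v u ≡ true → ⊥
        exclude ne uv vu = contradiction (trans (sym uv) (trans (R-flip ne) (cong not vu))) λ ()

        ca≢ : ∀ {u v} → lam u ≡ suc (suc zero) → lam v ≡ zero → lam u ≢ lam v
        ca≢ p q e = contradiction (trans (sym p) (trans e q)) λ ()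
        cb≢ : ∀ {u v} → lam u ≡ suc (suc zero) → lam v ≡ suc zero → lam u ≢ lam v
        cb≢ p q e = contradiction (trans (sym p) (trans e q)) λ ()
        ba≢ : ∀ {u v} → lam u ≡ suc zero → lam v ≡ zero → lam u ≢ lam v
        ba≢ p q e = contradiction (trans (sym p) (trans e q)) λ ()

        exhaust : Fin 3 → Fin 3 → Fin 3 → Set
        exhaust i j k = ∀ l → l ≡ i ⊎ l ≡ j ⊎ l ≡ k

        012-cases : exhaust zero (suc zero) (suc (suc zero))
        012-cases = λ { zero → inj₁ refl ; (suc zero) → inj₂ (inj₁ refl) ; (suc (suc zero)) → inj₂ (inj₂ refl) }
        021-cases : exhaust zero (suc (suc zero)) (suc zero)
        021-cases = λ { zero → inj₁ refl ; (suc zero) → inj₂ (inj₂ refl) ; (suc (suc zero)) → inj₂ (inj₁ refl) }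
        102-cases : exhaust (suc zero) zero (suc (suc zero))
        102-cases = λ { zero → inj₂ (inj₁ refl) ; (suc zero) → inj₁ refl ; (suc (suc zero)) → inj₂ (inj₂ refl) }
        120-cases : exhaust (suc zero) (suc (suc zero)) zero
        120-cases = λ { zero → inj₂ (inj₂ refl) ; (suc zero) → inj₁ refl ; (suc (suc zero)) → inj₂ (inj₁ refl) }
        201-cases : exhaust (suc (suc zero)) zero (suc zero)
        201-cases = λ { zero → inj₂ (inj₁ refl) ; (suc zero) → inj₂ (inj₂ refl) ; (suc (suc zero)) → inj₁ refl }
        210-cases : exhaust (suc (suc zero)) (suc zero) zero
        210-cases = λ { zero → inj₂ (inj₂ refl) ; (suc zero) → inj₂ (inj₁ refl) ; (suc (suc zero)) → inj₁ refl }

      -- By `shift` each of `a`, `b`, `c` has arcs to both of the others or to neither. The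
      -- out-degrees would be even, but the three arcs between them make their sum three.
      impossible : ∀ {a b c} → a ∈ X → b ∈ X → c ∈ X → lam a ≡ zero → lam b ≡ suc zero → lam c ≡ suc (suc zero) → ⊥
      impossible {a} {b} {c} a∈ b∈ c∈ a0 b1 c2 with R c a in ca
      ... | true = exclude (ca≢ c2 a0) ca (shift (λ ()) (λ ()) (λ ()) 120-cases b∈ b1 c∈ c2 a∈ a0 ab)
        where
        cb : R c b ≡ true
        cb = shift (λ ()) (λ ()) (λ ()) 012-cases a∈ a0 b∈ b1 c∈ c2 ca
        ab : R a b ≡ true
        ab with R b a in ba
        ... | true  = ⊥-elim (exclude (cb≢ c2 b1) cb (shift (λ ()) (λ ()) (λ ()) 021-cases a∈ a0 c∈ c2 b∈ b1 ba))
        ... | false = trans (R-flip (ba≢ b1 a0 ∘ sym)) (cong not ba)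
      ... | false = exclude (ca≢ c2 a0 ∘ sym) ac (shift (λ ()) (λ ()) (λ ()) 102-cases b∈ b1 a∈ a0 c∈ c2 cb)
        where
        ac : R a c ≡ true
        ac = trans (R-flip (ca≢ c2 a0 ∘ sym)) (cong not ca)
        ab : R a b ≡ true
        ab = shift (λ ()) (λ ()) (λ ()) 210-cases c∈ c2 b∈ b1 a∈ a0 ac
        cb : R c b ≡ true
        cb with R b c in bc
        ... | true  = ⊥-elim (exclude (ba≢ b1 a0 ∘ sym) ab (shift (λ ()) (λ ()) (λ ()) 201-cases c∈ c2 a∈ a0 b∈ b1 bc))
        ... | false = trans (R-flip (cb≢ c2 b1)) (cong not bc)

    Cut : Sub n → Fin n → Set
    Cut X u = Σ (Sub n) λ S → u ∈ X × u ∈ S × Closed R X S × Inhabited (X ∖ S)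

    cut? : ∀ X u → Dec (Cut X u)
    cut? X u with u ∈? X
    ... | no u∉ = no (u∉ ∘ proj₁ ∘ proj₂)
    ... | yes u∈ with component R X u u∈
    ...   | S , u∈S , S⊆ , cl , least = Dec.map′ (λ i → S , u∈ , u∈S , cl , i)
      (λ { (T , _ , u∈T , clT , v , p) → v , ∖∈ X S (proj₁ (∈∖ X T p)) (λ v∈S → proj₂ (∈∖ X T p) (least T clT u∈T v∈S)) }) (inhabited? (X ∖ S))

    four-in-three : ∀ (l i j k : Fin 3) → i ≢ j → j ≢ k → i ≢ k → i ≢ l → j ≢ l → k ≡ l
    four-in-three = Dec.toWitness {a? = F.all? λ l → F.all? λ i → F.all? λ j → F.all? λ k →
      ¬? (i F.≟ j) →-dec ¬? (j F.≟ k) →-dec ¬? (i F.≟ k) →-dec ¬? (i F.≟ l) →-dec ¬? (j F.≟ l) →-dec (k F.≟ l)} tt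

    missing : ∀ {X l} → ¬ (∃ λ v → v ∈ X × lam v ≡ l) → ¬ Ty.Three-types X
    missing {l = l} ∄ (u , u∈ , v , v∈ , uv , w , w∈ , vw , uw) =
      ∄ (w , w∈ , four-in-three l (lam u) (lam v) (lam w) uv vw uw (λ e → ∄ (u , u∈ , e)) (λ e → ∄ (v , v∈ , e)))

  -- No arc leaves a closed set, so all pairs across it point backwards and their adjacencies can be
  -- read off from the classes. If there is no proper closed set, the tournament is strong and some
  -- class is absent.
  cyclic-tree : ∀ {X} → X ⊆ X₀ → Inhabited X → W ad τ 3 X
  cyclic-tree {X} X⊆ = decompose (_⊆ X₀) (λ Y⊆X X⊆ → X⊆ ∘ Y⊆X) step X X⊆
    where
    step : ∀ X → X ⊆ X₀ → Inhabited X → W ad τ 3 X ⊎ Splitting {ad = ad} {τ = τ} X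
    step X X⊆ inh with F.any? (cut? X)
    ... | yes (u , S , u∈X , u∈S , cl , more) = inj₂ (S , (u , ∩∈ X S u∈X u∈S) , more , λ {a} {a′} {b} {b′} p p′ q q′ e e′ →
      trans (known p q) (trans (cong₂ unoriented (lam-τ e) (lam-τ e′)) (sym (known p′ q′))))
      where
      known : ∀ {a b} → a ∈ X ∩ S → b ∈ X ∖ S → ad a b ≡ unoriented (lam a) (lam b)
      known {a} {b} p q with lam a F.≟ lam b
      ... | yes e = trans (indep (X⊆ (proj₁ (∈∩ X S p))) (X⊆ (proj₁ (∈∖ X S q))) e)
        (sym (trans (cong (unoriented (lam a)) (sym e)) (unoriented-irrefl (lam a))))
      ... | no ne = unoriented-≡ (lam a) (lam b) (ad a b) ne (𝔹.¬-not λ r →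
        proj₂ (∈∖ X S q) (cl (proj₁ (∈∩ X S p)) (proj₁ (∈∖ X S q)) r (proj₂ (∈∩ X S p))))
    ... | no none with present zero | present (suc zero) | present (suc (suc zero))
      where
      present : ∀ l → Dec (∃ λ v → v ∈ X × lam v ≡ l)
      present l = F.any? (λ v → (v ∈? X) ×-dec (lam v F.≟ l))
    ...   | yes (a , a∈ , a0) | yes (b , b∈ , b1) | yes (c , c∈ , c2) = ⊥-elim (Strong.impossible X⊆ conn a∈ b∈ c∈ a0 b1 c2)
      where
      conn : Connected R X
      conn T cl {u} {v} u∈ v∈ u∈T = Dec.decidable-stable (v ∈? T) λ v∉T → none (u , T , u∈ , u∈T , cl , v , ∖∈ X T v∈ v∉T)
    ...   | no ∄ | _ | _ = inj₁ (Ty.two-types-tree X⊆ (missing ∄) inh)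
    ...   | yes _ | no ∄ | _ = inj₁ (Ty.two-types-tree X⊆ (missing ∄) inh)
    ...   | yes _ | yes _ | no ∄ = inj₁ (Ty.two-types-tree X⊆ (missing ∄) inh)

-- Bipartite graphs with non-crossing neighbourhoods

-- If no two neighbourhoods of vertices on side s cross (with all four regions non-empty), then complementing
-- those that contain a fixed vertex o makes them laminar.

module CrossFree {n : ℕ} (ad : Matrix n) (ad-sym : ∀ u v → ad u v ≡ ad v u) (X₀ : Sub n) (side : Fin n → Bool)
  (across : ∀ {u v} → u ∈ X₀ → v ∈ X₀ → ad u v ≡ true → side u ≡ not (side v)) (s : Bool)
  (uncrossed : ∀ {y z a b c d} → y ∈ X₀ → z ∈ X₀ → a ∈ X₀ → b ∈ X₀ → c ∈ X₀ → d ∈ X₀ → side y ≡ s → side z ≡ s →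
    side a ≡ not s → side b ≡ not s → side c ≡ not s → side d ≡ not s →
    ad y a ≡ true → ad z a ≡ true → ad y b ≡ true → ad z b ≡ false → ad y c ≡ false → ad z c ≡ true →
    ad y d ≡ false → ad z d ≡ false → ⊥)
  (o : Fin n) (o∈ : o ∈ X₀) (o-side : side o ≡ not s) where

  private
    xor-not : ∀ t → t xor not t ≡ true
    xor-not true  = refl
    xor-not false = refl

    not-xor : ∀ t → not t xor t ≡ true
    not-xor true  = refl
    not-xor false = refl

    -- For a pair on different sides this is the adjacency to `o` of the end on side `s`, which
    -- decides whether the neighbourhood of that end is complemented.
    key : Bool → Bool → Bool → Bool
    key t k k′ = if does (t 𝔹.≟ s) then k else k′

    ad′ : Matrix n
    ad′ u v = (side u xor side v) ∧ (ad u v xor key (side u) (ad o u) (ad o v))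

    key-swap : ∀ t t′ k k′ → t xor t′ ≡ true → key t k k′ ≡ key t′ k′ k
    key-swap t t′ k k′ e with t 𝔹.≟ s | t′ 𝔹.≟ s
    ... | yes _    | no _     = refl
    ... | no _     | yes _    = refl
    ... | yes refl | yes refl = contradiction (trans (sym e) (𝔹.xor-same t)) λ ()
    ... | no p     | no q     = contradiction (trans (sym e) (trans (cong₂ _xor_ (𝔹.¬-not p) (𝔹.¬-not q)) (𝔹.xor-same (not s)))) λ ()

    ad′-sym : ∀ u v → ad′ u v ≡ ad′ v u
    ad′-sym u v with side u xor side v in e | side v xor side u in e′
    ... | true  | true  = cong₂ _xor_ (ad-sym u v) (key-swap (side u) (side v) (ad o u) (ad o v) e)
    ... | false | false = refl
    ... | true  | false = contradiction (trans (sym e) (trans (𝔹.xor-comm (side u) (side v)) e′)) λ ()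
    ... | false | true  = contradiction (trans (sym e′) (trans (𝔹.xor-comm (side v) (side u)) e)) λ ()

    xor-true : ∀ {a b} → a xor b ≡ true → a ≡ not b
    xor-true {false} {true}  _ = refl
    xor-true {true}  {false} _ = refl

    ad′-across : ∀ {u v} → ad′ u v ≡ true → side u ≡ not (side v)
    ad′-across {u} {v} e with side u xor side v in x
    ... | true = xor-true x

    τ : Fin n → Bool × Bool
    τ v = side v , ad o v

    module B = Bipartite ad′ ad′-sym X₀ side (λ _ _ → ad′-across)

    ad′-s : ∀ {y b} → side y ≡ s → side b ≡ not s → ad′ y b ≡ ad y b xor ad o y
    ad′-s {y} {b} ys bs rewrite ys | bs with s 𝔹.≟ s
    ... | yes _ rewrite xor-not s = refl
    ... | no ne = contradiction refl ne

    at : ∀ {y b x} → side y ≡ s → side b ≡ not s → ad′ y b ≡ x → ad y b ≡ x xor ad o y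
    at {y} {b} ys bs e = undo (ad y b) (ad o y) (trans (sym (ad′-s ys bs)) e)
      where
      undo : ∀ a c {x} → a xor c ≡ x → a ≡ x xor c
      undo false false refl = refl
      undo false true  refl = refl
      undo true  false refl = refl
      undo true  true  refl = refl

    -- Complementing one or both neighbourhoods permutes the four regions of a pair. After the
    -- complementation `o` lies outside both, so it always supplies the fourth region of the
    -- excluded crossing.
    laminar : ∀ {y z e q r} → y ∈ X₀ → z ∈ X₀ → e ∈ X₀ → q ∈ X₀ → r ∈ X₀ → side y ≡ s → side z ≡ s →
      side e ≡ not s → side q ≡ not s → side r ≡ not s →
      ad′ y e ≡ true → ad′ z e ≡ true → ad′ y q ≡ true → ad′ z q ≡ false → ad′ y r ≡ false → ad′ z r ≡ true → ⊥
    laminar {y} {z} y∈ z∈ e∈ q∈ r∈ ys zs es qs rs ye ze yq zq yr zr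
      with ad o y in oy | ad o z in oz | at ys es ye | at zs es ze | at ys qs yq | at zs qs zq | at ys rs yr | at zs rs zr
    ... | false | false | a | b | c | d | f | g =
      uncrossed y∈ z∈ e∈ q∈ r∈ o∈ ys zs es qs rs o-side a b c d f g (trans (ad-sym y o) oy) (trans (ad-sym z o) oz)
    ... | true  | false | a | b | c | d | f | g =
      uncrossed y∈ z∈ r∈ o∈ e∈ q∈ ys zs rs o-side es qs f g (trans (ad-sym y o) oy) (trans (ad-sym z o) oz) a b c d
    ... | false | true  | a | b | c | d | f | g =
      uncrossed y∈ z∈ q∈ e∈ o∈ r∈ ys zs qs es o-side rs c d a b (trans (ad-sym y o) oy) (trans (ad-sym z o) oz) f g
    ... | true  | true  | a | b | c | d | f | g =
      uncrossed y∈ z∈ o∈ r∈ q∈ e∈ ys zs o-side rs qs es (trans (ad-sym y o) oy) (trans (ad-sym z o) oz) f g c d a b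

    step : ∀ X → X ⊆ X₀ → Inhabited X → W ad′ τ 1 X ⊎ Splitting {ad = ad′} {τ = τ} X
    step X X⊆ inh with connected-or-split ad′ ad′-sym X inh
    ... | inj₂ (S , i , j , none) = inj₂ (S , i , j , λ p p′ q q′ _ _ → trans (none p q) (sym (none p′ q′)))
    ... | inj₁ conn with F.any? (λ y → (y ∈? X) ×-dec (side y 𝔹.≟ s) ×-dec F.any? (λ b → (b ∈? X) ×-dec (ad′ y b 𝔹.≟ true)))
    ...   | no none = inj₁ (uniform-tree X (λ p p′ q q′ _ _ _ _ → trans (no-edge p q) (sym (no-edge p′ q′))) inh)
      where
      no-edge : ∀ {u v} → u ∈ X → v ∈ X → ad′ u v ≡ false
      no-edge {u} {v} p q = 𝔹.¬-not go
        where
        go : ad′ u v ≢ true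
        go e = pick (side u 𝔹.≟ s)
          where
          pick : Dec (side u ≡ s) → ⊥
          pick (yes us) = none (u , p , us , v , q , e)
          pick (no ne)  = none (v , q , trans (ad′-across (trans (ad′-sym v u) e)) (trans (cong not (𝔹.¬-not ne)) (𝔹.not-involutive s)) , u , p , trans (ad′-sym v u) e)
    ...   | yes (y , y∈ , ys , b , b∈ , yb) with B.Step.maximal τ (cong proj₁) X X⊆ conn n y y∈ (ℕ.m≤m+n n _)
    ...     | z , z∈ , ge , mx = inj₂ (B.Step.Around.no-crossing τ (cong proj₁) X X⊆ conn z z∈ mx uncrossing (b , b∈ , ge b∈ yb))
      where
      s-side : ∀ {u e} → side e ≡ not s → ad′ u e ≡ true → side u ≡ s
      s-side es ue = trans (ad′-across ue) (trans (cong not es) (𝔹.not-involutive s))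
      n-side : ∀ {u e} → side u ≡ s → ad′ u e ≡ true → side e ≡ not s
      n-side {u} {e} us ue = trans (ad′-across (trans (ad′-sym e u) ue)) (cong not us)
      zs : side z ≡ s
      zs = s-side (n-side ys yb) (ge b∈ yb)
      uncrossing : ¬ ∃ λ w → w ∈ X × (∃ λ e → e ∈ X × ad′ z e ≡ true × ad′ w e ≡ true) × ∃ λ r → r ∈ X × ad′ w r ≡ true × ad′ z r ≢ true
      uncrossing (w , w∈ , (e , e∈ , ze , we) , r , r∈ , wr , zr) with F.any? (λ q → (q ∈? X) ×-dec (ad′ z q 𝔹.≟ true) ×-dec ¬? (ad′ w q 𝔹.≟ true))
      ... | no none = zr (mx w∈ (λ {q} q∈ zq → Dec.decidable-stable (ad′ w q 𝔹.≟ true) (λ wq → none (q , q∈ , zq , wq))) r∈ wr)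
      ... | yes (q , q∈ , zq , wq) = laminar (X⊆ z∈) (X⊆ w∈) (X⊆ e∈) (X⊆ q∈) (X⊆ r∈) zs ws (n-side zs ze) (n-side zs zq) (n-side ws wr)
          ze we zq (𝔹.¬-not wq) (𝔹.¬-not zr) wr
        where
        ws : side w ≡ s
        ws = s-side (n-side zs ze) we

  cross-free-tree : ∀ {X} → X ⊆ X₀ → Inhabited X → W ad (λ v → side v , ad o v) 1 X
  cross-free-tree {X} X⊆ inh = transform f eq X⊆ (decompose (_⊆ X₀) (λ Y⊆X X⊆ → X⊆ ∘ Y⊆X) step X X⊆ inh)
    where
    f : Bool × Bool → Bool × Bool → Bool → Bool
    f (t , k) (t′ , k′) b = (t xor t′) ∧ (b xor key t k k′)
    cancel : ∀ a b → a ≡ (a xor b) xor b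
    cancel false false = refl
    cancel false true  = refl
    cancel true  false = refl
    cancel true  true  = refl
    eq : ∀ {u v} → u ∈ X₀ → v ∈ X₀ → u ≢ v → ad u v ≡ f (τ u) (τ v) (ad′ u v)
    eq {u} {v} p q _ with side u xor side v in e
    ... | true  = cancel (ad u v) _
    ... | false = 𝔹.¬-not λ r → contradiction (trans (sym e) (trans (cong (_xor side v) (across p q r)) (not-xor (side v)))) λ ()

-- Searching for small induced subgraphs

-- Small configurations as Boolean matrices, newest vertex first: for each vertex the row of its
-- neighbours and the row of its non-neighbours other than itself.

Row : Set
Row = List Bool

Config : Set
Config = List (Row × Row)

grow-row : Bool → Row × Row → Row × Row
grow-row b (x , y) = (b ∷ x) , (not b ∷ y)

addV : Row → Config → Config
addV r g = (false ∷ r , false ∷ List.map not r) ∷ List.zipWith grow-row r g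

meet : Row → Row → Row
meet (true ∷ xs)  (y ∷ ys) = y ∷ meet xs ys
meet (false ∷ xs) (y ∷ ys) = false ∷ meet xs ys
meet _            _        = []

someV : Row → Config → (Row × Row → Bool) → Bool
someV (true ∷ m)  (r ∷ g) f = f r ∨ someV m g f
someV (false ∷ m) (r ∷ g) f = someV m g f
someV _           _       f = false

select : Bool → Row × Row → Row
select true  (x , _) = x
select false (_ , y) = y

restrict : Row → List Row → Row × Row → List Row
restrict (b ∷ bs) (m ∷ ms) v = meet m (select b v) ∷ restrict bs ms v
restrict _        _        v = []

-- Backtracking search for a pattern (its upper triangular adjacency rows) with candidate sets.
embed : Config → List Row → List Row → Bool
embed g []       ms       = true
embed g (h ∷ hs) []       = false
embed g (h ∷ hs) (m ∷ ms) = someV m g (λ v → embed g hs (restrict h ms v))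

newest : Config → Row
newest []      = []
newest (_ ∷ g) = true ∷ List.map (λ _ → false) g

everything : Config → Row
everything = List.map (λ _ → true)

-- The first vertex of the pattern is pinned to the newest vertex. A pattern that is searched for
-- therefore lists orders beginning with at least one vertex of each orbit of its automorphisms.
occurs : Config → List Row → Bool
occurs g []       = false
occurs g (h ∷ hs) = embed g (h ∷ hs) (newest g ∷ List.map (λ _ → everything g) hs)

Edges : Set
Edges = List (ℕ × ℕ)

edge : Edges → ℕ → ℕ → Bool
edge []             i j = false
edge ((a , b) ∷ es) i j = ((i ℕ.≡ᵇ a) ∧ (j ℕ.≡ᵇ b)) ∨ ((j ℕ.≡ᵇ a) ∧ (i ℕ.≡ᵇ b)) ∨ edge es i j

edge-sym : ∀ es i j → edge es i j ≡ edge es j i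
edge-sym []             i j = refl
edge-sym ((a , b) ∷ es) i j rewrite edge-sym es i j = swap ((i ℕ.≡ᵇ a) ∧ (j ℕ.≡ᵇ b)) ((j ℕ.≡ᵇ a) ∧ (i ℕ.≡ᵇ b)) (edge es j i)
  where
  swap : ∀ x y z → x ∨ y ∨ z ≡ y ∨ x ∨ z
  swap true  true  z = refl
  swap true  false z = refl
  swap false true  z = refl
  swap false false z = refl

triangular : Edges → List ℕ → List Row
triangular es []       = []
triangular es (i ∷ is) = List.map (edge es i) is ∷ triangular es is

configuration : Edges → List ℕ → Config
configuration es []       = []
configuration es (i ∷ is) = addV (List.map (edge es i) is) (configuration es is)

-- A graph on the names 0, 1, …, together with orders of its vertices in which to search for it.
record Pattern : Set where
  field
    order  : ℕ
    edges  : Edges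
    orders : List (List ℕ)

open Pattern

anyL : ∀ {A : Set} → (A → Bool) → List A → Bool
anyL f []       = false
anyL f (x ∷ xs) = f x ∨ anyL f xs

allL : ∀ {A : Set} → (A → Bool) → List A → Bool
allL f []       = true
allL f (x ∷ xs) = f x ∧ allL f xs

allBits : ℕ → (Row → Bool) → Bool
allBits zero    f = f []
allBits (suc k) f = allBits k (λ r → f (false ∷ r) ∧ f (true ∷ r))

prune : List Pattern → Config → Bool
prune ps g = anyL (λ p → anyL (λ is → occurs g (triangular (edges p) is)) (orders p)) ps

-- An order that omits a vertex would find only part of the pattern, and this contradicts nothing.
valid : Pattern → Bool
valid p = allL (λ is → allL (λ i → anyL (i ℕ.≡ᵇ_) is) (List.upTo (order p))) (orders p)

∧-true : ∀ {a b} → a ∧ b ≡ true → a ≡ true × b ≡ true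
∧-true {true} {true} _ = refl , refl

∨-true : ∀ {a b} → a ∨ b ≡ true → a ≡ true ⊎ b ≡ true
∨-true {true}  _ = inj₁ refl
∨-true {false} e = inj₂ e

anyL-true : ∀ {A : Set} (f : A → Bool) xs → anyL f xs ≡ true → ∃ λ x → x L.∈ xs × f x ≡ true
anyL-true f (x ∷ xs) e with ∨-true {f x} e
... | inj₁ p = x , here refl , p
... | inj₂ p = let y , y∈ , q = anyL-true f xs p in y , there y∈ , q

allL-true : ∀ {A : Set} (f : A → Bool) xs → allL f xs ≡ true → ∀ {x} → x L.∈ xs → f x ≡ true
allL-true f (x ∷ xs) e (here refl) = proj₁ (∧-true e)
allL-true f (x ∷ xs) e (there x∈)  = allL-true f xs (proj₂ (∧-true {f x} e)) x∈

allBits-true : ∀ k f → allBits k f ≡ true → ∀ r → List.length r ≡ k → f r ≡ true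
allBits-true zero    f e []          _  = e
allBits-true (suc k) f e (false ∷ r) eq = proj₁ (∧-true (allBits-true k _ e r (ℕ.suc-injective eq)))
allBits-true (suc k) f e (true ∷ r)  eq = proj₂ (∧-true {f (false ∷ r)} (allBits-true k _ e r (ℕ.suc-injective eq)))

≡ᵇ-true : ∀ i j → (i ℕ.≡ᵇ j) ≡ true → i ≡ j
≡ᵇ-true i j e = ℕ.≡ᵇ⇒≡ i j (subst Data.Bool.T (sym e) tt)

rowsOf : ℕ → List Row
rowsOf zero    = [] ∷ []
rowsOf (suc k) = List.map (false ∷_) (rowsOf k) ++ List.map (true ∷_) (rowsOf k)

keep : ∀ {A : Set} → (A → Bool) → List A → List A
keep f []       = []
keep f (x ∷ xs) = if f x then x ∷ keep f xs else keep f xs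

keep∈ : ∀ {A : Set} (f : A → Bool) {xs x} → x L.∈ xs → f x ≡ true → x L.∈ keep f xs
keep∈ f {y ∷ xs} (here refl) e rewrite e = here refl
keep∈ f {y ∷ xs} (there x∈) e with f y
... | true  = there (keep∈ f x∈ e)
... | false = keep∈ f x∈ e

rowsOf∈ : ∀ k r → List.length r ≡ k → r L.∈ rowsOf k
rowsOf∈ zero    []          _  = here refl
rowsOf∈ (suc k) (false ∷ r) eq = ∈-++⁺ˡ (∈-map⁺ (false ∷_) (rowsOf∈ k r (ℕ.suc-injective eq)))
rowsOf∈ (suc k) (true ∷ r)  eq = ∈-++⁺ʳ (List.map (false ∷_) (rowsOf k)) (∈-map⁺ (true ∷_) (rowsOf∈ k r (ℕ.suc-injective eq)))

feasible : List Pattern → ℕ → Config → List Row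
feasible ps m g = keep (λ r → not (prune ps (addV r g))) (rowsOf m)

-- Exhaustive refutation: there are no further vertices, one for each predicate, whose kinds and adjacencies
-- to the earlier new vertices satisfy the predicates.

module Refutation {K : Set} (row : K → Row) (rule : K → K → Bool → Bool) (ps : List Pattern) (kinds : List K) where

  Pred : Set
  Pred = K → Row → List K → Bool

  ruled : K → Row → List K → Bool
  ruled κ (b ∷ bs) (k ∷ ks) = rule κ k b ∨ ruled κ bs ks
  ruled κ _        _        = false

  mutual
    refute : List Pred → Config → List K → Bool
    -- All required vertices have been placed without a forbidden pattern, so the refutation fails.
    refute []       g ks = false
    refute (p ∷ qs) g ks = allL (λ κ → allBits (List.length ks) (λ bs → not (p κ bs ks) ∨ ruled κ bs ks ∨ refute′ qs (κ ∷ ks) (addV (bs ++ row κ) g))) kinds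

    refute′ : List Pred → List K → Config → Bool
    refute′ qs ks g = prune ps g ∨ refute qs g ks

module Search {n : ℕ} (ad : Matrix n) (ad-sym : ∀ u v → ad u v ≡ ad v u) (ad-irrefl : ∀ v → ad v v ≡ false) (X : Sub n) where

  non : Fin n → Fin n → Bool
  non v w = not (ad v w) ∧ not (does (v F.≟ w))

  spec : List (Fin n) → Fin n → Row × Row
  spec vs v = List.map (ad v) vs , List.map (non v) vs

  matrix : List (Fin n) → Config
  matrix []       = []
  matrix (v ∷ vs) = addV (List.map (ad v) vs) (matrix vs)

  Apart : Fin n → List (Fin n) → Set
  Apart v vs = ∀ {w} → w L.∈ vs → v ≢ w

  Distinct : List (Fin n) → Set
  Distinct []       = ⊤
  Distinct (v ∷ vs) = Apart v vs × Distinct vs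

  private
    non-irrefl : ∀ v → non v v ≡ false
    non-irrefl v rewrite ⇒does (v F.≟ v) refl = 𝔹.∧-zeroʳ (not (ad v v))

    non-≢ : ∀ {v w} → v ≢ w → non v w ≡ not (ad v w)
    non-≢ {v} {w} ne with v F.≟ w
    ... | yes e = contradiction e ne
    ... | no _  = 𝔹.∧-identityʳ (not (ad v w))

    co-row : ∀ v vs → Apart v vs → List.map not (List.map (ad v) vs) ≡ List.map (non v) vs
    co-row v []       ap = refl
    co-row v (w ∷ vs) ap = cong₂ _∷_ (sym (non-≢ (ap (here refl)))) (co-row v vs (ap ∘ there))

    old-rows : ∀ v all vs → Apart v vs → List.zipWith grow-row (List.map (ad v) vs) (List.map (spec all) vs) ≡ List.map (spec (v ∷ all)) vs
    old-rows v all []       ap = refl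
    old-rows v all (w ∷ vs) ap = cong₂ _∷_
      (cong₂ (λ a b → (a ∷ List.map (ad w) all) , (b ∷ List.map (non w) all)) (ad-sym v w)
        (trans (cong not (ad-sym v w)) (sym (non-≢ (ap (here refl) ∘ sym)))))
      (old-rows v all vs (ap ∘ there))

  -- Configurations grow by `addV`, one vertex at a time, during the search. Soundness needs their
  -- rows as actual neighbourhoods, so that candidate masks become sets of vertices.
  matrix-spec : ∀ vs → Distinct vs → matrix vs ≡ List.map (spec vs) vs
  matrix-spec []       _        = refl
  matrix-spec (v ∷ vs) (ap , d) rewrite matrix-spec vs d = cong₂ _∷_
    (cong₂ _,_ (cong (_∷ List.map (ad v) vs) (sym (ad-irrefl v))) (cong₂ _∷_ (sym (non-irrefl v)) (co-row v vs ap)))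
    (old-rows v vs vs ap)

  data At : Row → List (Fin n) → Fin n → Set where
    here  : ∀ {m v vs} → At (true ∷ m) (v ∷ vs) v
    there : ∀ {b m v vs w} → At m vs w → At (b ∷ m) (v ∷ vs) w

  Ahead : Edges → ℕ → Fin n → List ℕ → List (Fin n) → Set
  Ahead es i w (j ∷ js) (x ∷ xs) = (ad w x ≡ edge es i j × w ≢ x) × Ahead es i w js xs
  Ahead es i w []       []       = ⊤
  Ahead es i w _        _        = ⊥

  Placed : Edges → List ℕ → List (Fin n) → Set
  Placed es (i ∷ is) (w ∷ ws) = Ahead es i w is ws × Placed es is ws
  Placed es []       []       = ⊤
  Placed es _        _        = ⊥

  private
    meet-at : ∀ m p vs {w} → At (meet m (List.map p vs)) vs w → At m vs w × p w ≡ true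
    meet-at (true ∷ m)  p (v ∷ vs) at with p v in e
    meet-at (true ∷ m)  p (v ∷ vs) here       | true = here , e
    meet-at (true ∷ m)  p (v ∷ vs) (there at) | _    = let a , b = meet-at m p vs at in there a , b
    meet-at (false ∷ m) p (v ∷ vs) (there at) = let a , b = meet-at m p vs at in there a , b

    someV-true : ∀ (s : Fin n → Row × Row) m vs f → someV m (List.map s vs) f ≡ true → ∃ λ w → At m vs w × f (s w) ≡ true
    someV-true s (true ∷ m) (v ∷ vs) f e with ∨-true {f (s v)} e
    ... | inj₁ p = v , here , p
    ... | inj₂ p = let w , a , b = someV-true s m vs f p in w , there a , b
    someV-true s (false ∷ m) (v ∷ vs) f e = let w , a , b = someV-true s m vs f e in w , there a , b

    Within : List (Fin n) → List Row → List (Fin n) → Set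
    Within vs (m ∷ ms) (w ∷ ws) = At m vs w × Within vs ms ws
    Within vs _        []       = ⊤
    Within vs []       (_ ∷ _)  = ⊥

    restrict-within : ∀ vs es i is w ms ws → Within vs (restrict (List.map (edge es i) is) ms (spec vs w)) ws → List.length is ≡ List.length ws →
      Within vs ms ws × Ahead es i w is ws
    restrict-within vs es i []       w ms       []       wi eq = tt′ ms , tt
      where
      tt′ : ∀ ms → Within vs ms []
      tt′ []      = tt
      tt′ (_ ∷ _) = tt
    restrict-within vs es i (j ∷ is) w (m ∷ ms) (x ∷ ws) (at , wi) eq =
      let a , b = restrict-within vs es i is w ms ws wi (ℕ.suc-injective eq) ; c , d = split (edge es i j) at in (c , a) , d , b
      where
      split : ∀ b → At (meet m (select b (spec vs w))) vs x → At m vs x × (ad w x ≡ b × w ≢ x)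
      split true at = let p , q = meet-at m (ad w) vs at in p , q , λ { refl → contradiction (trans (sym (ad-irrefl w)) q) λ () }
      split false at with meet-at m (non w) vs at
      ... | p , q with ad w x | w F.≟ x
      ...   | false | no ne = p , refl , ne

    embed-sound : ∀ vs → Distinct vs → ∀ es is ms → embed (matrix vs) (triangular es is) ms ≡ true →
      ∃ λ ws → Placed es is ws × Within vs ms ws × List.length is ≡ List.length ws
    embed-sound vs d es []       ms e = [] , tt , empty ms , refl
      where
      empty : ∀ ms → Within vs ms []
      empty []      = tt
      empty (_ ∷ _) = tt
    embed-sound vs d es (i ∷ is) (m ∷ ms) e
      with someV-true (spec vs) m vs continue (trans (cong (λ g → someV m g continue) (sym (matrix-spec vs d))) e)
      where
      continue : Row × Row → Bool
      continue v = embed (matrix vs) (triangular es is) (restrict (List.map (edge es i) is) ms v)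
    ... | w , at , rest
      with ws , pl , wi , len ← embed-sound vs d es is (restrict (List.map (edge es i) is) ms (spec vs w)) rest
      with a , b ← restrict-within vs es i is w ms ws wi len = w ∷ ws , (b , pl) , (at , a) , cong suc len

  Occurs : Edges → List ℕ → Set
  Occurs es is = Σ (ℕ → Fin n) λ f → (∀ {i} → i L.∈ is → f i ∈ X) ×
    (∀ {i j} → i L.∈ is → j L.∈ is → i ≢ j → f i ≢ f j × ad (f i) (f j) ≡ edge es i j)

  private
    assoc : Fin n → List ℕ → List (Fin n) → ℕ → Fin n
    assoc d (i ∷ is) (w ∷ ws) j with i ℕ.≟ j
    ... | yes _ = w
    ... | no _  = assoc d is ws j
    assoc d _ _ j = d

    assoc-ahead : ∀ d es i w is ws {j} → Ahead es i w is ws → j L.∈ is → ad w (assoc d is ws j) ≡ edge es i j × w ≢ assoc d is ws j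
    assoc-ahead d es i w (k ∷ is) (x ∷ ws) {j} (p , a) j∈ with k ℕ.≟ j | j∈
    ... | yes refl | _        = p
    ... | no ne    | here e   = contradiction (sym e) ne
    ... | no _     | there j∈′ = assoc-ahead d es i w is ws a j∈′

    placed⇒occurs : ∀ d es is ws → Placed es is ws → ∀ {i j} → i L.∈ is → j L.∈ is → i ≢ j →
      assoc d is ws i ≢ assoc d is ws j × ad (assoc d is ws i) (assoc d is ws j) ≡ edge es i j
    placed⇒occurs d es (k ∷ is) (w ∷ ws) (a , pl) {i} {j} i∈ j∈ ne with k ℕ.≟ i | k ℕ.≟ j | i∈ | j∈
    ... | yes refl | yes refl | _ | _ = contradiction refl ne
    ... | yes refl | no n     | _ | here e = contradiction (sym e) n
    ... | no n     | _        | here e | _ = contradiction (sym e) n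
    ... | no _     | no n     | there _ | here e = contradiction (sym e) n
    ... | yes refl | no _     | _ | there j∈′ = let p , q = assoc-ahead d es k w is ws a j∈′ in q , p
    ... | no _     | yes refl | there i∈′ | _ = let p , q = assoc-ahead d es k w is ws a i∈′ in
      q ∘ sym , trans (ad-sym _ w) (trans p (edge-sym es k i))
    ... | no _     | no _     | there i∈′ | there j∈′ = placed⇒occurs d es is ws pl i∈′ j∈′ ne

    at⇒∈ : ∀ {m vs w} → At m vs w → w L.∈ vs
    at⇒∈ here       = here refl
    at⇒∈ (there at) = there (at⇒∈ at)

    assoc∈ : ∀ d es is ws → Placed es is ws → ∀ {i} → i L.∈ is → assoc d is ws i L.∈ ws
    assoc∈ d es (k ∷ is) (w ∷ ws) (_ , pl) {i} i∈ with k ℕ.≟ i | i∈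
    ... | yes _ | _         = here refl
    ... | no ne | here e    = contradiction (sym e) ne
    ... | no _  | there i∈′ = there (assoc∈ d es is ws pl i∈′)

    within∈ : ∀ {vs} ms ws → Within vs ms ws → ∀ {w} → w L.∈ ws → w L.∈ vs
    within∈ (m ∷ ms) (w ∷ ws) (at , wi) (here refl) = at⇒∈ at
    within∈ (m ∷ ms) (w ∷ ws) (at , wi) (there w∈)  = within∈ ms ws wi w∈

  InX : List (Fin n) → Set
  InX vs = ∀ {v} → v L.∈ vs → v ∈ X

  arrange : ∀ es is w ws → Placed es is (w ∷ ws) → InX (w ∷ ws) → Occurs es is
  arrange es is w ws pl inX = assoc w is (w ∷ ws) , (λ i∈ → inX (assoc∈ w es is (w ∷ ws) pl i∈)) , placed⇒occurs w es is (w ∷ ws) pl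

  -- The place of the first vertex is returned as well, because the argument on long paths must know
  -- which vertex the new path begins its search with.
  embed⇒occurs : ∀ vs → Distinct vs → InX vs → ∀ es i is ms → embed (matrix vs) (triangular es (i ∷ is)) ms ≡ true →
    Σ (Occurs es (i ∷ is)) λ o → ∀ {m ms′} → ms ≡ m ∷ ms′ → At m vs (proj₁ o i)
  embed⇒occurs vs d inX es i is ms e with embed-sound vs d es (i ∷ is) ms e
  ... | w ∷ ws , pl , wi , _ =
    (assoc w (i ∷ is) (w ∷ ws) , (λ i∈ → inX (within∈ ms (w ∷ ws) wi (assoc∈ w es (i ∷ is) (w ∷ ws) pl i∈))) , placed⇒occurs w es (i ∷ is) (w ∷ ws) pl) ,
    λ { refl → first (proj₁ wi) }
    where
    first : ∀ {m} → At m vs w → At m vs (assoc w (i ∷ is) (w ∷ ws) i)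
    first at with i ℕ.≟ i
    ... | yes _ = at
    ... | no ne = contradiction refl ne

  Avoids : Pattern → Set
  Avoids p = ¬ Occurs (edges p) (List.upTo (order p))

  prune⇒⊥ : ∀ ps → (∀ {p} → p L.∈ ps → Avoids p × valid p ≡ true) → ∀ vs → Distinct vs → InX vs → prune ps (matrix vs) ≡ true → ⊥
  prune⇒⊥ ps av vs d inX e with anyL-true _ ps e
  ... | p , p∈ , e′ with anyL-true _ (orders p) e′ | av p∈
  ...   | i ∷ is , is∈ , occ | avoids , ok with embed⇒occurs vs d inX (edges p) i is
      (newest (matrix vs) ∷ List.map (λ _ → everything (matrix vs)) (triangular (edges p) is)) occ
  ...     | (f , f∈ , o) , _ = avoids (f , f∈ ∘ named , λ i∈ j∈ → o (named i∈) (named j∈))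
    where
    named : ∀ {j} → j L.∈ List.upTo (order p) → j L.∈ (i ∷ is)
    named {j} j∈ with anyL-true _ (i ∷ is) (allL-true _ (List.upTo (order p)) (allL-true _ (orders p) ok is∈) j∈)
    ... | k , k∈ , e rewrite ≡ᵇ-true j k e = k∈

  module Extend (ps : List Pattern) (avoids : ∀ {p} → p L.∈ ps → Avoids p × valid p ≡ true)
    (base : List (Fin n)) (base-distinct : Distinct base) (base∈ : InX base) where

    feasible∈ : ∀ {v} → v ∈ X → Apart v base → List.map (ad v) base L.∈ feasible ps (List.length base) (matrix base)
    feasible∈ {v} v∈ ap = keep∈ _ (rowsOf∈ (List.length base) (List.map (ad v) base) (length-map (ad v) base))
      (cong not (𝔹.¬-not (prune⇒⊥ ps avoids (v ∷ base) (ap , base-distinct) (λ { (here refl) → v∈ ; (there w∈) → base∈ w∈ }))))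

    module _ {K : Set} (row : K → Row) (rule : K → K → Bool → Bool) (kinds : List K) (X₀ : Sub n) (X₀⊆X : X₀ ⊆ X)
      (apart : ∀ {v} → v ∈ X₀ → Apart v base) (κ : Fin n → K) (κ∈ : ∀ {v} → v ∈ X₀ → κ v L.∈ kinds)
      (row-κ : ∀ {v} → v ∈ X₀ → row (κ v) ≡ List.map (ad v) base)
      (lawful : ∀ {u v} → u ∈ X₀ → v ∈ X₀ → u ≢ v → rule (κ u) (κ v) (ad u v) ≡ false) where

      open Refutation row rule ps kinds

      Satisfy : List (Fin n) → List Pred → List (Fin n) → Set
      Satisfy ws (p ∷ qs) (u ∷ us) = u ∈ X₀ × Apart u ws × p (κ u) (List.map (ad u) ws) (List.map κ ws) ≡ true × Satisfy (u ∷ ws) qs us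
      Satisfy ws []       []       = ⊤
      Satisfy ws _        _        = ⊥

      private
        unruled : ∀ u ws → u ∈ X₀ → (∀ {w} → w L.∈ ws → w ∈ X₀) → Apart u ws → ruled (κ u) (List.map (ad u) ws) (List.map κ ws) ≡ false
        unruled u []       u∈ ws∈ ap = refl
        unruled u (w ∷ ws) u∈ ws∈ ap = cong₂ _∨_ (lawful u∈ (ws∈ (here refl)) (ap (here refl))) (unruled u ws u∈ (ws∈ ∘ there) (ap ∘ there))

        apart-++ : ∀ {u} ws → Apart u ws → Apart u base → Apart u (ws ++ base)
        apart-++ []       a b w∈         = b w∈
        apart-++ (x ∷ ws) a b (here e)   = a (here e)
        apart-++ (x ∷ ws) a b (there w∈) = apart-++ ws (a ∘ there) b w∈

      refuted : ∀ qs ws → Distinct (ws ++ base) → (∀ {w} → w L.∈ ws → w ∈ X₀) → InX (ws ++ base) →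
        refute qs (matrix (ws ++ base)) (List.map κ ws) ≡ true → ∀ us → ¬ Satisfy ws qs us
      refuted (p ∷ qs) ws d ws∈ inX e (u ∷ us) (u∈ , ap , pu , rest) = go (∨-true first)
        where
        bs = List.map (ad u) ws
        ks = List.map κ ws
        g′ = addV (bs ++ row (κ u)) (matrix (ws ++ base))
        g′≡ : g′ ≡ matrix (u ∷ ws ++ base)
        g′≡ = cong (λ r → addV r (matrix (ws ++ base))) (trans (cong (bs ++_) (row-κ u∈)) (sym (map-++ (ad u) ws base)))
        inX′ : InX (u ∷ ws ++ base)
        inX′ (here refl) = X₀⊆X u∈
        inX′ (there w∈)  = inX w∈
        d′ : Distinct (u ∷ ws ++ base)
        d′ = apart-++ ws ap (apart u∈) , d
        first : prune ps g′ ∨ refute qs g′ (κ u ∷ ks) ≡ true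
        first with allBits-true (List.length ks) _ (allL-true _ kinds e (κ∈ u∈)) bs (trans (length-map (ad u) ws) (sym (length-map κ ws)))
        ... | x rewrite pu | unruled u ws u∈ ws∈ ap = x
        go : prune ps g′ ≡ true ⊎ refute qs g′ (κ u ∷ ks) ≡ true → ⊥
        go (inj₁ x) = prune⇒⊥ ps avoids (u ∷ ws ++ base) d′ inX′ (trans (cong (prune ps) (sym g′≡)) x)
        go (inj₂ x) = refuted qs (u ∷ ws) d′ (λ { (here refl) → u∈ ; (there w∈) → ws∈ w∈ }) inX′
          (trans (cong (λ g → refute qs g (κ u ∷ ks)) (sym g′≡)) x) us rest

      contradicts : ∀ qs → refute qs (matrix base) [] ≡ true → ∀ us → ¬ Satisfy [] qs us
      contradicts qs e us = refuted qs [] base-distinct (λ ()) base∈ e us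

  module Occurrence (es : Edges) (is : List ℕ) (uniq : Unique is) (occ : Occurs es is) where

    private
      f = proj₁ occ

      rows-agree : ∀ i js → i L.∈ is → (∀ {j} → j L.∈ js → j L.∈ is × i ≢ j) → List.map (ad (f i)) (List.map f js) ≡ List.map (edge es i) js
      rows-agree i []       i∈ js∈ = refl
      rows-agree i (j ∷ js) i∈ js∈ = let j∈ , ne = js∈ (here refl) in
        cong₂ _∷_ (proj₂ (proj₂ (proj₂ occ) i∈ j∈ ne)) (rows-agree i js i∈ (js∈ ∘ there))

      go : ∀ js → Unique js → (∀ {j} → j L.∈ js → j L.∈ is) → matrix (List.map f js) ≡ configuration es js
      go []       u js∈ = refl
      go (j ∷ js) (fresh ∷ u) js∈ = cong₂ addV (rows-agree j js (js∈ (here refl)) (λ k∈ → js∈ (there k∈) , All.lookup fresh k∈)) (go js u (js∈ ∘ there))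

      distinct : ∀ js → Unique js → (∀ {j} → j L.∈ js → j L.∈ is) → Distinct (List.map f js)
      distinct []       u js∈ = tt
      distinct (j ∷ js) (fresh ∷ u) js∈ = (λ {w} w∈ → let k , k∈ , e = ∈-map⁻ f w∈ in
        λ j≡w → proj₁ (proj₂ (proj₂ occ) (js∈ (here refl)) (js∈ (there k∈)) (All.lookup fresh k∈)) (trans j≡w e)) , distinct js u (js∈ ∘ there)

    image : List (Fin n)
    image = List.map f is

    -- The abstract base becomes a closed configuration, on which the checks can be evaluated.
    image-matrix : matrix image ≡ configuration es is
    image-matrix = go is uniq id

    image-distinct : Distinct image
    image-distinct = distinct is uniq id

    image∈ : InX image
    image∈ v∈ = let i , i∈ , e = ∈-map⁻ f v∈ in subst (_∈ X) (sym e) (proj₁ (proj₂ occ) i∈)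

-- Types over a base graph

_≟ᴿ_ : DecidableEquality Row
_≟ᴿ_ = ≡-dec 𝔹._≟_

eqᵇ : Bool → Bool → Bool
eqᵇ true  b = b
eqᵇ false b = not b

eqᴿ : Row → Row → Bool
eqᴿ []       []       = true
eqᴿ (x ∷ xs) (y ∷ ys) = eqᵇ x y ∧ eqᴿ xs ys
eqᴿ _        _        = false

eqᴿ-refl : ∀ r → eqᴿ r r ≡ true
eqᴿ-refl []          = refl
eqᴿ-refl (true ∷ r)  = eqᴿ-refl r
eqᴿ-refl (false ∷ r) = eqᴿ-refl r

eqᴿ-true : ∀ r s → eqᴿ r s ≡ true → r ≡ s
eqᴿ-true []          []          _ = refl
eqᴿ-true (true ∷ r)  (true ∷ s)  e = cong (true ∷_) (eqᴿ-true r s e)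
eqᴿ-true (false ∷ r) (false ∷ s) e = cong (false ∷_) (eqᴿ-true r s e)

eqᴿ-≡ : ∀ {r s} → r ≡ s → eqᴿ r s ≡ true
eqᴿ-≡ {r} refl = eqᴿ-refl r

eqᴿ-≢ : ∀ {r s} → r ≢ s → eqᴿ r s ≡ false
eqᴿ-≢ {r} {s} ne = 𝔹.¬-not (ne ∘ eqᴿ-true r s)

zeroᴿ : Row → Bool
zeroᴿ []       = true
zeroᴿ (b ∷ r) = not b ∧ zeroᴿ r

-- Rows read as binary numerals, least significant bit first.
code : Row → ℕ
code []          = 0
code (true ∷ r)  = 1 + 2 * code r
code (false ∷ r) = 2 * code r

stable : ∀ b → ¬ (b ≡ false) → b ≡ true
stable true  _ = refl
stable false f = contradiction refl f

module _ (ps : List Pattern) (base : Pattern) where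

  private
    g : Config
    g = configuration (edges base) (List.upTo (order base))

    module Plain (kinds : List Row) where
      open Refutation {K = Row} id (λ _ _ _ → false) ps kinds public

    kinds₀ : List Row
    kinds₀ = feasible ps (order base) g

  -- no vertex without neighbours in the base is adjacent to one with neighbours
  lonely-preds : List (Row → Row → List Row → Bool)
  lonely-preds = (λ t _ _ → zeroᴿ t) ∷ (λ { t (b ∷ _) _ → not (zeroᴿ t) ∧ b ; _ _ _ → false }) ∷ []

  no-lonely : Bool
  no-lonely = Plain.refute kinds₀ lonely-preds g []

  kinds-of : Bool → List Row
  kinds-of true  = keep (not ∘ zeroᴿ) kinds₀
  kinds-of false = kinds₀

  module TransitiveCheck (flips : Edges) where

    -- `flips` lists the pairs of types, by code, between which adjacency is complemented; `edge`
    -- makes the choice symmetric.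
    φ : Row → Row → Bool
    φ s t = edge flips (code s) (code t)

    indep-preds transitive-preds pair-preds : List (Row → Row → List Row → Bool)
    indep-preds = (λ _ _ _ → true) ∷ (λ { t (b ∷ _) (k ∷ _) → eqᴿ t k ∧ b ; _ _ _ → false }) ∷ []
    -- In each predicate the row and the list of types refer to the earlier new vertices, the latest
    -- one at the front.
    transitive-preds = (λ _ _ _ → true)
      ∷ (λ { v (b ∷ _) (u ∷ _) → not (eqᴿ u v) ∧ (b xor φ u v) ; _ _ _ → false })
      ∷ (λ { w (c ∷ a ∷ _) (v ∷ u ∷ _) → not (eqᴿ v w) ∧ not (eqᴿ u w) ∧ (c xor φ v w) ∧ not (a xor φ u w) ; _ _ _ → false })
      ∷ []
    pair-preds = (λ _ _ _ → true)
      ∷ (λ { z _ (y ∷ _) → eqᴿ y z ; _ _ _ → false })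
      ∷ (λ { d (e ∷ f ∷ _) (z ∷ y ∷ _) → not (eqᴿ y d) ∧ e ∧ not f ; _ _ _ → false })
      ∷ (λ { b (_ ∷ e ∷ f ∷ _) (d ∷ _) → eqᴿ b d ∧ not e ∧ f ; _ _ _ → false })
      ∷ (λ { b′ (_ ∷ _ ∷ e ∷ f ∷ _) (b ∷ _) → eqᴿ b b′ ∧ not e ∧ f ; _ _ _ → false })
      ∷ []

    transitive-check′ : List Row → Bool
    transitive-check′ kinds = Plain.refute kinds indep-preds g [] ∧ Plain.refute kinds transitive-preds g [] ∧ Plain.refute kinds pair-preds g []

    transitive-check : Bool → Bool
    transitive-check connected = transitive-check′ (kinds-of connected)

  module Around {n : ℕ} (ad : Matrix n) (ad-sym : ∀ u v → ad u v ≡ ad v u) (ad-irrefl : ∀ v → ad v v ≡ false) (X : Sub n)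
    (avoids : ∀ {p} → p L.∈ ps → Search.Avoids ad ad-sym ad-irrefl X p × valid p ≡ true)
    (occ : Search.Occurs ad ad-sym ad-irrefl X (edges base) (List.upTo (order base))) where

    open Search ad ad-sym ad-irrefl X

    bs : List (Fin n)
    bs = List.map (proj₁ occ) (List.upTo (order base))

    private
      is = List.upTo (order base)
      uniq : Unique is
      uniq = upTo⁺ (order base)

    bs-matrix : matrix bs ≡ g
    bs-matrix = Occurrence.image-matrix (edges base) is uniq occ
    bs-distinct : Distinct bs
    bs-distinct = Occurrence.image-distinct (edges base) is uniq occ
    bs∈ : InX bs
    bs∈ = Occurrence.image∈ (edges base) is uniq occ

    bs-length : List.length bs ≡ order base
    bs-length = trans (length-map (proj₁ occ) is) (length-upTo (order base))

    Bs : Sub n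
    Bs v = anyL (λ w → does (v F.≟ w)) bs

    ∈Bs : ∀ {v} → v ∈ Bs → v L.∈ bs
    ∈Bs {v} (mem e) = let w , w∈ , p = anyL-true _ bs e in subst (L._∈ bs) (sym (does⇒ (v F.≟ w) p)) w∈

    Bs∈ : ∀ {v} → v L.∈ bs → v ∈ Bs
    Bs∈ {v} v∈ = mem (go bs v∈)
      where
      go : ∀ ws → v L.∈ ws → anyL (λ w → does (v F.≟ w)) ws ≡ true
      go (w ∷ ws) (here refl) rewrite ⇒does (v F.≟ v) refl = refl
      go (w ∷ ws) (there v∈) rewrite go ws v∈ = 𝔹.∨-zeroʳ _

    X₀ : Sub n
    X₀ = X ∖ Bs

    X₀⊆X : X₀ ⊆ X
    X₀⊆X = proj₁ ∘ ∈∖ X Bs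

    apart : ∀ {v} → v ∈ X₀ → Apart v bs
    apart v∈ w∈ refl = proj₂ (∈∖ X Bs v∈) (Bs∈ w∈)

    typ : Fin n → Row
    typ v = List.map (ad v) bs

    typ-ad : ∀ {u v w} → w L.∈ bs → typ u ≡ typ v → ad u w ≡ ad v w
    typ-ad {u} {v} w∈ e = go bs w∈ e
      where
      go : ∀ ws {w} → w L.∈ ws → List.map (ad u) ws ≡ List.map (ad v) ws → ad u w ≡ ad v w
      go (w ∷ ws) (here refl) e = proj₁ (∷-injective e)
      go (w ∷ ws) (there w∈) e  = go ws w∈ (proj₂ (∷-injective e))

    typ∈ : ∀ {v} → v ∈ X₀ → typ v L.∈ kinds₀
    typ∈ {v} v∈ = subst (typ v L.∈_) (cong₂ (feasible ps) bs-length bs-matrix)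
      (Extend.feasible∈ ps avoids bs bs-distinct bs∈ (X₀⊆X v∈) (apart v∈))

    -- The label of a vertex includes its type, which determines its adjacency to every base vertex;
    -- base vertices can thus be peeled off without new classes.
    add-base : ∀ {L : Set} {τ : Fin n → L} {k} → (∀ {u v} → τ u ≡ τ v → typ u ≡ typ v) →
      (Inhabited X₀ → W ad τ (suc k) X₀) → Inhabited X → W ad τ (suc k) X
    add-base {τ = τ} {k} finer rest = go bs id X id X₀⊆X reach
      where
      reach : ∀ {v} → v ∈ X → v ∈ X₀ ⊎ v L.∈ bs
      reach {v} v∈ with v ∈? Bs
      ... | yes p = inj₂ (∈Bs p)
      ... | no p  = inj₁ (∖∈ X Bs v∈ p)
      go : ∀ ws → (∀ {w} → w L.∈ ws → w L.∈ bs) → ∀ Y → Y ⊆ X → X₀ ⊆ Y → (∀ {v} → v ∈ Y → v ∈ X₀ ⊎ v L.∈ ws) → Inhabited Y → W ad τ (suc k) Y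
      go [] ws∈ Y Y⊆ X₀⊆ cover (v , v∈) = let c , t = rest (v , back v∈) in c , tree-resp ad ad-sym back X₀⊆ t
        where
        back : Y ⊆ X₀
        back v∈ with cover v∈
        ... | inj₁ p = p
      go (w ∷ ws) ws∈ Y Y⊆ X₀⊆ cover inh with w ∈? Y
      ... | no w∉ = go ws (ws∈ ∘ there) Y Y⊆ X₀⊆ (λ v∈ → [ inj₁ , (λ { (here refl) → contradiction v∈ w∉ ; (there p) → inj₂ p }) ]′ (cover v∈)) inh
      ... | yes w∈ = peel Y w w∈
        (go ws (ws∈ ∘ there) (Y ∖ ⟨ w ⟩) (Y⊆ ∘ proj₁ ∘ ∈∖ Y ⟨ w ⟩)
          (λ v∈ → ∖∈ Y ⟨ w ⟩ (X₀⊆ v∈) (λ p → proj₂ (∈∖ X Bs v∈) (Bs∈ (subst (L._∈ bs) (sym (∈⟨⟩ p)) (ws∈ (here refl))))))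
          (λ v∈ → [ inj₁ , (λ { (here e) → contradiction (subst (_∈ ⟨ w ⟩) (sym e) (v∈⟨v⟩ w)) (proj₂ (∈∖ Y ⟨ w ⟩ v∈)) ; (there p) → inj₂ p }) ]′
            (cover (proj₁ (∈∖ Y ⟨ w ⟩ v∈)))))
        (λ {x} {x′} _ _ _ _ e → trans (ad-sym w x) (trans (typ-ad (ws∈ (here refl)) (finer e)) (ad-sym x′ w)))

    module _ {K : Set} (row : K → Row) (rule : K → K → Bool → Bool) (kinds : List K) (κ : Fin n → K) (κ∈ : ∀ {v} → v ∈ X₀ → κ v L.∈ kinds)
      (row-κ : ∀ {v} → v ∈ X₀ → row (κ v) ≡ typ v)
      (lawful : ∀ {u v} → u ∈ X₀ → v ∈ X₀ → u ≢ v → rule (κ u) (κ v) (ad u v) ≡ false) where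

      open Extend ps avoids bs bs-distinct bs∈ using () renaming (contradicts to contradicts₀; Satisfy to Satisfy₀)

      Sat : List (K → Row → List K → Bool) → List (Fin n) → Set
      Sat = Satisfy₀ row rule kinds X₀ X₀⊆X apart κ κ∈ row-κ lawful []

      refuted : ∀ qs → Refutation.refute row rule ps kinds qs g [] ≡ true → ∀ us → ¬ Sat qs us
      refuted qs e = contradicts₀ row rule kinds X₀ X₀⊆X apart κ κ∈ row-κ lawful qs
        (trans (cong (λ h → Refutation.refute row rule ps kinds qs h []) bs-matrix) e)

    module Plain′ (kinds : List Row) (typ∈′ : ∀ {v} → v ∈ X₀ → typ v L.∈ kinds) where

      Satᵖ : List (Row → Row → List Row → Bool) → List (Fin n) → Set
      Satᵖ = Sat id (λ _ _ _ → false) kinds typ typ∈′ (λ _ → refl) (λ _ _ _ → refl)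

      refutedᵖ : ∀ qs → Plain.refute kinds qs g [] ≡ true → ∀ us → ¬ Satᵖ qs us
      refutedᵖ = refuted id (λ _ _ _ → false) kinds typ typ∈′ (λ _ → refl) (λ _ _ _ → refl)

    -- By `no-lonely` the vertices without neighbours in the base form a closed set. It misses the
    -- base, which is non-empty, so connectedness leaves no such vertex.
    kinds-of∈ : ∀ connected → (connected ≡ true → Connected ad X × no-lonely ≡ true × 0 < order base) → ∀ {v} → v ∈ X₀ → typ v L.∈ kinds-of connected
    kinds-of∈ false _ v∈ = typ∈ v∈
    kinds-of∈ true  c {v} v∈ = keep∈ (not ∘ zeroᴿ) (typ∈ v∈) (cong not (𝔹.¬-not lonely))
      where
      conn = proj₁ (c refl)
      open Plain′ kinds₀ typ∈
      P? : ∀ v → Dec (v ∈ X₀ × zeroᴿ (typ v) ≡ true)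
      P? v = (v ∈? X₀) ×-dec (zeroᴿ (typ v) 𝔹.≟ true)
      S : Sub n
      S v = does (P? v)
      zero-ad : ∀ {u w} → w L.∈ bs → zeroᴿ (typ u) ≡ true → ad u w ≡ false
      zero-ad {u} w∈ z = go′ bs w∈ z
        where
        go′ : ∀ ws {w} → w L.∈ ws → zeroᴿ (List.map (ad u) ws) ≡ true → ad u w ≡ false
        go′ (w ∷ ws) (here refl) z with ad u w
        ... | false = refl
        go′ (w ∷ ws) (there w∈) z = go′ ws w∈ (proj₂ (∧-true {not (ad u w)} z))
      closed : Closed ad X S
      closed {u} {w} u∈ w∈ uw (mem p) with does⇒ (P? u) p | w ∈? Bs
      ... | u∈X₀ , z | yes w∈B = contradiction (trans (sym uw) (zero-ad (∈Bs w∈B) z)) λ ()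
      ... | u∈X₀ , z | no w∉B with zeroᴿ (typ w) 𝔹.≟ true
      ...   | yes z′ = mem (⇒does (P? w) (∖∈ X Bs w∈ w∉B , z′))
      ...   | no nz  = ⊥-elim (refutedᵖ lonely-preds (proj₁ (proj₂ (c refl))) (u ∷ w ∷ [])
        (u∈X₀ , (λ ()) , z , ∖∈ X Bs w∈ w∉B , (λ { (here refl) refl → nz z }) , cong₂ _∧_ (cong not (𝔹.¬-not nz)) (trans (ad-sym w u) uw) , tt))
      lonely : zeroᴿ (typ v) ≢ true
      lonely z = proj₂ (∈∖ X Bs (proj₁ (does⇒ (P? b) (holds (conn S closed (X₀⊆X v∈) (bs∈ b∈) (mem (⇒does (P? v) (v∈ , z)))))))) (Bs∈ b∈)
        where
        b : Fin n
        b = proj₁ occ 0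
        b∈ : b L.∈ bs
        b∈ = ∈-map⁺ (proj₁ occ) (∈-upTo⁺ (proj₂ (proj₂ (c refl))))

    module _ (flips : Edges) where
      open TransitiveCheck flips

      transitive-theorem : ∀ connected → (connected ≡ true → Connected ad X × no-lonely ≡ true × 0 < order base) →
        transitive-check connected ≡ true → Inhabited X → W ad typ 3 X
      transitive-theorem connected c check = add-base id (T.Transitive.transitive-tree φ (λ s t → edge-sym flips (code s) (code t)) trans-hyp id)
        where
        kinds = kinds-of connected
        open Plain′ kinds (kinds-of∈ connected c)
        checks = ∧-true {Plain.refute kinds indep-preds g []} check
        checks′ = ∧-true {Plain.refute kinds transitive-preds g []} (proj₂ checks)
        indep : ∀ {u v} → u ∈ X₀ → v ∈ X₀ → typ u ≡ typ v → ad u v ≡ false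
        indep {u} {v} u∈ v∈ e = 𝔹.¬-not λ uv → refutedᵖ indep-preds (proj₁ checks) (u ∷ v ∷ [])
          (u∈ , (λ ()) , refl , v∈ , (λ { (here refl) refl → contradiction (trans (sym uv) (ad-irrefl v)) λ () }) ,
            cong₂ _∧_ (eqᴿ-≡ (sym e)) (trans (ad-sym v u) uv) , tt)
        pair : ∀ {y z b b′ d} → y ∈ X₀ → z ∈ X₀ → b ∈ X₀ → b′ ∈ X₀ → d ∈ X₀ →
          typ y ≡ typ z → typ b ≡ typ b′ → typ b ≡ typ d → typ y ≢ typ b →
          ad y b ≡ true → ad y b′ ≡ true → b ≢ b′ → ad z d ≡ true → ad z b ≡ false → ad z b′ ≡ false → ad y d ≡ false → ⊥
        pair {y} {z} {b} {b′} {d} y∈ z∈ b∈ b′∈ d∈ yz bb′ bd yb yb₁ yb₂ ne zd zb zb′ yd =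
          refutedᵖ pair-preds (proj₂ checks′) (y ∷ z ∷ d ∷ b ∷ b′ ∷ [])
            ( y∈ , (λ ()) , refl
            , z∈ , (λ { (here refl) refl → contradiction (trans (sym yb₁) zb) λ () }) , eqᴿ-≡ yz
            , d∈ , (λ { (here refl) refl → yb (trans yz (sym bd)) ; (there (here refl)) refl → yb (sym bd) }) ,
              cong₂ _∧_ (cong not (eqᴿ-≢ (λ e → yb (trans e (sym bd))))) (cong₂ (λ x y → x ∧ not y) (trans (ad-sym d z) zd) (trans (ad-sym d y) yd))
            , b∈ , (λ { (here refl) refl → contradiction (trans (sym yb₁) yd) λ () ; (there (here refl)) refl → yb yz ; (there (there (here refl))) refl → yb refl }) ,
              cong₂ _∧_ (eqᴿ-≡ bd) (cong₂ (λ x y → not x ∧ y) (trans (ad-sym b z) zb) (trans (ad-sym b y) yb₁))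
            , b′∈ , (λ { (here refl) e → ne (sym e) ; (there (here refl)) refl → contradiction (trans (sym yb₂) yd) λ ()
                ; (there (there (here refl))) refl → yb (trans yz (sym bb′)) ; (there (there (there (here refl)))) refl → yb (sym bb′) }) ,
              cong₂ _∧_ (eqᴿ-≡ bb′) (cong₂ (λ x y → not x ∧ y) (trans (ad-sym b′ z) zb′) (trans (ad-sym b′ y) yb₂))
            , tt )
        trans-hyp : ∀ {u v w} → u ∈ X₀ → v ∈ X₀ → w ∈ X₀ → typ u ≢ typ v → typ v ≢ typ w → typ u ≢ typ w →
          ad u v xor φ (typ u) (typ v) ≡ true → ad v w xor φ (typ v) (typ w) ≡ true → ad u w xor φ (typ u) (typ w) ≡ true
        trans-hyp {u} {v} {w} u∈ v∈ w∈ uv vw uw euv evw = stable (ad u w xor φ (typ u) (typ w)) λ euw →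
          refutedᵖ transitive-preds (proj₁ checks′) (u ∷ v ∷ w ∷ [])
          ( u∈ , (λ ()) , refl
          , v∈ , (λ { (here refl) refl → uv refl }) , cong₂ _∧_ (cong not (eqᴿ-≢ uv)) (trans (cong (_xor φ (typ u) (typ v)) (ad-sym v u)) euv)
          , w∈ , (λ { (here refl) refl → vw refl ; (there (here refl)) refl → uw refl }) ,
            cong₂ _∧_ (cong not (eqᴿ-≢ vw)) (cong₂ _∧_ (cong not (eqᴿ-≢ uw)) (cong₂ (λ x y → x ∧ not y)
              (trans (cong (_xor φ (typ v) (typ w)) (ad-sym w v)) evw) (trans (cong (_xor φ (typ u) (typ w)) (ad-sym w u)) euw)))
          , tt )
        module T = Typed ad ad-sym X₀ _≟ᴿ_ typ indep pair typ id

eq₃ : Fin 3 → Fin 3 → Bool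
eq₃ i j = does (i F.≟ j)

eq₃-≡ : ∀ {i j} → i ≡ j → eq₃ i j ≡ true
eq₃-≡ {i} {j} = ⇒does (i F.≟ j)

eq₃-≢ : ∀ {i j} → i ≢ j → eq₃ i j ≡ false
eq₃-≢ {i} {j} ne with i F.≟ j
... | yes e = contradiction e ne
... | no _  = refl

nand : ∀ {a b} → not (a ∧ b) ≡ true → a ≡ true → b ≡ true → ⊥
nand {true} {true} () _ _

not-true : ∀ {a} → not a ≡ true → a ≡ false
not-true {false} _ = refl

-- Three classes defined from the types over a base and, for some types, from one bit recording the existence
-- of a vertex of a prescribed type and adjacency. The rule lists the pairs that do not occur for a vertex with that bit.

module _ (ps : List Pattern) (base : Pattern) where

  module CyclicCheck (witnesses : ℕ → List (ℕ × Bool)) (excluded : ℕ → ℕ → Bool → Bool) (lam : ℕ → Bool → Fin 3) where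

    private
      g : Config
      g = configuration (edges base) (List.upTo (order base))

    Kind : Set
    Kind = Row × Bool

    class : Kind → Fin 3
    class (t , x) = lam (code t) x

    match : Row → Row → Bool → Bool
    match s t b = anyL (λ { (c , b′) → (code t ℕ.≡ᵇ c) ∧ eqᵇ b b′ }) (witnesses (code s))

    -- The bit `false` says that no witness exists, so every matching pair violates it. With the bit
    -- `true` the violations are the pairs of the table `excluded`, which `witness-preds` certifies.
    half : Kind → Row → Bool → Bool
    half (s , false) t b = match s t b
    half (s , true)  t b = excluded (code s) (code t) b

    rule : Kind → Kind → Bool → Bool
    rule κ κ′ b = half κ (proj₁ κ′) b ∨ half κ′ (proj₁ κ) b

    with-bit : Row → List (ℕ × Bool) → List Kind
    with-bit t []      = []
    with-bit t (_ ∷ _) = (t , true) ∷ []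

    expand : List Row → List Kind
    expand []       = []
    expand (t ∷ ts) = (t , false) ∷ with-bit t (witnesses (code t)) ++ expand ts

    witness-preds : List (Row → Row → List Row → Bool)
    witness-preds = (λ _ _ _ → true)
      ∷ (λ { z (b ∷ _) (u ∷ _) → match u z b ; _ _ _ → false })
      ∷ (λ { v (_ ∷ b ∷ _) (_ ∷ u ∷ _) → excluded (code u) (code v) b ; _ _ _ → false })
      ∷ []

    Predᴷ : Set
    Predᴷ = Kind → Row → List Kind → Bool

    same-preds triangle-preds transversal-preds pairᴷ-preds : List Predᴷ
    same-preds = (λ _ _ _ → true) ∷ (λ { κ (b ∷ _) (k ∷ _) → eq₃ (class κ) (class k) ∧ b ; _ _ _ → false }) ∷ []
    triangle-preds = (λ κ _ _ → eq₃ (class κ) zero)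
      ∷ (λ { κ (b ∷ _) _ → eq₃ (class κ) (suc zero) ∧ b ; _ _ _ → false })
      ∷ (λ { κ (b ∷ c ∷ _) _ → eq₃ (class κ) (suc (suc zero)) ∧ b ∧ c ; _ _ _ → false }) ∷ []
    transversal-preds = (λ κ _ _ → eq₃ (class κ) zero)
      ∷ (λ { κ (b ∷ _) _ → eq₃ (class κ) (suc zero) ∧ not b ; _ _ _ → false })
      ∷ (λ { κ (b ∷ c ∷ _) _ → eq₃ (class κ) (suc (suc zero)) ∧ not b ∧ not c ; _ _ _ → false }) ∷ []
    pairᴷ-preds = (λ _ _ _ → true)
      ∷ (λ { z _ (y ∷ _) → eq₃ (class y) (class z) ; _ _ _ → false })
      ∷ (λ { d (e ∷ f ∷ _) (z ∷ y ∷ _) → not (eq₃ (class y) (class d)) ∧ e ∧ not f ; _ _ _ → false })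
      ∷ (λ { b (_ ∷ e ∷ f ∷ _) (d ∷ _) → eq₃ (class b) (class d) ∧ not e ∧ f ; _ _ _ → false })
      ∷ (λ { b′ (_ ∷ _ ∷ e ∷ f ∷ _) (b ∷ _) → eq₃ (class b) (class b′) ∧ not e ∧ f ; _ _ _ → false })
      ∷ []

    unharmed : Row → Row → Bool → Bool
    unharmed s t b = not (match s t b ∧ excluded (code s) (code t) b)

    -- The search places distinct vertices only. The two coincidences are covered here: a vertex
    -- that would be its own witness, and a witness that would itself form an excluded pair.
    consistent : List Row → Bool
    consistent ts = allL (λ s → not (match s s false) ∧ allL (λ t → unharmed s t true ∧ unharmed s t false) ts) ts

    cyclic-check′ : List Row → List Kind → Bool
    cyclic-check′ ts ks = consistent ts ∧ Refutation.refute id (λ _ _ _ → false) ps ts witness-preds g [] ∧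
      Refutation.refute proj₁ rule ps ks same-preds g [] ∧ Refutation.refute proj₁ rule ps ks triangle-preds g [] ∧
      Refutation.refute proj₁ rule ps ks transversal-preds g [] ∧ Refutation.refute proj₁ rule ps ks pairᴷ-preds g []

    cyclic-check : Bool
    cyclic-check = cyclic-check′ (kinds-of ps base true) (expand (kinds-of ps base true))

    module _ {n : ℕ} (ad : Matrix n) (ad-sym : ∀ u v → ad u v ≡ ad v u) (ad-irrefl : ∀ v → ad v v ≡ false) (X : Sub n)
      (avoids : ∀ {p} → p L.∈ ps → Search.Avoids ad ad-sym ad-irrefl X p × valid p ≡ true)
      (occ : Search.Occurs ad ad-sym ad-irrefl X (edges base) (List.upTo (order base))) where

      open Around ps base ad ad-sym ad-irrefl X avoids occ

      private
        hit? : ∀ v → Dec (∃ λ z → z ∈ X₀ × match (typ v) (typ z) (ad v z) ≡ true)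
        hit? v = F.any? (λ z → (z ∈? X₀) ×-dec (match (typ v) (typ z) (ad v z) 𝔹.≟ true))

        bit : Fin n → Bool
        bit v = does (hit? v)

      kind : Fin n → Kind
      kind v = typ v , bit v

      cyclic-theorem : Connected ad X → no-lonely ps base ≡ true → 0 < order base → cyclic-check ≡ true → Inhabited X → W ad kind 3 X
      cyclic-theorem conn lonely nonempty check = add-base (cong proj₁) (C.cyclic-tree id)
        where
        ts = kinds-of ps base true
        ks = expand ts
        typ∈ts : ∀ {v} → v ∈ X₀ → typ v L.∈ ts
        typ∈ts = kinds-of∈ true (λ _ → conn , lonely , nonempty)
        c₁ = ∧-true {consistent ts} check
        c₂ = ∧-true {Refutation.refute id (λ _ _ _ → false) ps ts witness-preds g []} (proj₂ c₁)
        c₃ = ∧-true {Refutation.refute proj₁ rule ps ks same-preds g []} (proj₂ c₂)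
        c₄ = ∧-true {Refutation.refute proj₁ rule ps ks triangle-preds g []} (proj₂ c₃)
        c₅ = ∧-true {Refutation.refute proj₁ rule ps ks transversal-preds g []} (proj₂ c₄)

        open Plain′ ts typ∈ts

        with-bit∈ : ∀ {s t b} l → anyL (λ { (c , b′) → (code t ℕ.≡ᵇ c) ∧ eqᵇ b b′ }) l ≡ true → (s , true) L.∈ with-bit s l
        with-bit∈ (_ ∷ _) _ = here refl

        expand∈ : ∀ {t x} l → t L.∈ l → (x ≡ true → (t , true) L.∈ with-bit t (witnesses (code t))) → (t , x) L.∈ expand l
        expand∈ {x = false} (t ∷ l) (here refl) f = here refl
        expand∈ {x = true}  (t ∷ l) (here refl) f = there (∈-++⁺ˡ (f refl))
        expand∈ (t ∷ l) (there t∈) f = there (∈-++⁺ʳ (with-bit t (witnesses (code t))) (expand∈ l t∈ f))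

        kind∈ : ∀ {v} → v ∈ X₀ → kind v L.∈ ks
        kind∈ {v} v∈ = expand∈ ts (typ∈ts v∈) λ e → let z , _ , m = does⇒ (hit? v) e in
          with-bit∈ {typ v} {typ z} {ad v z} (witnesses (code (typ v))) m

        unharmed-at : ∀ {s t} → s L.∈ ts → t L.∈ ts → ∀ b → unharmed s t b ≡ true
        unharmed-at {s} {t} s∈ t∈ b = at b (∧-true {unharmed s t true} (allL-true _ ts (proj₂ (∧-true {not (match s s false)} (allL-true _ ts (proj₁ c₁) s∈))) t∈))
          where
          at : ∀ b → unharmed s t true ≡ true × unharmed s t false ≡ true → unharmed s t b ≡ true
          at true  = proj₁
          at false = proj₂

        half-false : ∀ {u v} → u ∈ X₀ → v ∈ X₀ → u ≢ v → half (kind u) (typ v) (ad u v) ≡ false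
        half-false {u} {v} u∈ v∈ ne = go (hit? u) refl
          where
          go : (d : Dec (∃ λ z → z ∈ X₀ × match (typ u) (typ z) (ad u z) ≡ true)) → bit u ≡ does d → half (typ u , does d) (typ v) (ad u v) ≡ false
          go (no none) _ = 𝔹.¬-not λ m → none (v , v∈ , m)
          go (yes (z , z∈ , m)) _ = 𝔹.¬-not (clash (z F.≟ v))
            where
            clash : Dec (z ≡ v) → excluded (code (typ u)) (code (typ v)) (ad u v) ≢ true
            clash (yes refl) ex = nand (unharmed-at (typ∈ts u∈) (typ∈ts v∈) (ad u v)) m ex
            clash (no z≢v) ex = refutedᵖ witness-preds (proj₁ c₂) (u ∷ z ∷ v ∷ [])
              ( u∈ , (λ ()) , refl
              , z∈ , (λ { (here refl) e → z≢u e }) , trans (cong (match (typ u) (typ z)) (ad-sym z u)) m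
              , v∈ , (λ { (here refl) e → z≢v (sym e) ; (there (here refl)) e → ne (sym e) }) ,
                trans (cong (excluded (code (typ u)) (code (typ v))) (ad-sym v u)) ex
              , tt )
              where
              z≢u : z ≢ u
              z≢u refl = contradiction (trans (sym (cong (match (typ u) (typ u)) (ad-irrefl u))) m)
                (𝔹.not-¬ (not-true (proj₁ (∧-true (allL-true _ ts (proj₁ c₁) (typ∈ts u∈))))))

        lawful : ∀ {u v} → u ∈ X₀ → v ∈ X₀ → u ≢ v → rule (kind u) (kind v) (ad u v) ≡ false
        lawful {u} {v} u∈ v∈ ne = cong₂ _∨_ (half-false u∈ v∈ ne)
          (trans (cong (half (kind v) (typ u)) (ad-sym u v)) (half-false v∈ u∈ (ne ∘ sym)))

        refutedᴷ : ∀ qs → Refutation.refute proj₁ rule ps ks qs g [] ≡ true → ∀ us → ¬ Sat proj₁ rule ks kind kind∈ (λ _ → refl) lawful qs us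
        refutedᴷ = refuted proj₁ rule ks kind kind∈ (λ _ → refl) lawful

        cls : Fin n → Fin 3
        cls = class ∘ kind

        differ : ∀ {u v i j} → cls u ≡ i → cls v ≡ j → i ≢ j → u ≢ v
        differ p q ne refl = ne (trans (sym p) q)

        indep : ∀ {u v} → u ∈ X₀ → v ∈ X₀ → cls u ≡ cls v → ad u v ≡ false
        indep {u} {v} u∈ v∈ e = 𝔹.¬-not λ uv → refutedᴷ same-preds (proj₁ c₃) (u ∷ v ∷ [])
          (u∈ , (λ ()) , refl , v∈ , (λ { (here refl) refl → contradiction (trans (sym uv) (ad-irrefl v)) λ () }) ,
            cong₂ _∧_ (eq₃-≡ (sym e)) (trans (ad-sym v u) uv) , tt)

        no-triangle : ∀ {u v w} → u ∈ X₀ → v ∈ X₀ → w ∈ X₀ → cls u ≡ zero → cls v ≡ suc zero → cls w ≡ suc (suc zero) →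
          ad u v ≡ true → ad v w ≡ true → ad u w ≡ true → ⊥
        no-triangle {u} {v} {w} u∈ v∈ w∈ u0 v1 w2 uv vw uw = refutedᴷ triangle-preds (proj₁ c₄) (u ∷ v ∷ w ∷ [])
          ( u∈ , (λ ()) , eq₃-≡ u0
          , v∈ , (λ { (here refl) → differ v1 u0 λ () }) , cong₂ _∧_ (eq₃-≡ v1) (trans (ad-sym v u) uv)
          , w∈ , (λ { (here refl) → differ w2 v1 λ () ; (there (here refl)) → differ w2 u0 λ () }) ,
            cong₂ _∧_ (eq₃-≡ w2) (cong₂ _∧_ (trans (ad-sym w v) vw) (trans (ad-sym w u) uw)) , tt )

        no-transversal : ∀ {u v w} → u ∈ X₀ → v ∈ X₀ → w ∈ X₀ → cls u ≡ zero → cls v ≡ suc zero → cls w ≡ suc (suc zero) →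
          ad u v ≡ false → ad v w ≡ false → ad u w ≡ false → ⊥
        no-transversal {u} {v} {w} u∈ v∈ w∈ u0 v1 w2 uv vw uw = refutedᴷ transversal-preds (proj₁ c₅) (u ∷ v ∷ w ∷ [])
          ( u∈ , (λ ()) , eq₃-≡ u0
          , v∈ , (λ { (here refl) → differ v1 u0 λ () }) , cong₂ _∧_ (eq₃-≡ v1) (cong not (trans (ad-sym v u) uv))
          , w∈ , (λ { (here refl) → differ w2 v1 λ () ; (there (here refl)) → differ w2 u0 λ () }) ,
            cong₂ _∧_ (eq₃-≡ w2) (cong₂ _∧_ (cong not (trans (ad-sym w v) vw)) (cong not (trans (ad-sym w u) uw))) , tt )

        pair : ∀ {y z b b′ d} → y ∈ X₀ → z ∈ X₀ → b ∈ X₀ → b′ ∈ X₀ → d ∈ X₀ →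
          cls y ≡ cls z → cls b ≡ cls b′ → cls b ≡ cls d → cls y ≢ cls b →
          ad y b ≡ true → ad y b′ ≡ true → b ≢ b′ → ad z d ≡ true → ad z b ≡ false → ad z b′ ≡ false → ad y d ≡ false → ⊥
        pair {y} {z} {b} {b′} {d} y∈ z∈ b∈ b′∈ d∈ yz bb′ bd yb yb₁ yb₂ ne zd zb zb′ yd =
          refutedᴷ pairᴷ-preds (proj₂ c₅) (y ∷ z ∷ d ∷ b ∷ b′ ∷ [])
            ( y∈ , (λ ()) , refl
            , z∈ , (λ { (here refl) refl → contradiction (trans (sym yb₁) zb) λ () }) , eq₃-≡ yz
            , d∈ , (λ { (here refl) refl → yb (trans yz (sym bd)) ; (there (here refl)) refl → yb (sym bd) }) ,
              cong₂ _∧_ (cong not (eq₃-≢ (λ e → yb (trans e (sym bd))))) (cong₂ (λ x y → x ∧ not y) (trans (ad-sym d z) zd) (trans (ad-sym d y) yd))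
            , b∈ , (λ { (here refl) refl → contradiction (trans (sym yb₁) yd) λ () ; (there (here refl)) refl → yb yz ; (there (there (here refl))) refl → yb refl }) ,
              cong₂ _∧_ (eq₃-≡ bd) (cong₂ (λ x y → not x ∧ y) (trans (ad-sym b z) zb) (trans (ad-sym b y) yb₁))
            , b′∈ , (λ { (here refl) e → ne (sym e) ; (there (here refl)) refl → contradiction (trans (sym yb₂) yd) λ ()
                ; (there (there (here refl))) refl → yb (trans yz (sym bb′)) ; (there (there (there (here refl)))) refl → yb (sym bb′) }) ,
              cong₂ _∧_ (eq₃-≡ bb′) (cong₂ (λ x y → not x ∧ y) (trans (ad-sym b′ z) zb′) (trans (ad-sym b′ y) yb₂))
            , tt )

        module C = Cyclic ad ad-sym X₀ cls indep pair no-triangle no-transversal kind (cong class)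

-- Numbers of classes, and the case distinction on occurring patterns

bit : Bool → Fin 2
bit false = zero
bit true  = suc zero

bit-injective : ∀ {a b} → bit a ≡ bit b → a ≡ b
bit-injective {false} {false} _ = refl
bit-injective {true}  {true}  _ = refl

index : ∀ m → Row → Fin (2 ^ m)
index zero    _       = zero
index (suc m) []      = combine {2} zero (index m [])
index (suc m) (b ∷ r) = combine (bit b) (index m r)

index-injective : ∀ m {r s} → List.length r ≡ m → List.length s ≡ m → index m r ≡ index m s → r ≡ s
index-injective zero    {[]}    {[]}    _ _ _ = refl
index-injective (suc m) {b ∷ r} {c ∷ s} p q e =
  let e₁ , e₂ = F.combine-injective (bit b) (index m r) (bit c) (index m s) e in
  cong₂ _∷_ (bit-injective e₁) (index-injective m (ℕ.suc-injective p) (ℕ.suc-injective q) e₂)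

-- 768 = 2 · 2⁷ · 3: one bit and the adjacencies to seven base vertices, for each of three classes.
Narrow : ∀ {n} → Matrix n → Sub n → Set
Narrow ad X = W ad (λ _ → tt) 768 X

module Cases {n : ℕ} (ad : Matrix n) (ad-sym : ∀ u v → ad u v ≡ ad v u) (ad-irrefl : ∀ v → ad v v ≡ false) (X : Sub n) where

  open Search ad ad-sym ad-irrefl X

  Occurrence-of : Pattern → Set
  Occurrence-of p = Occurs (edges p) (List.upTo (order p))

  Avoiding : List Pattern → Set
  Avoiding ps = ∀ {p} → p L.∈ ps → Avoids p × valid p ≡ true

  infixr 5 _▷_
  _▷_ : ∀ {p ps} → Avoids p × valid p ≡ true → Avoiding ps → Avoiding (p ∷ ps)
  (a ▷ as) (here refl) = a
  (a ▷ as) (there p∈)  = as p∈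

  none : Avoiding []
  none ()

  occurrence? : Inhabited X → ∀ p → Dec (Occurrence-of p)
  occurrence? (d , _) p = Dec.map′ (λ (i , g) → to (finToFun i) g) from (F.any? λ i → good? (finToFun {n} {m} i))
    where
    m = order p
    Good : (Fin m → Fin n) → Set
    Good g = (∀ i → g i ∈ X) × (∀ i j → i ≢ j → g i ≢ g j × ad (g i) (g j) ≡ edge (edges p) (toℕ i) (toℕ j))
    good? : ∀ g → Dec (Good g)
    good? g = F.all? (λ i → g i ∈? X) ×-dec F.all? (λ i → F.all? λ j → ¬? (i F.≟ j) →-dec (¬? (g i F.≟ g j) ×-dec (ad (g i) (g j) 𝔹.≟ edge (edges p) (toℕ i) (toℕ j))))
    extend : (Fin m → Fin n) → ∀ k → Dec (k < m) → Fin n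
    extend g k (yes k<m) = g (F.fromℕ< k<m)
    -- An occurrence is a total function on names; those from `m` onwards are unconstrained and
    -- receive the given inhabitant of `X`.
    extend g k (no _)    = d
    extend-≡ : ∀ g {k} (d : Dec (k < m)) (k<m : k < m) → extend g k d ≡ g (F.fromℕ< k<m)
    extend-≡ g {k} (yes p) k<m = cong g (F.fromℕ<-cong k k refl p k<m)
    extend-≡ g (no ¬p) k<m = contradiction k<m ¬p
    to : ∀ g → Good g → Occurrence-of p
    to g (g∈ , ok) = f , (λ {i} i∈ → subst (_∈ X) (sym (f≡ i∈)) (g∈ (at i∈))) , rel
      where
      f : ℕ → Fin n
      f k = extend g k (k ℕ.<? m)
      at : ∀ {k} → k L.∈ List.upTo m → Fin m
      at k∈ = F.fromℕ< (∈-upTo⁻ k∈)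
      f≡ : ∀ {k} (k∈ : k L.∈ List.upTo m) → f k ≡ g (at k∈)
      f≡ {k} k∈ = extend-≡ g (k ℕ.<? m) (∈-upTo⁻ k∈)
      toℕ-at : ∀ {k} (k∈ : k L.∈ List.upTo m) → toℕ (at k∈) ≡ k
      toℕ-at k∈ = F.toℕ-fromℕ< (∈-upTo⁻ k∈)
      rel : ∀ {i j} → i L.∈ List.upTo m → j L.∈ List.upTo m → i ≢ j → f i ≢ f j × ad (f i) (f j) ≡ edge (edges p) i j
      rel i∈ j∈ ne = let a , b = ok (at i∈) (at j∈) (λ e → ne (trans (sym (toℕ-at i∈)) (trans (cong toℕ e) (toℕ-at j∈)))) in
        (λ e → a (trans (sym (f≡ i∈)) (trans e (f≡ j∈)))) ,
        trans (cong₂ ad (f≡ i∈) (f≡ j∈)) (trans b (cong₂ (edge (edges p)) (toℕ-at i∈) (toℕ-at j∈)))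
    from : Occurrence-of p → ∃ λ i → Good (finToFun {n} {m} i)
    from (f , f∈ , ok) = funToFin {m} {n} (f ∘ toℕ) ,
      (λ i → subst (_∈ X) (sym (F.finToFun-funToFin (f ∘ toℕ) i)) (f∈ (named i))) ,
      λ i j ne → let a , b = ok (named i) (named j) (ne ∘ F.toℕ-injective) ; p = F.finToFun-funToFin (f ∘ toℕ) i ; q = F.finToFun-funToFin (f ∘ toℕ) j in
        (λ e → a (trans (sym p) (trans e q))) , trans (cong₂ ad p q) b
      where
      named : ∀ (i : Fin m) → toℕ i L.∈ List.upTo m
      named i = ∈-upTo⁺ (F.toℕ<n i)

  either : Inhabited X → ∀ p → valid p ≡ true → ∀ {A : Set} → (Occurrence-of p → A) → (Avoids p × valid p ≡ true → A) → A
  either inh p v yes-case no-case with occurrence? inh p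
  ... | yes o = yes-case o
  ... | no a  = no-case (a , v)

  -- prune finds only occurrences through the newest vertex, which is the vertex 0 here.
  avoids-larger : ∀ ps → Avoiding ps → ∀ p → prune ps (configuration (edges p) (List.upTo (order p))) ≡ true → Avoids p
  avoids-larger ps av p e occ = prune⇒⊥ ps av image image-distinct image∈ (trans (cong (prune ps) image-matrix) e)
    where open Occurrence (edges p) (List.upTo (order p)) (upTo⁺ (order p)) occ

  module _ (ps : List Pattern) (base : Pattern) (small : order base ≤ 7) (nonempty : 0 < order base) (connected : Connected ad X) (inh : Inhabited X)
    (av : Avoiding ps) (occ : Occurrence-of base) where

    open Around ps base ad ad-sym ad-irrefl X av occ

    private
      m = order base

      typ-length : ∀ v → List.length (typ v) ≡ m
      typ-length v = trans (length-map (ad v) bs) (trans (length-map (proj₁ occ) (List.upTo m)) (length-upTo m))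

      key : Fin n → Fin (2 ^ m)
      key v = index m (typ v)

      key-typ : ∀ {u v} → key u ≡ key v → typ u ≡ typ v
      key-typ {u} {v} = index-injective m (typ-length u) (typ-length v)

      bound : 2 ^ m * 3 ≤ 2 ^ 7 * 3
      bound = ℕ.*-monoˡ-≤ 3 (ℕ.^-monoʳ-≤ 2 small)

    transitive-case : ∀ flips c → (c ≡ true → no-lonely ps base ≡ true) → TransitiveCheck.transitive-check ps base flips c ≡ true → Narrow ad X
    transitive-case flips c lonely check = more-classes (ℕ.≤-trans bound (ℕ.≤ᵇ⇒≤ _ _ tt))
      (absorb-labels key key-typ (transitive-theorem flips c (λ e → connected , lonely e , nonempty) check inh))

    cyclic-case : ∀ witnesses excluded lam → no-lonely ps base ≡ true → CyclicCheck.cyclic-check ps base witnesses excluded lam ≡ true → Narrow ad X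
    cyclic-case witnesses excluded lam lonely check = more-classes
      (ℕ.≤-trans (ℕ.≤-reflexive (ℕ.*-assoc 2 (2 ^ m) 3)) (ℕ.≤-trans (ℕ.*-monoʳ-≤ 2 bound) (ℕ.≤ᵇ⇒≤ _ _ tt)))
      (absorb-labels (λ v → combine (bit (proj₂ (kind v))) (key v)) finer (cyclic-theorem connected lonely nonempty check inh))
      where
      kind = CyclicCheck.kind ps base witnesses excluded lam ad ad-sym ad-irrefl X av occ
      finer : ∀ {u v} → combine (bit (proj₂ (kind u))) (key u) ≡ combine (bit (proj₂ (kind v))) (key v) → kind u ≡ kind v
      finer {u} {v} e = let p , q = F.combine-injective (bit (proj₂ (kind u))) (key u) (bit (proj₂ (kind v))) (key v) e in
        cong₂ _,_ (key-typ q) (bit-injective p)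
      cyclic-theorem = CyclicCheck.cyclic-theorem ps base witnesses excluded lam ad ad-sym ad-irrefl X av occ

occurrence⇒⊴ : ∀ {m n} (H : Graph m) (G : Graph n) (adᵇ-sym : ∀ u v → adjᵇ G u v ≡ adjᵇ G v u) (irr : ∀ v → adjᵇ G v v ≡ false) (X : Sub n) es →
  does (F.all? λ u → F.all? λ v → edge es (toℕ u) (toℕ v) 𝔹.≟ adjᵇ H u v) ≡ true →
  Search.Occurs (adjᵇ G) adᵇ-sym irr X es (List.upTo m) → H ⊴ G
occurrence⇒⊴ {m} H G adᵇ-sym irr X es check (f , _ , ok) = f ∘ toℕ , injective , λ u v → adjacent u v (u F.≟ v)
  where
  open Graph
  named : ∀ (i : Fin m) → toℕ i L.∈ List.upTo m
  named i = ∈-upTo⁺ (F.toℕ<n i)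
  injective : Injective _≡_ _≡_ (f ∘ toℕ)
  injective {u} {v} e with u F.≟ v
  ... | yes p = p
  ... | no ne = contradiction e (proj₁ (ok (named u) (named v) (ne ∘ F.toℕ-injective)))
  same : ∀ u v → u ≢ v → adjᵇ H u v ≡ adjᵇ G (f (toℕ u)) (f (toℕ v))
  same u v ne = trans (sym (does⇒ (F.all? _) check u v)) (sym (proj₂ (ok (named u) (named v) (ne ∘ F.toℕ-injective))))
  adjacent : ∀ u v → Dec (u ≡ v) → Adj H u v ⇔ Adj G (f (toℕ u)) (f (toℕ v))
  adjacent u v (yes refl) = mk⇔ (λ e → contradiction e (adj-irrefl H)) (λ e → contradiction e (adj-irrefl G))
  adjacent u v (no ne)    = mk⇔
    (λ e → does⇒ (adj? G _ _) (trans (sym (same u v ne)) (⇒does (adj? H u v) e)))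
    (λ e → does⇒ (adj? H u v) (trans (same u v ne) (⇒does (adj? G _ _) e)))

-- The patterns

-- The four special bases extend a pentagon. `e₁` adds to the pentagon 1 2 6 3 5 a twin 4 of 3 and a
-- pendant vertex 0 at 4. `e₂` consists of three paths of lengths 2, 3, 3 between 5 and 6, so two
-- pentagons share the path 5 4 6. `e₃` and `e₄` contain the pentagon 2 3 5 6 4: `e₃` has the
-- pendant path 1 0 at 6, and `e₄` has pendant vertices at the adjacent vertices 5 and 6. For `p₈`
-- there are no orders because it is excluded through the smaller patterns that it contains.
triangle p₁p₅ s₁₂₂ p₁p₂p₃ p₇ p₈ pentagon heptagon e₁ e₂ e₃ e₄ : Pattern
triangle = record { order = 3 ; edges = (0 , 1) ∷ (1 , 2) ∷ (0 , 2) ∷ [] ; orders = (0 ∷ 1 ∷ 2 ∷ []) ∷ [] }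
p₁p₅ = record { order = 6 ; edges = (1 , 2) ∷ (2 , 3) ∷ (3 , 4) ∷ (4 , 5) ∷ [] ; orders =
  (0 ∷ 1 ∷ 2 ∷ 3 ∷ 4 ∷ 5 ∷ []) ∷ (1 ∷ 2 ∷ 3 ∷ 4 ∷ 5 ∷ 0 ∷ []) ∷ (2 ∷ 1 ∷ 3 ∷ 4 ∷ 5 ∷ 0 ∷ []) ∷ (3 ∷ 2 ∷ 4 ∷ 1 ∷ 5 ∷ 0 ∷ []) ∷ [] }
s₁₂₂ = record { order = 6 ; edges = (0 , 1) ∷ (0 , 2) ∷ (2 , 3) ∷ (0 , 4) ∷ (4 , 5) ∷ [] ; orders =
  (0 ∷ 2 ∷ 4 ∷ 1 ∷ 3 ∷ 5 ∷ []) ∷ (1 ∷ 0 ∷ 2 ∷ 4 ∷ 3 ∷ 5 ∷ []) ∷ (2 ∷ 0 ∷ 3 ∷ 1 ∷ 4 ∷ 5 ∷ []) ∷ (3 ∷ 2 ∷ 0 ∷ 1 ∷ 4 ∷ 5 ∷ []) ∷ [] }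
p₁p₂p₃ = record { order = 6 ; edges = (1 , 2) ∷ (3 , 4) ∷ (4 , 5) ∷ [] ; orders =
  (0 ∷ 1 ∷ 2 ∷ 4 ∷ 3 ∷ 5 ∷ []) ∷ (1 ∷ 2 ∷ 4 ∷ 3 ∷ 5 ∷ 0 ∷ []) ∷ (3 ∷ 4 ∷ 5 ∷ 1 ∷ 2 ∷ 0 ∷ []) ∷ (4 ∷ 3 ∷ 5 ∷ 1 ∷ 2 ∷ 0 ∷ []) ∷ [] }
p₇ = record { order = 7 ; edges = (0 , 1) ∷ (1 , 2) ∷ (2 , 3) ∷ (3 , 4) ∷ (4 , 5) ∷ (5 , 6) ∷ [] ; orders = (0 ∷ 1 ∷ 2 ∷ 3 ∷ 4 ∷ 5 ∷ 6 ∷ []) ∷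
  (1 ∷ 0 ∷ 2 ∷ 3 ∷ 4 ∷ 5 ∷ 6 ∷ []) ∷ (2 ∷ 1 ∷ 0 ∷ 3 ∷ 4 ∷ 5 ∷ 6 ∷ []) ∷ (3 ∷ 2 ∷ 1 ∷ 0 ∷ 4 ∷ 5 ∷ 6 ∷ []) ∷ [] }
p₈ = record { order = 8 ; edges = (0 , 1) ∷ (1 , 2) ∷ (2 , 3) ∷ (3 , 4) ∷ (4 , 5) ∷ (5 , 6) ∷ (6 , 7) ∷ [] ; orders = [] }
pentagon = record { order = 5 ; edges = (0 , 1) ∷ (1 , 2) ∷ (2 , 3) ∷ (3 , 4) ∷ (4 , 0) ∷ [] ; orders = (0 ∷ 1 ∷ 2 ∷ 3 ∷ 4 ∷ []) ∷ [] }
heptagon = record { order = 7 ; edges = (0 , 1) ∷ (1 , 2) ∷ (2 , 3) ∷ (3 , 4) ∷ (4 , 5) ∷ (5 , 6) ∷ (6 , 0) ∷ [] ; orders = (0 ∷ 1 ∷ 2 ∷ 3 ∷ 4 ∷ 5 ∷ 6 ∷ []) ∷ [] }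

roots₇ : List (List ℕ)
roots₇ = (0 ∷ 1 ∷ 2 ∷ 3 ∷ 4 ∷ 5 ∷ 6 ∷ []) ∷ (1 ∷ 0 ∷ 2 ∷ 3 ∷ 4 ∷ 5 ∷ 6 ∷ []) ∷ (2 ∷ 0 ∷ 1 ∷ 3 ∷ 4 ∷ 5 ∷ 6 ∷ [])
  ∷ (3 ∷ 0 ∷ 1 ∷ 2 ∷ 4 ∷ 5 ∷ 6 ∷ []) ∷ (4 ∷ 0 ∷ 1 ∷ 2 ∷ 3 ∷ 5 ∷ 6 ∷ []) ∷ (5 ∷ 0 ∷ 1 ∷ 2 ∷ 3 ∷ 4 ∷ 6 ∷ []) ∷ (6 ∷ 0 ∷ 1 ∷ 2 ∷ 3 ∷ 4 ∷ 5 ∷ []) ∷ []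

e₁ = record { order = 7 ; edges = (2 , 1) ∷ (4 , 0) ∷ (5 , 1) ∷ (5 , 3) ∷ (5 , 4) ∷ (6 , 2) ∷ (6 , 3) ∷ (6 , 4) ∷ [] ; orders = roots₇ }
e₂ = record { order = 7 ; edges = (1 , 0) ∷ (3 , 2) ∷ (5 , 0) ∷ (5 , 2) ∷ (5 , 4) ∷ (6 , 1) ∷ (6 , 3) ∷ (6 , 4) ∷ [] ; orders = roots₇ }
e₃ = record { order = 7 ; edges = (1 , 0) ∷ (3 , 2) ∷ (4 , 2) ∷ (5 , 3) ∷ (6 , 1) ∷ (6 , 4) ∷ (6 , 5) ∷ [] ; orders = roots₇ }
e₄ = record { order = 7 ; edges = (3 , 2) ∷ (4 , 2) ∷ (5 , 0) ∷ (5 , 3) ∷ (6 , 1) ∷ (6 , 4) ∷ (6 , 5) ∷ [] ; orders = roots₇ }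

-- Layers of a breadth-first search

module Layers {n : ℕ} (ad : Matrix n) (ad-sym : ∀ u v → ad u v ≡ ad v u) (ad-irrefl : ∀ v → ad v v ≡ false) (X : Sub n)
  (connected : Connected ad X) (r : Fin n) (r∈ : r ∈ X) where

  open Search ad ad-sym ad-irrefl X

  Walk : ℕ → Fin n → Set
  Walk zero    v = v ≡ r
  Walk (suc k) v = ∃ λ u → u ∈ X × Walk k u × ad u v ≡ true

  walk? : ∀ v k → Dec (Walk k v)
  walk? v zero    = v F.≟ r
  walk? v (suc k) = F.any? λ u → (u ∈? X) ×-dec walk? u k ×-dec (ad u v 𝔹.≟ true)

  reached : ∀ {v} → v ∈ X → ∃ λ k → Walk k v
  reached v∈ = connected-induction connected (λ u → ∃ λ k → Walk k u) (λ {u} u∈ w∈ e (k , p) → suc k , u , u∈ , p , e) r∈ v∈ (0 , refl)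

  private
    shortest : ∀ {v} → v ∈ X → ∃ λ k → Walk k v × (∀ j → Walk j v → k ≤ j)
    shortest {v} v∈ = let k , p = reached v∈ ; d , q , _ , m = least (walk? v) p in d , q , m

    depth-at : ∀ v → Dec (v ∈ X) → ℕ
    depth-at v (yes v∈) = proj₁ (shortest v∈)
    depth-at v (no _)   = 0

  depth : Fin n → ℕ
  depth v = depth-at v (v ∈? X)

  depth-walk : ∀ {v} → v ∈ X → Walk (depth v) v
  depth-walk {v} v∈ = go (v ∈? X)
    where
    go : ∀ d → Walk (depth-at v d) v
    go (yes p) = proj₁ (proj₂ (shortest p))
    go (no v∉) = contradiction v∈ v∉

  depth-least : ∀ {v k} → v ∈ X → Walk k v → depth v ≤ k
  depth-least {v} {k} v∈ w = go (v ∈? X)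
    where
    go : ∀ d → depth-at v d ≤ k
    go (yes p) = proj₂ (proj₂ (shortest p)) k w
    go (no v∉) = contradiction v∈ v∉

  depth-step : ∀ {u v} → u ∈ X → v ∈ X → ad u v ≡ true → depth v ≤ suc (depth u)
  depth-step {u} u∈ v∈ e = depth-least v∈ (u , u∈ , depth-walk u∈ , e)

  Layer : ℕ → Set
  Layer k = ∃ λ v → v ∈ X × depth v ≡ k

  infix 4 _~_ _≁_
  _~_ _≁_ : ∀ {j k} → Layer j → Layer k → Set
  (u , _) ~ (v , _) = ad u v ≡ true × u ≢ v
  (u , _) ≁ (v , _) = ad u v ≡ false × u ≢ v

  flip : ∀ {j k} (a : Layer j) (b : Layer k) → a ~ b → b ~ a
  flip (u , _) (v , _) (e , ne) = trans (ad-sym v u) e , ne ∘ sym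

  ~-of : ∀ {j k} (a : Layer j) (b : Layer k) → ad (proj₁ a) (proj₁ b) ≡ true → a ~ b
  ~-of (u , _) (v , _) e = e , λ { refl → contradiction (trans (sym e) (ad-irrefl u)) λ () }

  parent : ∀ {k} (a : Layer (suc k)) → Σ (Layer k) λ p → a ~ p
  parent {k} (v , v∈ , d) = back (subst (λ j → Walk j v) d (depth-walk v∈))
    where
    back : Walk (suc k) v → Σ (Layer k) λ p → (v , v∈ , d) ~ p
    back (u , u∈ , w , e) = (u , u∈ , ℕ.≤-antisym (depth-least u∈ w) (ℕ.s≤s⁻¹ (subst (_≤ suc (depth u)) d (depth-step u∈ v∈ e)))) ,
      trans (ad-sym v u) e , λ { refl → contradiction (trans (sym e) (ad-irrefl v)) λ () }

  root : (a : Layer 0) → proj₁ a ≡ r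
  root (v , v∈ , d) = subst (λ j → Walk j v) d (depth-walk v∈)

  -- The gap between the layers is `e + 2`, so that a numeral for `e` makes the depths agree by
  -- computation.
  below : ∀ {k} e (a : Layer k) (b : Layer (suc (suc (e + k)))) → a ≁ b
  below {k} e (u , u∈ , p) (v , v∈ , q) = 𝔹.¬-not (λ uv → ℕ.<⇒≱ (deep uv) (ℕ.m≤n+m k e)) ,
    λ { refl → ℕ.<⇒≢ (ℕ.m≤n⇒m≤1+n (s≤s (ℕ.m≤n+m k e))) (trans (sym p) q) }
    where
    deep : ad u v ≡ true → e + k < k
    deep uv = ℕ.s≤s⁻¹ (subst₂ _≤_ q (cong suc p) (depth-step u∈ v∈ uv))

  above : ∀ {k} e (b : Layer (suc (suc (e + k)))) (a : Layer k) → b ≁ a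
  above e b a = let p , ne = below e a b in trans (ad-sym (proj₁ b) (proj₁ a)) p , ne ∘ sym

  module _ (no-triangle : Avoids triangle) (no-pentagon : Avoids pentagon) (no-heptagon : Avoids heptagon) (no-p₈ : Avoids p₈) where

    private
      Common : ∀ {j} k → Layer j → Layer j → Set
      Common k (u , _) (v , _) = ∃ λ w → w ∈ X × depth w ≡ k × ad u w ≡ true × ad v w ≡ true

      common? : ∀ {j} k (a b : Layer j) → Dec (Common k a b)
      common? k (u , _) (v , _) = F.any? λ w → (w ∈? X) ×-dec (depth w ℕ.≟ k) ×-dec (ad u w 𝔹.≟ true) ×-dec (ad v w 𝔹.≟ true)

      apart-layers : ∀ {k} (a : Layer (suc k)) (b : Layer k) → proj₁ a ≢ proj₁ b
      apart-layers (_ , _ , p) (_ , _ , q) refl = ℕ.1+n≢n (trans (sym p) q)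

      -- A parent shared or seen by both vertices would be a common neighbour in the layer below,
      -- and the parents are not adjacent because that layer is already known to be flat.
      separate : ∀ {j} (a b : Layer (suc j)) (c d : Layer j) → ¬ Common j a b → a ~ c → b ~ d → ¬ (c ~ d) → a ≁ d × b ≁ c × c ≁ d
      separate a b c@(w , w∈ , wj) d@(x , x∈ , xj) nc (uw , _) (vx , _) ncd =
        (𝔹.¬-not (λ ux → nc (x , x∈ , xj , ux , vx)) , apart-layers a d) ,
        (𝔹.¬-not (λ vw → nc (w , w∈ , wj , uw , vw)) , apart-layers b c) ,
        𝔹.¬-not (λ wx → ncd (wx , c≢d)) , c≢d
        where
        c≢d : w ≢ x
        c≢d refl = nc (w , w∈ , wj , uw , vx)

      turn : ∀ {j k} (a : Layer j) (b : Layer k) → a ≁ b → b ≁ a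
      turn (u , _) (v , _) (e , ne) = trans (ad-sym v u) e , ne ∘ sym

      vertices : List (∃ Layer) → List (Fin n)
      vertices = List.map (proj₁ ∘ proj₂)

      forbidden : ∀ p → Avoids p → ∀ l ls → Placed (edges p) (List.upTo (order p)) (vertices (l ∷ ls)) → ⊥
      forbidden p avoids l ls placed = avoids (arrange (edges p) (List.upTo (order p)) _ (vertices ls) placed (λ {v} → inside (l ∷ ls) {v}))
        where
        inside : ∀ ls → InX (vertices ls)
        inside ((_ , _ , v∈ , _) ∷ ls) (here refl) = v∈
        inside (_ ∷ ls)                (there w∈)  = inside ls w∈

      Flat : ℕ → Set
      Flat k = (a b : Layer k) → ¬ (a ~ b)

      -- Following the parents of two adjacent vertices of a layer down to a common ancestor closes a cycle of length 3, 5 or 7,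
      -- or the paths grow to an induced P₈.
      fourth : ∀ j (a b : Layer (suc (suc (suc j)))) (a₁ b₁ : Layer (suc (suc j))) (a₂ b₂ : Layer (suc j)) (a₃ b₃ : Layer j) → a ~ b → a ~ a₁ → b ~ b₁ →
        a ≁ b₁ → b ≁ a₁ → a₁ ≁ b₁ → a₁ ~ a₂ → b₁ ~ b₂ → a₁ ≁ b₂ → b₁ ≁ a₂ → a₂ ≁ b₂ → a₂ ~ a₃ → b₂ ≁ a₃ → a₃ ≁ b₃ → ⊥
      fourth zero    a b a₁ b₁ a₂ b₂ a₃ b₃ _ _ _ _ _ _ _ _ _ _ _ _ _ (_ , ne) = ne (trans (root a₃) (sym (root b₃)))
      fourth (suc j) a b a₁ b₁ a₂ b₂ a₃ b₃ ab aa₁ bb₁ ab₁ ba₁ a₁b₁ a₁a₂ b₁b₂ a₁b₂ b₁a₂ a₂b₂ a₂a₃ b₂a₃ _ = let a₄ , a₃a₄ = parent a₃ in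
        forbidden p₈ no-p₈ (_ , a₄) ((_ , a₃) ∷ (_ , a₂) ∷ (_ , a₁) ∷ (_ , a) ∷ (_ , b) ∷ (_ , b₁) ∷ (_ , b₂) ∷ [])
          ( (flip a₃ a₄ a₃a₄ , below 0 a₄ a₂ , below 1 a₄ a₁ , below 2 a₄ a , below 2 a₄ b , below 1 a₄ b₁ , below 0 a₄ b₂ , tt)
          , (flip a₂ a₃ a₂a₃ , below 0 a₃ a₁ , below 1 a₃ a , below 1 a₃ b , below 0 a₃ b₁ , turn b₂ a₃ b₂a₃ , tt)
          , (flip a₁ a₂ a₁a₂ , below 0 a₂ a , below 0 a₂ b , turn b₁ a₂ b₁a₂ , a₂b₂ , tt)
          , (flip a a₁ aa₁ , turn b a₁ ba₁ , a₁b₁ , a₁b₂ , tt)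
          , (ab , ab₁ , above 0 a b₂ , tt)
          , (bb₁ , above 0 b b₂ , tt)
          , (b₁b₂ , tt)
          , tt , tt )

      third : ∀ j (a b : Layer (suc (suc j))) (a₁ b₁ : Layer (suc j)) (a₂ b₂ : Layer j) → a ~ b → a ~ a₁ → b ~ b₁ →
        a ≁ b₁ → b ≁ a₁ → a₁ ≁ b₁ → a₁ ~ a₂ → b₁ ~ b₂ → a₁ ≁ b₂ → b₁ ≁ a₂ → a₂ ≁ b₂ → (∀ {i} → i < j → Flat i) → ⊥
      third zero    a b a₁ b₁ a₂ b₂ _ _ _ _ _ _ _ _ _ _ (_ , ne) _ = ne (trans (root a₂) (sym (root b₂)))
      third (suc j) a b a₁ b₁ a₂ b₂ ab aa₁ bb₁ ab₁ ba₁ a₁b₁ a₁a₂ b₁b₂ a₁b₂ b₁a₂ a₂b₂ ih with common? j a₂ b₂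
      ... | yes (w , w∈ , wj , p , q) = let c = w , w∈ , wj ; a₂c = ~-of a₂ c p ; b₂c = ~-of b₂ c q in
        forbidden heptagon no-heptagon (_ , a) ((_ , a₁) ∷ (_ , a₂) ∷ (_ , c) ∷ (_ , b₂) ∷ (_ , b₁) ∷ (_ , b) ∷ [])
          ( (aa₁ , above 0 a a₂ , above 1 a c , above 0 a b₂ , ab₁ , ab , tt)
          , (a₁a₂ , above 0 a₁ c , a₁b₂ , a₁b₁ , turn b a₁ ba₁ , tt)
          , (a₂c , a₂b₂ , turn b₁ a₂ b₁a₂ , below 0 a₂ b , tt)
          , (flip b₂ c b₂c , below 0 c b₁ , below 1 c b , tt)
          , (flip b₁ b₂ b₁b₂ , below 0 b₂ b , tt)
          , (flip b b₁ bb₁ , tt)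
          , tt , tt )
      ... | no nc =
        let a₃ , a₂a₃ = parent a₂ ; b₃ , b₂b₃ = parent b₂ ; _ , b₂a₃ , a₃b₃ = separate a₂ b₂ a₃ b₃ nc a₂a₃ b₂b₃ (ih ℕ.≤-refl a₃ b₃)
        in fourth j a b a₁ b₁ a₂ b₂ a₃ b₃ ab aa₁ bb₁ ab₁ ba₁ a₁b₁ a₁a₂ b₁b₂ a₁b₂ b₁a₂ a₂b₂ a₂a₃ b₂a₃ a₃b₃

      second : ∀ j (a b : Layer (suc j)) (a₁ b₁ : Layer j) → a ~ b → a ~ a₁ → b ~ b₁ → a ≁ b₁ → b ≁ a₁ → a₁ ≁ b₁ → (∀ {i} → i < j → Flat i) → ⊥
      second zero    a b a₁ b₁ _ _ _ _ _ (_ , ne) _ = ne (trans (root a₁) (sym (root b₁)))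
      second (suc j) a b a₁ b₁ ab aa₁ bb₁ ab₁ ba₁ a₁b₁ ih with common? j a₁ b₁
      ... | yes (w , w∈ , wj , p , q) = let c = w , w∈ , wj ; a₁c = ~-of a₁ c p ; b₁c = ~-of b₁ c q in
        forbidden pentagon no-pentagon (_ , a) ((_ , a₁) ∷ (_ , c) ∷ (_ , b₁) ∷ (_ , b) ∷ [])
          ( (aa₁ , above 0 a c , ab₁ , ab , tt)
          , (a₁c , a₁b₁ , turn b a₁ ba₁ , tt)
          , (flip b₁ c b₁c , below 0 c b , tt)
          , (flip b b₁ bb₁ , tt)
          , tt , tt )
      ... | no nc =
        let a₂ , a₁a₂ = parent a₁ ; b₂ , b₁b₂ = parent b₁ ; a₁b₂ , b₁a₂ , a₂b₂ = separate a₁ b₁ a₂ b₂ nc a₁a₂ b₁b₂ (ih ℕ.≤-refl a₂ b₂)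
        in third j a b a₁ b₁ a₂ b₂ ab aa₁ bb₁ ab₁ ba₁ a₁b₁ a₁a₂ b₁b₂ a₁b₂ b₁a₂ a₂b₂ (ih ∘ ℕ.m<n⇒m<1+n)

      first : ∀ k → (∀ {i} → i < k → Flat i) → Flat k
      first zero    _  a b (_ , ne) = ne (trans (root a) (sym (root b)))
      first (suc j) ih a b ab with common? j a b
      ... | yes (w , w∈ , wj , p , q) = let c = w , w∈ , wj in
        forbidden triangle no-triangle (_ , a) ((_ , b) ∷ (_ , c) ∷ []) ((ab , ~-of a c p , tt) , (~-of b c q , tt) , tt , tt)
      ... | no nc =
        let a₁ , aa₁ = parent a ; b₁ , bb₁ = parent b ; ab₁ , ba₁ , a₁b₁ = separate a b a₁ b₁ nc aa₁ bb₁ (ih ℕ.≤-refl a₁ b₁)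
        in second j a b a₁ b₁ ab aa₁ bb₁ ab₁ ba₁ a₁b₁ (ih ∘ ℕ.m<n⇒m<1+n)

    flat : ∀ k (a b : Layer k) → ¬ (a ~ b)
    flat = <-rec Flat first

    odd : ℕ → Bool
    odd zero    = false
    odd (suc k) = not (odd k)

    side : Fin n → Bool
    side = odd ∘ depth

    across : ∀ {u v} → u ∈ X → v ∈ X → ad u v ≡ true → side u ≡ not (side v)
    across {u} {v} u∈ v∈ e with ℕ.<-cmp (depth u) (depth v)
    ... | tri< lt _ _ = sym (trans (cong (not ∘ odd) (ℕ.≤-antisym (depth-step u∈ v∈ e) lt)) (𝔹.not-involutive (side u)))
    ... | tri≈ _ eq _ = contradiction (~-of (u , u∈ , refl) (v , v∈ , sym eq) e) (flat (depth u) (u , u∈ , refl) (v , v∈ , sym eq))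
    ... | tri> _ _ gt = cong odd (ℕ.≤-antisym (depth-step v∈ u∈ (trans (ad-sym v u) e)) gt)

-- Bipartite parts

-- On a crossing listed as d, b, y, a, z, c (an induced P₁ + P₅): adjacent to d and to one of a, b, c, and on the side of y and z.
linked : Row → Bool
linked (d ∷ b ∷ y ∷ a ∷ z ∷ c ∷ []) = d ∧ (a ∨ b ∨ c) ∧ not y ∧ not z
linked _                            = false

module Sides {n : ℕ} (ad : Matrix n) (ad-sym : ∀ u v → ad u v ≡ ad v u) (ad-irrefl : ∀ v → ad v v ≡ false) (X : Sub n) (inh : Inhabited X)
  (side : Fin n → Bool) (across : ∀ {u v} → u ∈ X → v ∈ X → ad u v ≡ true → side u ≡ not (side v)) where

  open Search ad ad-sym ad-irrefl X

  infix 4 _~_ _≁_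
  _~_ _≁_ : Fin n → Fin n → Set
  u ~ v = ad u v ≡ true × u ≢ v
  u ≁ v = ad u v ≡ false × u ≢ v

  private
    not-fixed : ∀ {b} → b ≢ not b
    not-fixed {true}  ()
    not-fixed {false} ()

    opposite : ∀ {s u v} → side u ≡ s → side v ≡ not s → side u ≡ not (side v)
    opposite {s} us vs = trans us (sym (trans (cong not vs) (𝔹.not-involutive s)))

    opposite′ : ∀ {s u v} → side u ≡ not s → side v ≡ s → side u ≡ not (side v)
    opposite′ us vs = trans us (cong not (sym vs))

    apart : ∀ {u v} → side u ≡ not (side v) → u ≢ v
    apart e refl = not-fixed e

    joined : ∀ {u v} → side u ≡ not (side v) → ad u v ≡ true → u ~ v
    joined op e = e , apart op

    unjoined : ∀ {u v} → side u ≡ not (side v) → ad u v ≡ false → u ≁ v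
    unjoined op e = e , apart op

    along : ∀ {u v} → u ∈ X → v ∈ X → side u ≡ side v → u ≢ v → u ≁ v
    along u∈ v∈ e ne = 𝔹.¬-not (λ uv → not-fixed (trans (sym e) (across u∈ v∈ uv))) , ne

    distinguish : ∀ (r : Matrix n) {w u v} → r w u ≡ true → r w v ≡ false → u ≢ v
    distinguish r p q refl = contradiction (trans (sym p) q) λ ()

    back : ∀ {u v b} → ad u v ≡ b → ad v u ≡ b
    back {u} {v} = trans (ad-sym v u)

    inside₆ : ∀ {a b c d e f} → a ∈ X → b ∈ X → c ∈ X → d ∈ X → e ∈ X → f ∈ X → InX (a ∷ b ∷ c ∷ d ∷ e ∷ f ∷ [])
    inside₆ p q r s t u (here refl) = p
    inside₆ p q r s t u (there (here refl)) = q
    inside₆ p q r s t u (there (there (here refl))) = r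
    inside₆ p q r s t u (there (there (there (here refl)))) = s
    inside₆ p q r s t u (there (there (there (there (here refl))))) = t
    inside₆ p q r s t u (there (there (there (there (there (here refl)))))) = u

  record Crossing (s : Bool) (y z a b c d : Fin n) : Set where
    constructor crossing
    field
      y∈ : y ∈ X
      z∈ : z ∈ X
      a∈ : a ∈ X
      b∈ : b ∈ X
      c∈ : c ∈ X
      d∈ : d ∈ X
      ys : side y ≡ s
      zs : side z ≡ s
      as : side a ≡ not s
      bs : side b ≡ not s
      cs : side c ≡ not s
      ds : side d ≡ not s
      ya : ad y a ≡ true
      za : ad z a ≡ true
      yb : ad y b ≡ true
      zb : ad z b ≡ false
      yc : ad y c ≡ false
      zc : ad z c ≡ true
      yd : ad y d ≡ false
      zd : ad z d ≡ false

  crossing⇒p₁p₅ : ∀ {s y z a b c d} → Crossing s y z a b c d → Placed (edges p₁p₅) (List.upTo 6) (d ∷ b ∷ y ∷ a ∷ z ∷ c ∷ [])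
  crossing⇒p₁p₅ {s} {y} {z} {a} {b} {c} {d} cr =
    ( along d∈ b∈ (same ds bs) (distinguish ad yb yd ∘ sym) , unjoined (opposite′ ds ys) (back yd) , along d∈ a∈ (same ds as) (distinguish ad ya yd ∘ sym)
    , unjoined (opposite′ ds zs) (back zd) , along d∈ c∈ (same ds cs) (distinguish ad zc zd ∘ sym) , tt )
    , ( joined (opposite′ bs ys) (back yb) , along b∈ a∈ (same bs as) (distinguish ad za zb ∘ sym) , unjoined (opposite′ bs zs) (back zb)
      , along b∈ c∈ (same bs cs) (distinguish ad yb yc) , tt )
    , ( joined (opposite ys as) ya , along y∈ z∈ (same ys zs) (λ { refl → contradiction (trans (sym yb) zb) λ () }) , unjoined (opposite ys cs) yc , tt )
    , ( joined (opposite′ as zs) (back za) , along a∈ c∈ (same as cs) (distinguish ad ya yc) , tt )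
    , ( joined (opposite zs cs) zc , tt )
    , tt , tt
    where
    open Crossing cr
    same : ∀ {t u v} → side u ≡ t → side v ≡ t → side u ≡ side v
    same p q = trans p (sym q)

  crossing⇒occurrence : ∀ {s y z a b c d} → Crossing s y z a b c d → Occurs (edges p₁p₅) (List.upTo 6)
  crossing⇒occurrence {s} {y} {z} {a} {b} {c} {d} cr = arrange (edges p₁p₅) (List.upTo 6) d (b ∷ y ∷ a ∷ z ∷ c ∷ []) (crossing⇒p₁p₅ cr) (λ {v} → inside₆ d∈ b∈ y∈ a∈ z∈ c∈ {v})
    where open Crossing cr

  cross-free-case : (∀ {s y z a b c d} → ¬ Crossing s y z a b c d) → Narrow ad X
  cross-free-case none = more-classes (ℕ.≤ᵇ⇒≤ 4 768 tt) (absorb-labels {t = 4} (key o) (finer o) (CrossFree.cross-free-tree ad ad-sym X side across s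
    (λ y∈ z∈ a∈ b∈ c∈ d∈ ys zs as bs cs ds ya za yb zb yc zc yd zd → none (crossing y∈ z∈ a∈ b∈ c∈ d∈ ys zs as bs cs ds ya za yb zb yc zc yd zd)) o (proj₂ inh)
    (sym (𝔹.not-involutive (side o))) id inh))
    where
    o : Fin n
    o = proj₁ inh
    s : Bool
    -- The fixed vertex `o` has to lie on the side opposite to the neighbourhoods that are
    -- complemented.
    s = not (side o)
    key : Fin n → Fin n → Fin 4
    key o v = combine (bit (side v)) (bit (ad o v))
    finer : ∀ o {u v} → key o u ≡ key o v → (side u , ad o u) ≡ (side v , ad o v)
    finer o {u} {v} e = let p , q = F.combine-injective (bit (side u)) (bit (ad o u)) (bit (side v)) (bit (ad o v)) e in cong₂ _,_ (bit-injective p) (bit-injective q)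

  -- Complementing the pairs between the two sides turns P₁ + P₂ + P₃ into either of the configurations excluded in Bipartite.bipartite-tree.
  bicomplement-case : Avoids p₁p₂p₃ → Narrow ad X
  bicomplement-case avoids = more-classes (ℕ.≤ᵇ⇒≤ 6 768 tt) (absorb-labels {t = 2} (λ v → bit (side v)) bit-injective
    (transform (λ s t b → (s xor t) ∧ not b) restore id (Bipartite.bipartite-tree ad′ ad′-sym X side (λ _ _ → ad′-across) side id S₁₁₃-free Q-free id inh)))
    where
    ad′ : Matrix n
    ad′ u v = (side u xor side v) ∧ not (ad u v)
    ad′-sym : ∀ u v → ad′ u v ≡ ad′ v u
    ad′-sym u v = cong₂ (λ x y → x ∧ not y) (𝔹.xor-comm (side u) (side v)) (ad-sym u v)
    xor-not : ∀ s t → s xor t ≡ true → s ≡ not t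
    xor-not true  false _ = refl
    xor-not false true  _ = refl
    not-xor : ∀ {s t} → s ≡ not t → s xor t ≡ true
    not-xor {t = true}  refl = refl
    not-xor {t = false} refl = refl
    ad′-across : ∀ {u v} → ad′ u v ≡ true → side u ≡ not (side v)
    ad′-across {u} {v} e = xor-not (side u) (side v) (proj₁ (∧-true e))
    restore : ∀ {u v} → u ∈ X → v ∈ X → u ≢ v → ad u v ≡ (side u xor side v) ∧ not (ad′ u v)
    restore {u} {v} u∈ v∈ _ = formula (side u xor side v) (ad u v) (not-xor ∘ across u∈ v∈)
      where
      formula : ∀ x a → (a ≡ true → x ≡ true) → a ≡ x ∧ not (x ∧ not a)
      formula true  a     _ = sym (𝔹.not-involutive a)
      formula false true  f = sym (f refl)
      formula false false _ = refl
    cross : ∀ {u v b} → side u ≡ not (side v) → ad′ u v ≡ b → ad u v ≡ not b × u ≢ v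
    cross {u} {v} op e = trans (sym (𝔹.not-involutive (ad u v))) (cong not (trans (sym (cong (_∧ not (ad u v)) (not-xor op))) e)) , apart op
    back′ : ∀ {u v b} → ad′ u v ≡ b → ad′ v u ≡ b
    back′ {u} {v} = trans (ad′-sym v u)
    far-side : ∀ {s u v} → side u ≡ s → ad′ u v ≡ true → side v ≡ not s
    far-side {u = u} {v} us e = trans (ad′-across (back′ {u} {v} e)) (cong not us)
    near-side : ∀ {s u v} → side v ≡ not s → ad′ u v ≡ true → side u ≡ s
    near-side {s} vs e = trans (ad′-across e) (trans (cong not vs) (𝔹.not-involutive s))
    found : ∀ {z c d b a b′} → z ∈ X → c ∈ X → d ∈ X → b ∈ X → a ∈ X → b′ ∈ X → ∀ s → side c ≡ s → side a ≡ s → side d ≡ not s → side b ≡ not s → side b′ ≡ not s →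
      z ≁ c → z ≁ d → z ≁ b → z ≁ a → z ≁ b′ → c ≢ a → b ≢ b′ → ad′ c d ≡ false → ad′ c b ≡ true → ad′ c b′ ≡ true → ad′ a d ≡ true → ad′ a b ≡ false → ad′ a b′ ≡ false → ⊥
    found {z} {c} {d} {b} {a} {b′} z∈ c∈ d∈ b∈ a∈ b′∈ s cs as ds bs b′s zc zd zb za zb′ c≢a b≢b′ cd cb cb′ ad ab ab′ = avoids
      (arrange (edges p₁p₂p₃) (List.upTo 6) z (c ∷ d ∷ b ∷ a ∷ b′ ∷ [])
        ( (zc , zd , zb , za , zb′ , tt)
        , ( cross (opposite cs ds) cd , cross (opposite cs bs) cb , along c∈ a∈ (trans cs (sym as)) c≢a , cross (opposite cs b′s) cb′ , tt )
        , ( along d∈ b∈ (trans ds (sym bs)) (distinguish ad′ ad ab) , cross (opposite′ ds as) (back′ {a} {d} ad) , along d∈ b′∈ (trans ds (sym b′s)) (distinguish ad′ ad ab′) , tt )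
        , ( cross (opposite′ bs as) (back′ {a} {b} ab) , along b∈ b′∈ (trans bs (sym b′s)) b≢b′ , tt )
        , ( cross (opposite as b′s) ab′ , tt )
        , tt , tt )
        (λ {v} → inside₆ z∈ c∈ d∈ b∈ a∈ b′∈ {v}))
    S₁₁₃-free : ∀ {a c e b b′ d} → a ∈ X → c ∈ X → e ∈ X → b ∈ X → b′ ∈ X → d ∈ X →
      ad′ a e ≡ true → ad′ c e ≡ true → ad′ c b ≡ true → ad′ c b′ ≡ true → b ≢ b′ → ¬ ad′ a b ≡ true → ¬ ad′ a b′ ≡ true → ad′ a d ≡ true → ¬ ad′ c d ≡ true → ⊥
    S₁₁₃-free {a} {c} {e} {b} {b′} {d} a∈ c∈ e∈ b∈ b′∈ d∈ ae ce cb cb′ b≢b′ ab ab′ ad cd =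
      found e∈ c∈ d∈ b∈ a∈ b′∈ (side a) cs refl ds bs b′s
        (cross (opposite′ es cs) (back′ {c} {e} ce)) (along e∈ d∈ (trans es (sym ds)) (distinguish ad′ ce (𝔹.¬-not cd)))
        (along e∈ b∈ (trans es (sym bs)) (distinguish ad′ ae (𝔹.¬-not ab))) (cross (opposite′ es refl) (back′ {a} {e} ae))
        (along e∈ b′∈ (trans es (sym b′s)) (distinguish ad′ ae (𝔹.¬-not ab′)))
        (λ { refl → cd ad }) b≢b′ (𝔹.¬-not cd) cb cb′ ad (𝔹.¬-not ab) (𝔹.¬-not ab′)
      where
      es = far-side {side a} {a} {e} refl ae
      cs = near-side {side a} {c} {e} es ce
      ds = far-side {side a} {a} {d} refl ad
      bs = far-side {side a} {c} {b} cs cb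
      b′s = far-side {side a} {c} {b′} cs cb′
    Q-free : ∀ {x c a b b′ d} → x ∈ X → c ∈ X → a ∈ X → b ∈ X → b′ ∈ X → d ∈ X →
      ad′ x b ≡ true → ad′ x b′ ≡ true → ad′ x d ≡ true → ad′ c b ≡ true → ad′ c b′ ≡ true → b ≢ b′ → ¬ ad′ c d ≡ true → ad′ a d ≡ true → ¬ ad′ a b ≡ true → ¬ ad′ a b′ ≡ true → ⊥
    Q-free {x} {c} {a} {b} {b′} {d} x∈ c∈ a∈ b∈ b′∈ d∈ xb xb′ xd cb cb′ b≢b′ cd ad ab ab′ =
      found x∈ c∈ d∈ b∈ a∈ b′∈ (side x) cs as ds bs b′s
        (along x∈ c∈ (sym cs) (λ { refl → cd xd })) (cross (opposite refl ds) xd) (cross (opposite refl bs) xb)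
        (along x∈ a∈ (sym as) (λ { refl → ab xb })) (cross (opposite refl b′s) xb′)
        (λ { refl → cd ad }) b≢b′ (𝔹.¬-not cd) cb cb′ ad (𝔹.¬-not ab) (𝔹.¬-not ab′)
      where
      ds = far-side {side x} {x} {d} refl xd
      bs = far-side {side x} {x} {b} refl xb
      b′s = far-side {side x} {x} {b′} refl xb′
      cs = near-side {side x} {c} {b} bs cb
      as = near-side {side x} {a} {d} ds ad

  module _ (connected : Connected ad X) (ps : List Pattern) (av : ∀ {p} → p L.∈ ps → Avoids p × valid p ≡ true)
    (check : allL (not ∘ linked) (kinds-of ps p₁p₅ false) ≡ true) where

    unlinked : ∀ {s y z a b c d x} → Crossing s y z a b c d → x ∈ X → side x ≡ s → ad x d ≡ true → ad x a ∨ ad x b ∨ ad x c ≡ true → ⊥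
    unlinked {s} {y} {z} {a} {b} {c} {d} {x} cr x∈ xs xd xabc =
      contradiction (trans (sym (allL-true (not ∘ linked) (kinds-of ps p₁p₅ false) check (kinds-of∈ false (λ ()) (∖∈ X Bs x∈ (x∉ ∘ ∈Bs))))) (cong not is-linked)) λ ()
      where
      open Crossing cr
      open Around ps p₁p₅ ad ad-sym ad-irrefl X av (crossing⇒occurrence cr) using (Bs; ∈Bs; kinds-of∈; typ)
      x∉ : ¬ x L.∈ (d ∷ b ∷ y ∷ a ∷ z ∷ c ∷ [])
      x∉ (here refl) = not-fixed (trans (sym xs) ds)
      x∉ (there (here refl)) = not-fixed (trans (sym xs) bs)
      x∉ (there (there (here refl))) = contradiction (trans (sym xd) yd) λ ()
      x∉ (there (there (there (here refl)))) = not-fixed (trans (sym xs) as)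
      x∉ (there (there (there (there (here refl))))) = contradiction (trans (sym xd) zd) λ ()
      x∉ (there (there (there (there (there (here refl)))))) = not-fixed (trans (sym xs) cs)
      flat : ∀ {v} → v ∈ X → side v ≡ s → ad x v ≡ false
      flat v∈ vs = 𝔹.¬-not (λ e → not-fixed (trans (sym (trans xs (sym vs))) (across x∈ v∈ e)))
      is-linked : linked (typ x) ≡ true
      is-linked = cong₂ _∧_ xd (cong₂ _∧_ xabc (cong₂ (λ p q → not p ∧ not q) (flat y∈ ys) (flat z∈ zs)))

    -- Connectedness attaches `d` to the rest of a crossing. Consider the vertices opposite to `y`
    -- and `z` that are near, meaning adjacent to `y` or `z`, and the vertices of side `s` all of
    -- whose neighbours are near. This set contains `y` but not `d`, so it is not closed: some
    -- vertex of side `s` has a near and a far neighbour. These can be exchanged into the crossing,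
    -- and the vertex becomes linked, which the finite check excludes.
    uncrossed : ∀ {s y z a b c d} → ¬ Crossing s y z a b c d
    uncrossed {s} {y} {z} {a} {b} {c} {d} cr = outside (does⇒ (Q? d) (holds (connected S closed y∈ d∈ (mem (⇒does (Q? y) (inj₂ (ys , λ w _ yw → cong (_∨ ad z w) yw)))))))
      where
      open Crossing cr
      Near : Fin n → Set
      Near w = ad y w ∨ ad z w ≡ true
      Q : Fin n → Set
      Q v = (side v ≡ not s × Near v) ⊎ (side v ≡ s × ∀ w → w ∈ X → ad v w ≡ true → Near w)
      Q? : ∀ v → Dec (Q v)
      Q? v = ((side v 𝔹.≟ not s) ×-dec (_ 𝔹.≟ true)) ⊎-dec ((side v 𝔹.≟ s) ×-dec F.all? λ w → (w ∈? X) →-dec (ad v w 𝔹.≟ true) →-dec (_ 𝔹.≟ true))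
      S : Sub n
      S v = does (Q? v)
      outside : ¬ Q d
      outside (inj₁ (_ , near)) = contradiction (trans (sym near) (cong₂ _∨_ yd zd)) λ ()
      outside (inj₂ (ds′ , _))  = not-fixed (trans (sym ds′) ds)
      -- The far vertex `w` takes the place of `d`. The near vertex `u` takes that of `a`, `b` or
      -- `c` according to whether it is adjacent to both of `y` and `z`, to `y` only or to `z` only.
      replace : ∀ {u w v} → u ∈ X → w ∈ X → v ∈ X → side u ≡ not s → side w ≡ not s → side v ≡ s → ad v u ≡ true → ad v w ≡ true →
        ad y w ≡ false → ad z w ≡ false → ∀ p q → ad y u ≡ p → ad z u ≡ q → p ∨ q ≡ true → ⊥
      replace {u} {w} {v} u∈ w∈ v∈ us ws vs vu vw yw zw true true yu zu _ =
        unlinked (crossing y∈ z∈ u∈ b∈ c∈ w∈ ys zs us bs cs ws yu zu yb zb yc zc yw zw) v∈ vs vw (cong (_∨ ad v b ∨ ad v c) vu)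
      replace {u} {w} {v} u∈ w∈ v∈ us ws vs vu vw yw zw true false yu zu _ =
        unlinked (crossing y∈ z∈ a∈ u∈ c∈ w∈ ys zs as us cs ws ya za yu zu yc zc yw zw) v∈ vs vw (trans (cong (λ t → ad v a ∨ t ∨ ad v c) vu) (𝔹.∨-zeroʳ (ad v a)))
      replace {u} {w} {v} u∈ w∈ v∈ us ws vs vu vw yw zw false true yu zu _ =
        unlinked (crossing y∈ z∈ a∈ b∈ u∈ w∈ ys zs as bs us ws ya za yb zb yu zu yw zw) v∈ vs vw
          (trans (cong (λ t → ad v a ∨ ad v b ∨ t) vu) (trans (cong (ad v a ∨_) (𝔹.∨-zeroʳ (ad v b))) (𝔹.∨-zeroʳ (ad v a))))
      closed : Closed ad X S
      closed {u} {v} u∈ v∈ uv (mem p) = mem (⇒does (Q? v) (next (does⇒ (Q? u) p)))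
        where
        next : Q u → Q v
        next (inj₂ (us , all)) = inj₁ (trans (across v∈ u∈ (back uv)) (cong not us) , all v v∈ uv)
        next (inj₁ (us , near)) = inj₂ (vs , λ w w∈ vw → Dec.decidable-stable (_ 𝔹.≟ true) λ far →
          replace u∈ w∈ v∈ us (trans (across w∈ v∈ (back vw)) (cong not vs)) vs (back uv) vw (fst (𝔹.¬-not far)) (snd (𝔹.¬-not far)) (ad y u) (ad z u) refl refl near)
          where
          vs : side v ≡ s
          vs = trans (across v∈ u∈ (back uv)) (trans (cong not us) (𝔹.not-involutive s))
          fst : ∀ {p q} → p ∨ q ≡ false → p ≡ false
          fst {false} _ = refl
          snd : ∀ {p q} → p ∨ q ≡ false → q ≡ false
          snd {false} e = e

-- Long induced paths

module SevenPath where

  private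
    ps : List Pattern
    ps = triangle ∷ s₁₂₂ ∷ []

    names : List ℕ
    names = List.upTo 7

    base : Config
    base = configuration (edges p₇) names

    kinds : List Row
    kinds = kinds-of ps p₇ false

    path-row : ℕ → Row
    path-row j = List.map (edge (edges p₇) j) names

    nth : ℕ → Row → Bool
    nth _       []      = false
    nth zero    (b ∷ _) = b
    nth (suc k) (_ ∷ r) = nth k r

    next-to : ℕ → Row → ℕ → Bool
    next-to i r k = edge (edges p₇) i k ∧ eqᴿ r (path-row k)

    -- A neighbour of path vertex `i` is regular if it has the type of a neighbour of `i` on the
    -- path; by `twins-agree` it is then a twin of that neighbour.
    regular : ℕ → Row → Bool
    regular i r = anyL (next-to i r) names

    disagree : Row → Bool → Row → ℕ → Bool
    disagree t b d j = eqᴿ t (path-row j) ∧ (b xor nth j d)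

    -- A counterexample would be a vertex with the type of path vertex `j` that some further vertex
    -- `d` distinguishes from `j`. Its absence makes having the type of a path vertex the same as
    -- being its twin.
    twin-preds : List (Row → Row → List Row → Bool)
    twin-preds = (λ _ _ _ → true) ∷ (λ { d (b ∷ _) (t ∷ _) → anyL (disagree t b d) names ; _ _ _ → false }) ∷ []

    twins-agree : Refutation.refute {K = Row} id (λ _ _ _ → false) ps kinds twin-preds base [] ≡ true
    twins-agree = refl

    distinct-rows : ℕ → ℕ → Bool
    distinct-rows i j = (i ℕ.≡ᵇ j) ∨ not (eqᴿ (path-row i) (path-row j))

    rows-differ : allL (λ i → allL (distinct-rows i) names) names ≡ true
    rows-differ = refl

    claw-free : ℕ → ℕ → ℕ → ℕ → Bool
    claw-free i a b c = not (edge (edges p₇) i a ∧ edge (edges p₇) i b ∧ edge (edges p₇) i c) ∨ (a ℕ.≡ᵇ b) ∨ (b ℕ.≡ᵇ c) ∨ (a ℕ.≡ᵇ c)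

    at-most-two : allL (λ i → allL (λ a → allL (λ b → allL (claw-free i a b) names) names) names) names ≡ true
    at-most-two = refl

    path-through : Row → List ℕ → Bool
    path-through r is = occurs (addV r base) (triangular (edges p₇) is)

    extends : Row → Bool
    extends r = zeroᴿ r ∨ anyL (path-through r) (orders p₇)

    on-a-path : allL extends kinds ≡ true
    on-a-path = refl

    second-fine : Row → Bool
    second-fine r = not (nth 1 r) ∨ regular 1 r

    second-regular : allL second-fine kinds ≡ true
    second-regular = refl

    -- The leading `false` stands for the new vertex, which precedes the seven path vertices.
    marked : ℕ → Row
    marked i = false ∷ List.map (i ℕ.≡ᵇ_) names

    masks : ℕ → Row → List Row
    masks i r = marked i ∷ List.map (λ _ → everything (addV r base)) (0 ∷ 2 ∷ 3 ∷ 4 ∷ 5 ∷ 6 ∷ [])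

    from-second : List ℕ
    from-second = 1 ∷ 0 ∷ 2 ∷ 3 ∷ 4 ∷ 5 ∷ 6 ∷ []

    -- The last alternative finds an induced P₇ whose second vertex is path vertex `i`, a position
    -- at which all neighbours are regular by `second-regular`.
    movable : ℕ → Row → Bool
    movable i r = not (nth i r) ∨ regular i r ∨ embed (addV r base) (triangular (edges p₇) from-second) (masks i r)

    moves-to-second : allL (λ i → allL (movable i) kinds) names ≡ true
    moves-to-second = refl

  module LongPath {n : ℕ} (ad : Matrix n) (ad-sym : ∀ u v → ad u v ≡ ad v u) (ad-irrefl : ∀ v → ad v v ≡ false) (X : Sub n) (connected : Connected ad X)
    (av : Cases.Avoiding ad ad-sym ad-irrefl X ps) where

    open Search ad ad-sym ad-irrefl X
    open Cases ad ad-sym ad-irrefl X using (Occurrence-of)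

    On-a-path : Fin n → Set
    On-a-path v = Σ (Occurrence-of p₇) λ o → ∃ λ i → i L.∈ names × proj₁ o i ≡ v

    private
      xor-false : ∀ {a b} → a xor b ≢ true → a ≡ b
      xor-false {true}  {true}  _ = refl
      xor-false {false} {false} _ = refl
      xor-false {true}  {false} f = contradiction refl f
      xor-false {false} {true}  f = contradiction refl f

      anyL-intro : ∀ {A : Set} (f : A → Bool) {xs x} → x L.∈ xs → f x ≡ true → anyL f xs ≡ true
      anyL-intro f {_ ∷ xs} (here refl) e = cong (_∨ anyL f xs) e
      anyL-intro f {y ∷ xs} (there x∈) e = trans (cong (f y ∨_) (anyL-intro f x∈ e)) (𝔹.∨-zeroʳ (f y))

      no-edge : ∀ {i} → i L.∈ names → edge (edges p₇) i i ≡ false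
      no-edge i∈ = not-true (allL-true (λ i → not (edge (edges p₇) i i)) names refl i∈)

      nth-map : ∀ (h : ℕ → Bool) {i} → i L.∈ names → nth i (List.map h names) ≡ h i
      nth-map h (here refl) = refl
      nth-map h (there (here refl)) = refl
      nth-map h (there (there (here refl))) = refl
      nth-map h (there (there (there (here refl)))) = refl
      nth-map h (there (there (there (there (here refl))))) = refl
      nth-map h (there (there (there (there (there (here refl)))))) = refl
      nth-map h (there (there (there (there (there (there (here refl))))))) = refl

      At-map : ∀ (p : ℕ → Bool) (f : ℕ → Fin n) js {x} → At (List.map p js) (List.map f js) x → ∃ λ j → p j ≡ true × x ≡ f j
      At-map p f (j ∷ js) at = go (p j) refl at
        where
        go : ∀ b → p j ≡ b → ∀ {x} → At (b ∷ List.map p js) (f j ∷ List.map f js) x → ∃ λ j → p j ≡ true × x ≡ f j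
        go true e here       = j , e , refl
        go b    e (there at) = At-map p f js at

      At-nowhere : ∀ (g : Config) vs {x} → ¬ At (List.map (λ _ → false) g) vs x
      At-nowhere (_ ∷ g) (v ∷ vs) (there at) = At-nowhere g vs at

      among : List ℕ → ℕ → Bool
      among is k = anyL (k ℕ.≡ᵇ_) is

      reorder : ∀ i is → allL (among (i ∷ is)) names ≡ true → Occurs (edges p₇) (i ∷ is) → Occurrence-of p₇
      reorder i is ok (f , f∈ , o) = f , f∈ ∘ named , λ i∈ j∈ → o (named i∈) (named j∈)
        where
        named : ∀ {j} → j L.∈ names → j L.∈ (i ∷ is)
        named {j} j∈ = let k , k∈ , e = anyL-true (j ℕ.≡ᵇ_) (i ∷ is) (allL-true (among (i ∷ is)) names ok j∈) in subst (L._∈ (i ∷ is)) (sym (≡ᵇ-true j k e)) k∈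

    module _ (occ : Occurrence-of p₇) where

      open Around ps p₇ ad ad-sym ad-irrefl X av occ

      private
        f : ℕ → Fin n
        f = proj₁ occ

        f-ad : ∀ {i j} → i L.∈ names → j L.∈ names → ad (f i) (f j) ≡ edge (edges p₇) i j
        f-ad {i} {j} i∈ j∈ = go (i ℕ.≟ j)
          where
          go : Dec (i ≡ j) → ad (f i) (f j) ≡ edge (edges p₇) i j
          go (yes refl) = trans (ad-irrefl (f i)) (sym (no-edge i∈))
          go (no ne)    = proj₂ (proj₂ (proj₂ occ) i∈ j∈ ne)

        path-typ : ∀ {i} → i L.∈ names → typ (f i) ≡ path-row i
        path-typ {i} i∈ = go names id
          where
          go : ∀ js → (∀ {j} → j L.∈ js → j L.∈ names) → List.map (ad (f i)) (List.map f js) ≡ List.map (edge (edges p₇) i) js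
          go []       _   = refl
          go (j ∷ js) js∈ = cong₂ _∷_ (f-ad i∈ (js∈ (here refl))) (go js (js∈ ∘ there))

        nth-typ : ∀ v {i} → i L.∈ names → nth i (typ v) ≡ ad v (f i)
        nth-typ v = nth-map (ad v ∘ f)

        locate : ∀ {v} → v ∈ X → v ∈ X₀ ⊎ ∃ λ i → i L.∈ names × v ≡ f i
        locate {v} v∈ with v ∈? Bs
        ... | yes p = inj₂ (∈-map⁻ f (∈Bs p))
        ... | no p  = inj₁ (∖∈ X Bs v∈ p)

        new-vertex : ∀ {v} (v∈ : v ∈ X₀) → Distinct (v ∷ bs) × InX (v ∷ bs) × addV (typ v) base ≡ matrix (v ∷ bs)
        new-vertex {v} v∈ = (apart v∈ , bs-distinct) , (λ { (here refl) → X₀⊆X v∈ ; (there w∈) → bs∈ w∈ }) , cong (addV (typ v)) (sym bs-matrix)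

        kin : ∀ {a d j} → a ∈ X → j L.∈ names → typ a ≡ path-row j → d ∈ X₀ → ad a d ≡ nth j (typ d)
        kin {a} {d} {j} a∈ j∈ e d∈ with locate a∈
        ... | inj₂ (i , i∈ , refl) = trans (cong (λ k → ad (f k) d) i≡j) (trans (ad-sym (f j) d) (sym (nth-typ d j∈)))
          where
          i≡j : i ≡ j
          i≡j with ∨-true (allL-true (distinct-rows i) names (allL-true (λ i → allL (distinct-rows i) names) names rows-differ i∈) j∈)
          ... | inj₁ p = ≡ᵇ-true i j p
          ... | inj₂ q = contradiction (trans (sym (not-true q)) (eqᴿ-≡ (trans (sym (path-typ i∈)) e))) λ ()
        ... | inj₁ a∈₀ with a F.≟ d
        ...   | yes refl = trans (ad-irrefl a) (sym (trans (cong (nth j) e) (trans (nth-map (edge (edges p₇) j) j∈) (no-edge j∈))))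
        ...   | no a≢d = trans (ad-sym a d) (xor-false λ x → refutedᵖ twin-preds twins-agree (a ∷ d ∷ [])
          ( a∈₀ , (λ ()) , refl
          , d∈ , (λ { (here refl) p → a≢d (sym p) }) , anyL-intro (disagree (typ a) (ad d a) (typ d)) j∈ (cong₂ _∧_ (eqᴿ-≡ e) x)
          , tt ))
          where open Plain′ kinds typ∈

        path-twins : ∀ {a b j} → a ∈ X → b ∈ X → j L.∈ names → typ a ≡ path-row j → typ b ≡ path-row j → Twins ad ad-sym X a b
        path-twins {a} {b} a∈ b∈ j∈ ea eb {d} d∈ with locate d∈
        ... | inj₁ d∈₀             = trans (kin a∈ j∈ ea d∈₀) (sym (kin b∈ j∈ eb d∈₀))
        ... | inj₂ (i , i∈ , refl) = typ-ad (∈-map⁺ f i∈) (trans ea (sym eb))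

        regular-on-path : ∀ {i w} → i L.∈ names → w ∈ X → w ∈ X₀ ⊎ (Σ ℕ λ k → k L.∈ names × w ≡ f k) → ad (f i) w ≡ true →
          regular i (typ w) ≡ true ⊎ (w ∈ X₀ × nth i (typ w) ≡ true)
        regular-on-path i∈ w∈ (inj₁ p) e = inj₂ (p , trans (nth-typ _ i∈) (trans (ad-sym _ _) e))
        regular-on-path {i} i∈ w∈ (inj₂ (k , k∈ , refl)) e = inj₁ (anyL-intro (next-to i (typ (f k))) k∈ (cong₂ _∧_ (trans (sym (f-ad i∈ k∈)) e) (eqᴿ-≡ (path-typ k∈))))

      -- A path vertex has at most two neighbours on the path, so two of three regular neighbours
      -- are twins of the same path vertex.
      regular-neighbours : ∀ {i} → i L.∈ names → (∀ {w} → w ∈ X → ad (f i) w ≡ true → regular i (typ w) ≡ true) →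
        ∀ {a b c} → a ∈ X → b ∈ X → c ∈ X → ad (f i) a ≡ true → ad (f i) b ≡ true → ad (f i) c ≡ true → Twins ad ad-sym X a b ⊎ Twins ad ad-sym X b c ⊎ Twins ad ad-sym X a c
      regular-neighbours {i} i∈ reg {a} {b} {c} a∈ b∈ c∈ ea eb ec = pick (like a∈ ea) (like b∈ eb) (like c∈ ec)
        where
        Like : Fin n → Set
        Like w = ∃ λ k → k L.∈ names × edge (edges p₇) i k ≡ true × typ w ≡ path-row k
        like : ∀ {w} → w ∈ X → ad (f i) w ≡ true → Like w
        like {w} w∈ e = let k , k∈ , p = anyL-true (next-to i (typ w)) names (reg w∈ e) ; p₁ , p₂ = ∧-true p in k , k∈ , p₁ , eqᴿ-true (typ w) (path-row k) p₂
        pick : Like a → Like b → Like c → Twins ad ad-sym X a b ⊎ Twins ad ad-sym X b c ⊎ Twins ad ad-sym X a c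
        pick (j , j∈ , ij , ta) (k , k∈ , ik , tb) (l , l∈ , il , tc)
          with ∨-true (allL-true (claw-free i j k) names (allL-true (λ b → allL (claw-free i j b) names) names (allL-true (λ a → allL (λ b → allL (claw-free i a b) names) names) names
            (allL-true (λ i → allL (λ a → allL (λ b → allL (claw-free i a b) names) names) names) names at-most-two i∈) j∈) k∈) l∈)
        ... | inj₁ p = contradiction (trans (sym (not-true p)) (cong₂ _∧_ ij (cong₂ _∧_ ik il))) λ ()
        ... | inj₂ p with ∨-true p
        ...   | inj₁ jk = inj₁ (path-twins a∈ b∈ j∈ ta (trans tb (cong path-row (sym (≡ᵇ-true j k jk)))))
        ...   | inj₂ q with ∨-true q
        ...     | inj₁ kl = inj₂ (inj₁ (path-twins b∈ c∈ k∈ tb (trans tc (cong path-row (sym (≡ᵇ-true k l kl))))))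
        ...     | inj₂ jl = inj₂ (inj₂ (path-twins a∈ c∈ j∈ ta (trans tc (cong path-row (sym (≡ᵇ-true j l jl))))))

      second : ∀ {w} → w ∈ X → ad (f 1) w ≡ true → regular 1 (typ w) ≡ true
      second {w} w∈ e with regular-on-path (there (here refl)) w∈ (locate w∈) e
      ... | inj₁ p        = p
      ... | inj₂ (p , q) with ∨-true (allL-true second-fine kinds second-regular (typ∈ p))
      ...   | inj₁ x = contradiction (trans (sym (not-true x)) q) λ ()
      ...   | inj₂ y = y

      -- An irregular neighbour of an end of the path extends it, so that the end becomes the second vertex of another path.
      irregular : ∀ {i w} → i L.∈ names → w ∈ X → ad (f i) w ≡ true → regular i (typ w) ≢ true → Σ (Occurrence-of p₇) λ o → proj₁ o 1 ≡ f i
      irregular {i} {w} i∈ w∈ e nr with regular-on-path i∈ w∈ (locate w∈) e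
      ... | inj₁ p       = contradiction p nr
      ... | inj₂ (p , q) with ∨-true (allL-true (movable i) kinds (allL-true (λ i → allL (movable i) kinds) names moves-to-second i∈) (typ∈ p))
      ...   | inj₁ x = contradiction (trans (sym (not-true x)) q) λ ()
      ...   | inj₂ y with ∨-true y
      ...     | inj₁ z = contradiction z nr
      ...     | inj₂ z =
        let d , inX , m = new-vertex p
            o , first = embed⇒occurs (w ∷ bs) d inX (edges p₇) 1 (0 ∷ 2 ∷ 3 ∷ 4 ∷ 5 ∷ 6 ∷ []) (masks i (typ w))
              (trans (cong (λ g → embed g (triangular (edges p₇) from-second) (masks i (typ w))) (sym m)) z)
        in reorder 1 _ refl o , at-second (first refl)
        where
        at-second : ∀ {x} → At (marked i) (w ∷ bs) x → x ≡ f i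
        at-second (there at) = let j , p , x≡ = At-map (i ℕ.≡ᵇ_) f names at in trans x≡ (cong f (sym (≡ᵇ-true i j p)))

      beside : ∀ {i w} → i L.∈ names → w ∈ X → ad (f i) w ≡ true → On-a-path w
      beside {i} {w} i∈ w∈ e with locate w∈
      ... | inj₂ (k , k∈ , p) = occ , k , k∈ , sym p
      ... | inj₁ p with ∨-true (allL-true extends kinds on-a-path (typ∈ p))
      ...   | inj₁ z = contradiction (trans (sym (trans (ad-sym w (f i)) e)) (zero-nth names i∈ z)) λ ()
        where
        zero-nth : ∀ js → i L.∈ js → zeroᴿ (List.map (ad w) (List.map f js)) ≡ true → ad w (f i) ≡ false
        zero-nth (j ∷ js) (here refl) z = not-true (proj₁ (∧-true z))
        zero-nth (j ∷ js) (there i∈) z  = zero-nth js i∈ (proj₂ (∧-true {not (ad w (f j))} z))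
      ...   | inj₂ z with anyL-true (path-through (typ w)) (orders p₇) z
      ...     | is , is∈ , y = go is is∈ y
        where
        go : ∀ is → is L.∈ orders p₇ → occurs (addV (typ w) base) (triangular (edges p₇) is) ≡ true → On-a-path w
        go []       _   ()
        go (i ∷ is) is∈ y =
          let d , inX , m = new-vertex p
              o , first = embed⇒occurs (w ∷ bs) d inX (edges p₇) i is _ (trans (cong (λ g → occurs g (triangular (edges p₇) (i ∷ is))) (sym m)) y)
          in reorder i is (allL-true (λ is → allL (among is) names) (orders p₇) refl is∈) o , i , in-range is∈ , at-first (first refl)
          where
          at-first : ∀ {x} → At (newest (matrix (w ∷ bs))) (w ∷ bs) x → x ≡ w
          at-first here       = refl
          at-first (there at) = ⊥-elim (At-nowhere (List.zipWith grow-row (typ w) (matrix bs)) bs at)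
          in-range : ∀ {i is} → (i ∷ is) L.∈ orders p₇ → i L.∈ names
          in-range (here refl) = here refl
          in-range (there (here refl)) = there (here refl)
          in-range (there (there (here refl))) = there (there (here refl))
          in-range (there (there (there (here refl)))) = there (there (there (here refl)))

    -- A vertex with a neighbour on an induced P₇ lies on some induced P₇ itself, and connectedness
    -- spreads this to all of `X`.
    everywhere : Occurrence-of p₇ → ∀ {v} → v ∈ X → On-a-path v
    everywhere o v∈ = connected-induction connected On-a-path (λ { u∈ w∈ e (o , i , i∈ , refl) → beside o i∈ w∈ e })
      (proj₁ (proj₂ o) {0} (here refl)) v∈ (o , 0 , here refl , refl)

    long-path-case : Occurrence-of p₇ → Narrow ad X
    long-path-case occ = more-classes (ℕ.≤ᵇ⇒≤ 3 768 tt) (twin-degree≤2-tree ad ad-sym X (λ v∈ → at (everywhere occ v∈)) (proj₁ occ 0 , proj₁ (proj₂ occ) {0} (here refl)))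
      where
      at : ∀ {v a b c} → On-a-path v → a ∈ X → b ∈ X → c ∈ X → ad v a ≡ true → ad v b ≡ true → ad v c ≡ true → Twins ad ad-sym X a b ⊎ Twins ad ad-sym X b c ⊎ Twins ad ad-sym X a c
      at {v} (o , i , i∈ , refl) with F.any? (λ w → (w ∈? X) ×-dec (ad v w 𝔹.≟ true) ×-dec ¬? (regular i (Around.typ ps p₇ ad ad-sym ad-irrefl X av o w) 𝔹.≟ true))
      ... | no none = regular-neighbours o i∈ (λ {w} w∈ e → Dec.decidable-stable (_ 𝔹.≟ true) (λ nr → none (w , w∈ , e , nr)))
      -- An irregular neighbour allows changing to a path on which `v` is the second vertex, where
      -- all neighbours are regular.
      ... | yes (w , w∈ , e , nr) with irregular o i∈ w∈ e nr
      ...   | o′ , p = subst (λ v → ∀ {a b c} → a ∈ X → b ∈ X → c ∈ X → ad v a ≡ true → ad v b ≡ true → ad v c ≡ true → Twins ad ad-sym X a b ⊎ Twins ad ad-sym X b c ⊎ Twins ad ad-sym X a c) p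
        (regular-neighbours o′ {1} (there (here refl)) (second o′))

-- Finite checks

-- A code 2^(i-1) + 2^(i+1), with indices modulo 7, is the type of the twins of heptagon vertex i: 5
-- belongs to 1, 10 to 2, 66 to 0. The pairs listed are those of twins of consecutive vertices.
flips₇ : Edges
flips₇ = (5 , 10) ∷ (5 , 66) ∷ (10 , 20) ∷ (20 , 40) ∷ (33 , 66) ∷ (33 , 80) ∷ (40 , 80) ∷ []

infix 4 _is-one-of_
_is-one-of_ : ℕ → List ℕ → Bool
c is-one-of cs = anyL (c ℕ.≡ᵇ_) cs

-- The tables are indexed by the codes of types: around the pentagon 18 stands for the common neighbours of 1 and 4.
-- They were found by computer search and are certified by the checks below.
witnesses₅ : ℕ → List (ℕ × Bool)
witnesses₅ c = if c ℕ.≡ᵇ 18 then (9 , false) ∷ (4 , true) ∷ [] else []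

excluded₅ : ℕ → ℕ → Bool → Bool
excluded₅ c d true  = (c ℕ.≡ᵇ 18) ∧ (d is-one-of 2 ∷ 8 ∷ 10 ∷ 16 ∷ 18 ∷ 20 ∷ [])
excluded₅ c d false = (c ℕ.≡ᵇ 18) ∧ (d is-one-of 1 ∷ 5 ∷ [])

-- On the twins of pentagon vertices 1, 2, 3, 4 (codes 5, 10, 20, 9) this is a proper colouring.
-- Both neighbours of vertex 0 have class 1, which leaves classes 0 and 2 for the twins of 0 (code
-- 18); the bit chooses between them.
classes₅ : ℕ → Bool → Fin 3
classes₅ c b =
  if c is-one-of 4 ∷ 16 ∷ 20 ∷ [] then zero else
  if c is-one-of 1 ∷ 5 ∷ 9 ∷ [] then suc zero else
  if c is-one-of 2 ∷ 8 ∷ 10 ∷ [] then suc (suc zero) else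
  if b then suc (suc zero) else zero

witnesses₂ : ℕ → List (ℕ × Bool)
witnesses₂ c =
  if c ℕ.≡ᵇ 64 then (32 , true) ∷ [] else
  if c ℕ.≡ᵇ 42 then (69 , false) ∷ [] else []

excluded₂ : ℕ → ℕ → Bool → Bool
excluded₂ c d true  = ((c ℕ.≡ᵇ 64) ∧ (d is-one-of 5 ∷ 21 ∷ 64 ∷ 69 ∷ 96 ∷ [])) ∨ ((c ℕ.≡ᵇ 42) ∧ (d is-one-of 10 ∷ 26 ∷ 32 ∷ 42 ∷ 64 ∷ 96 ∷ []))
excluded₂ c d false = ((c ℕ.≡ᵇ 64) ∧ (d is-one-of 10 ∷ 26 ∷ 42 ∷ [])) ∨ ((c ℕ.≡ᵇ 42) ∧ (d is-one-of 5 ∷ 21 ∷ []))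

classes₂ : ℕ → Bool → Fin 3
classes₂ c b =
  if c is-one-of 32 ∷ 96 ∷ [] then zero else
  if c is-one-of 5 ∷ 21 ∷ 69 ∷ [] then suc zero else
  if c is-one-of 10 ∷ 26 ∷ [] then suc (suc zero) else
  if c ℕ.≡ᵇ 64 then (if b then suc zero else zero) else
  if b then zero else suc (suc zero)

module Checks-P₁P₂P₃ where

  before-e₃ : List Pattern
  before-e₃ = triangle ∷ p₁p₂p₃ ∷ []

  flips-e₃ : Edges
  flips-e₃ = (17 , 38) ∷ (18 , 37) ∷ (25 , 34) ∷ (26 , 33) ∷ []

  check-e₃ : TransitiveCheck.transitive-check before-e₃ e₃ flips-e₃ false ≡ true
  check-e₃ = refl

  before-e₁ : List Pattern
  before-e₁ = triangle ∷ p₁p₂p₃ ∷ e₃ ∷ []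

  flips-e₁ : Edges
  flips-e₁ = (8 , 18) ∷ (8 , 20) ∷ (8 , 37) ∷ (8 , 67) ∷ (11 , 20) ∷ (11 , 64) ∷ (11 , 96) ∷ (13 , 18) ∷ (13 , 32) ∷
    (13 , 96) ∷ (18 , 64) ∷ (18 , 96) ∷ (20 , 32) ∷ (20 , 96) ∷ (24 , 37) ∷ (24 , 67) ∷ (26 , 28) ∷ (26 , 37) ∷
    (26 , 64) ∷ (26 , 96) ∷ (28 , 32) ∷ (28 , 67) ∷ (28 , 96) ∷ (32 , 64) ∷ (32 , 67) ∷ (37 , 64) ∷ []

  check-e₁ : TransitiveCheck.transitive-check before-e₁ e₁ flips-e₁ false ≡ true
  check-e₁ = refl

  before-e₄ : List Pattern
  before-e₄ = triangle ∷ p₁p₂p₃ ∷ e₁ ∷ e₃ ∷ []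

  flips-e₄ : Edges
  flips-e₄ = (10 , 17) ∷ []

  check-e₄ : TransitiveCheck.transitive-check before-e₄ e₄ flips-e₄ false ≡ true
  check-e₄ = refl

  before-heptagon : List Pattern
  before-heptagon = triangle ∷ p₁p₂p₃ ∷ pentagon ∷ []

  check-heptagon : TransitiveCheck.transitive-check before-heptagon heptagon flips₇ false ≡ true
  check-heptagon = refl

  before-e₂ : List Pattern
  before-e₂ = triangle ∷ p₁p₂p₃ ∷ e₁ ∷ e₃ ∷ e₄ ∷ []

  lonely-e₂ : no-lonely before-e₂ e₂ ≡ true
  lonely-e₂ = refl

  check-e₂ : CyclicCheck.cyclic-check before-e₂ e₂ witnesses₂ excluded₂ classes₂ ≡ true
  check-e₂ = refl

  before-pentagon : List Pattern
  before-pentagon = triangle ∷ p₁p₂p₃ ∷ e₁ ∷ e₂ ∷ e₃ ∷ e₄ ∷ []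

  lonely-pentagon : no-lonely before-pentagon pentagon ≡ true
  lonely-pentagon = refl

  check-pentagon : CyclicCheck.cyclic-check before-pentagon pentagon witnesses₅ excluded₅ classes₅ ≡ true
  check-pentagon = refl

module Checks-P₁P₅ where

  before-e₁ : List Pattern
  before-e₁ = triangle ∷ p₁p₅ ∷ []

  flips-e₁ : Edges
  flips-e₁ = (9 , 16) ∷ (9 , 96) ∷ (11 , 16) ∷ (11 , 36) ∷ (11 , 96) ∷ (13 , 16) ∷ (13 , 66) ∷ (13 , 96) ∷ (16 , 97) ∷
    (26 , 36) ∷ (26 , 96) ∷ (26 , 97) ∷ (28 , 66) ∷ (28 , 96) ∷ (28 , 97) ∷ (36 , 66) ∷ []

  check-e₁ : TransitiveCheck.transitive-check before-e₁ e₁ flips-e₁ false ≡ true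
  check-e₁ = refl

  before-e₂ : List Pattern
  before-e₂ = triangle ∷ p₁p₅ ∷ []

  flips-e₂ : Edges
  flips-e₂ = (21 , 34) ∷ (21 , 40) ∷ (21 , 96) ∷ (22 , 40) ∷ (22 , 65) ∷ (22 , 96) ∷ (25 , 34) ∷ (25 , 68) ∷ (25 , 96) ∷
    (26 , 65) ∷ (26 , 68) ∷ (26 , 96) ∷ (34 , 65) ∷ (40 , 68) ∷ []

  check-e₂ : TransitiveCheck.transitive-check before-e₂ e₂ flips-e₂ false ≡ true
  check-e₂ = refl

  before-e₃ : List Pattern
  before-e₃ = triangle ∷ p₁p₅ ∷ []

  flips-e₃ : Edges
  flips-e₃ = (2 , 49) ∷ (2 , 65) ∷ (24 , 36) ∷ (24 , 68) ∷ (36 , 72) ∷ (49 , 68) ∷ (49 , 72) ∷ (50 , 65) ∷ (50 , 68) ∷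
    (50 , 72) ∷ []

  check-e₃ : TransitiveCheck.transitive-check before-e₃ e₃ flips-e₃ false ≡ true
  check-e₃ = refl

  before-heptagon : List Pattern
  before-heptagon = triangle ∷ p₁p₅ ∷ pentagon ∷ []

  check-heptagon : TransitiveCheck.transitive-check before-heptagon heptagon flips₇ false ≡ true
  check-heptagon = refl

  before-pentagon : List Pattern
  before-pentagon = triangle ∷ p₁p₅ ∷ e₁ ∷ e₂ ∷ e₃ ∷ []

  lonely-pentagon : no-lonely before-pentagon pentagon ≡ true
  lonely-pentagon = refl

  check-pentagon : CyclicCheck.cyclic-check before-pentagon pentagon witnesses₅ excluded₅ classes₅ ≡ true
  check-pentagon = refl

module Checks-S₁₂₂ where

  before-heptagon : List Pattern
  before-heptagon = triangle ∷ s₁₂₂ ∷ pentagon ∷ []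

  lonely-heptagon : no-lonely before-heptagon heptagon ≡ true
  lonely-heptagon = refl

  check-heptagon : TransitiveCheck.transitive-check before-heptagon heptagon flips₇ true ≡ true
  check-heptagon = refl

  before-pentagon : List Pattern
  before-pentagon = triangle ∷ s₁₂₂ ∷ []

  lonely-pentagon : no-lonely before-pentagon pentagon ≡ true
  lonely-pentagon = refl

  check-pentagon : CyclicCheck.cyclic-check before-pentagon pentagon witnesses₅ excluded₅ classes₅ ≡ true
  check-pentagon = refl

  check-unlinked : allL (not ∘ linked) (kinds-of (s₁₂₂ ∷ p₇ ∷ []) p₁p₅ false) ≡ true
  check-unlinked = refl

-- Bounded clique-width

module Part {n : ℕ} (ad : Matrix n) (ad-sym : ∀ u v → ad u v ≡ ad v u) (ad-irrefl : ∀ v → ad v v ≡ false) (X : Sub n) (connected : Connected ad X) (inh : Inhabited X) where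

  open Search ad ad-sym ad-irrefl X using (Avoids)
  open Cases ad ad-sym ad-irrefl X

  private
    transitive : ∀ ps base → order base ≤ 7 → 0 < order base → Avoiding ps → ∀ flips → TransitiveCheck.transitive-check ps base flips false ≡ true → Occurrence-of base → Narrow ad X
    transitive ps base small nonempty av flips check o = transitive-case ps base small nonempty connected inh av o flips false (λ ()) check

    cyclic : ∀ ps base → order base ≤ 7 → 0 < order base → Avoiding ps → ∀ witnesses excluded classes → no-lonely ps base ≡ true →
      CyclicCheck.cyclic-check ps base witnesses excluded classes ≡ true → Occurrence-of base → Narrow ad X
    cyclic ps base small nonempty av witnesses excluded classes lonely check o =
      cyclic-case ps base small nonempty connected inh av o witnesses excluded classes lonely check

    upto : ∀ {m n} → (m ℕ.≤ᵇ n) ≡ true → m ≤ n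
    upto {m} {n} e = ℕ.≤ᵇ⇒≤ m n (subst Data.Bool.T (sym e) tt)

    bipartite-case : Avoids triangle → Avoids pentagon → Avoids heptagon → Avoids p₈ →
      (∀ (side : Fin n → Bool) → (∀ {u v} → u ∈ X → v ∈ X → ad u v ≡ true → side u ≡ not (side v)) → Narrow ad X) → Narrow ad X
    bipartite-case no-triangle no-pentagon no-heptagon no-p₈ rest = rest (side no-triangle no-pentagon no-heptagon no-p₈) (across no-triangle no-pentagon no-heptagon no-p₈)
      where open Layers ad ad-sym ad-irrefl X connected (proj₁ inh) (proj₂ inh)

  p₁p₂p₃-narrow : Avoids triangle → Avoids p₁p₂p₃ → Narrow ad X
  p₁p₂p₃-narrow no-triangle no-p₁p₂p₃ =
    either inh e₃ refl (transitive before-e₃ e₃ (upto refl) (upto refl) (T ▷ H ▷ none) flips-e₃ check-e₃) λ E₃ →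
    either inh e₁ refl (transitive before-e₁ e₁ (upto refl) (upto refl) (T ▷ H ▷ E₃ ▷ none) flips-e₁ check-e₁) λ E₁ →
    either inh e₄ refl (transitive before-e₄ e₄ (upto refl) (upto refl) (T ▷ H ▷ E₁ ▷ E₃ ▷ none) flips-e₄ check-e₄) λ E₄ →
    either inh e₂ refl (cyclic before-e₂ e₂ (upto refl) (upto refl) (T ▷ H ▷ E₁ ▷ E₃ ▷ E₄ ▷ none) witnesses₂ excluded₂ classes₂ lonely-e₂ check-e₂) λ E₂ →
    either inh pentagon refl (cyclic before-pentagon pentagon (upto refl) (upto refl) (T ▷ H ▷ E₁ ▷ E₂ ▷ E₃ ▷ E₄ ▷ none) witnesses₅ excluded₅ classes₅ lonely-pentagon check-pentagon) λ C₅ →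
    either inh heptagon refl (transitive before-heptagon heptagon (upto refl) (upto refl) (T ▷ H ▷ C₅ ▷ none) flips₇ check-heptagon) λ C₇ →
    -- P₈ is excluded because it contains P₁ + P₂ + P₃, which `prune` detects through an end vertex.
    bipartite-case no-triangle (proj₁ C₅) (proj₁ C₇) (avoids-larger (triangle ∷ p₁p₂p₃ ∷ []) (T ▷ H ▷ none) p₈ refl) λ side across →
    Sides.bicomplement-case ad ad-sym ad-irrefl X inh side across no-p₁p₂p₃
    where
    open Checks-P₁P₂P₃
    T : Avoids triangle × valid triangle ≡ true
    T = no-triangle , refl
    H : Avoids p₁p₂p₃ × valid p₁p₂p₃ ≡ true
    H = no-p₁p₂p₃ , refl

  p₁p₅-narrow : Avoids triangle → Avoids p₁p₅ → Narrow ad X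
  p₁p₅-narrow no-triangle no-p₁p₅ =
    either inh e₁ refl (transitive before-e₁ e₁ (upto refl) (upto refl) (T ▷ H ▷ none) flips-e₁ check-e₁) λ E₁ →
    either inh e₂ refl (transitive before-e₂ e₂ (upto refl) (upto refl) (T ▷ H ▷ none) flips-e₂ check-e₂) λ E₂ →
    either inh e₃ refl (transitive before-e₃ e₃ (upto refl) (upto refl) (T ▷ H ▷ none) flips-e₃ check-e₃) λ E₃ →
    either inh pentagon refl (cyclic before-pentagon pentagon (upto refl) (upto refl) (T ▷ H ▷ E₁ ▷ E₂ ▷ E₃ ▷ none) witnesses₅ excluded₅ classes₅ lonely-pentagon check-pentagon) λ C₅ →
    either inh heptagon refl (transitive before-heptagon heptagon (upto refl) (upto refl) (T ▷ H ▷ C₅ ▷ none) flips₇ check-heptagon) λ C₇ →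
    bipartite-case no-triangle (proj₁ C₅) (proj₁ C₇) (avoids-larger (triangle ∷ p₁p₅ ∷ []) (T ▷ H ▷ none) p₈ refl) λ side across →
    let open Sides ad ad-sym ad-irrefl X inh side across in cross-free-case (no-p₁p₅ ∘ crossing⇒occurrence)
    where
    open Checks-P₁P₅
    T : Avoids triangle × valid triangle ≡ true
    T = no-triangle , refl
    H : Avoids p₁p₅ × valid p₁p₅ ≡ true
    H = no-p₁p₅ , refl

  s₁₂₂-narrow : Avoids triangle → Avoids s₁₂₂ → Narrow ad X
  s₁₂₂-narrow no-triangle no-s₁₂₂ =
    either inh p₇ refl (SevenPath.LongPath.long-path-case ad ad-sym ad-irrefl X connected (T ▷ H ▷ none)) λ L →
    either inh pentagon refl (cyclic before-pentagon pentagon (upto refl) (upto refl) (T ▷ H ▷ none) witnesses₅ excluded₅ classes₅ lonely-pentagon check-pentagon) λ C₅ →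
    either inh heptagon refl (λ o → transitive-case before-heptagon heptagon (upto refl) (upto refl) connected inh (T ▷ H ▷ C₅ ▷ none) o flips₇ true (λ _ → lonely-heptagon) check-heptagon) λ C₇ →
    -- P₈ contains the P₇ that has been dealt with already.
    bipartite-case no-triangle (proj₁ C₅) (proj₁ C₇) (avoids-larger (p₇ ∷ []) (L ▷ none) p₈ refl) λ side across →
    let open Sides ad ad-sym ad-irrefl X inh side across in cross-free-case (uncrossed connected (s₁₂₂ ∷ p₇ ∷ []) (H ▷ L ▷ none) check-unlinked)
    where
    open Checks-S₁₂₂
    T : Avoids triangle × valid triangle ≡ true
    T = no-triangle , refl
    H : Avoids s₁₂₂ × valid s₁₂₂ ≡ true
    H = no-s₁₂₂ , refl

module _ {n : ℕ} (G : Graph n) where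

  adjᵇ-sym : ∀ u v → adjᵇ G u v ≡ adjᵇ G v u
  adjᵇ-sym u v = does-⇔ (adj? G u v) (adj? G v u) (adj-sym G) (adj-sym G)

  adjᵇ-irrefl : ∀ v → adjᵇ G v v ≡ false
  adjᵇ-irrefl v = 𝔹.¬-not (λ e → adj-irrefl G (does⇒ (adj? G v v) e))

narrow⇒bounded : ∀ {m} (H : Graph m) p → order p ≡ m →
  does (F.all? λ u → F.all? λ v → edge (edges p) (toℕ u) (toℕ v) 𝔹.≟ adjᵇ H u v) ≡ true →
  (∀ {n} (ad : Matrix n) (ad-sym : ∀ u v → ad u v ≡ ad v u) (ad-irrefl : ∀ v → ad v v ≡ false) X → Connected ad X → Inhabited X →
    Search.Avoids ad ad-sym ad-irrefl X triangle → Search.Avoids ad ad-sym ad-irrefl X p → Narrow ad X) →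
  BoundedCliqueWidth (Free (K 3) H)
narrow⇒bounded H p refl check narrow = bounded-cliqueWidth (Free (K 3) H) (3 * 768) build
  where
  build : ∀ n .{{_ : NonZero n}} (G : Graph n) → Free (K 3) H G → Constructible (3 * 768) G
  build (suc n) G (no-triangle , no-H) = tree⇒constructible G (proj₂ (by-components (adjᵇ-sym G) (λ _ → true)
    (λ X _ inh connected → narrow (adjᵇ G) (adjᵇ-sym G) (adjᵇ-irrefl G) X connected inh
      (no-triangle ∘ occurrence⇒⊴ (K 3) G (adjᵇ-sym G) (adjᵇ-irrefl G) X (edges triangle) refl)
      (no-H ∘ occurrence⇒⊴ H G (adjᵇ-sym G) (adjᵇ-irrefl G) X (edges p) check))
    (zero , mem refl)))

theorem3 : BoundedCliqueWidth (Free (K 3) (P 1 ⊕ P 5)) × BoundedCliqueWidth (Free (K 3) S₁₂₂) × BoundedCliqueWidth (Free (K 3) (P 1 ⊕ P 2 ⊕ P 3))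
theorem3 =
  narrow⇒bounded (P 1 ⊕ P 5) p₁p₅ refl refl Part.p₁p₅-narrow ,
  narrow⇒bounded S₁₂₂ s₁₂₂ refl refl Part.s₁₂₂-narrow ,
  narrow⇒bounded (P 1 ⊕ P 2 ⊕ P 3) p₁p₂p₃ refl refl Part.p₁p₂p₃-narrow
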